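{- Let $m\ge 2$ and $n\ge 2$ be integers, and let $T_{n,m}$ denote the number of pairs $(T,t)$ where $T$ is a tree on the vertex set $\{1,\dots,n\}$ and $t\colon\{1,\dots,n\}\to\{1,\dots,m\}$ is a function (not necessarily surjective) whose image has at least two elements, such that adjacent vertices $v,v'$ satisfy $t(v)\ne t(v')$, and if $v,v'$ are adjacent with $v>v'$ then $t(v)>t(v')$. Then \[ T_{n,m}=\frac{1}{n\,m^{n-1}}\sum_{\substack{k_1,\dots,k_m\ge 0\\ k_1+\dots+k_m=n}}\binom{n}{k_1,k_2,\dots,k_m}\bigl((m-1)k_1+(m-2)k_2+\dots+1\cdot k_{m-1}\bigr)^{n-1}. \]
   Context: Such pairs $(T,t)$ are called (properly or improperly) tiered trees with $m$ tiers; "properly" means $t$ is surjective. For $n\ge2$ the condition that the image of $t$ has at least two elements is automatic. -}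

module Defs where

open import Data.Bool using (Bool; true; false; _∧_; _∨_; not; if_then_else_)
open import Data.Nat using (ℕ; zero; suc; _+_; _*_; _^_)
open import Data.Nat.Combinatorics using (_C_)
open import Data.Fin using (Fin; toℕ; inject₁; fromℕ)
open import Data.Fin.Properties using (_<?_)
import Data.Fin as F
open import Data.List using (List; []; _∷_; [_]; map; concatMap; allFin; tabulate; applyUpTo)
open import Data.Bool.ListAction using (any; all)
open import Data.Nat.ListAction using (sum)
open import Relation.Nullary.Decidable using (⌊_⌋)

-- Finite enumeration helpers (vertices are Fin n = {0,…,n-1}, order-preserving
-- relabelling of {1,…,n}; tiers are Fin m, order-preserving relabelling of {1,…,m}).

funs : ∀ {A : Set} → List A → (k : ℕ) → List (Fin k → A)
funs xs zero    = [ (λ ()) ]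
funs xs (suc k) = concatMap (λ x → map (λ f → cons x f) (funs xs k)) xs
  where
  cons : _ → (Fin _ → _) → Fin (suc _) → _
  cons x f Fin.zero    = x
  cons x f (Fin.suc i) = f i

anyFin : (n : ℕ) → (Fin n → Bool) → Bool
anyFin n p = any p (allFin n)

allFin? : (n : ℕ) → (Fin n → Bool) → Bool
allFin? n p = all p (allFin n)

_≡ᵇ_ : ∀ {n} → Fin n → Fin n → Bool
i ≡ᵇ j = ⌊ i F.≟ j ⌋

_<ᵇ_ : ∀ {n} → Fin n → Fin n → Bool
i <ᵇ j = ⌊ i <? j ⌋

_⇔ᵇ_ : Bool → Bool → Bool
true  ⇔ᵇ b = b
false ⇔ᵇ b = not b

_⇒ᵇ_ : Bool → Bool → Bool
a ⇒ᵇ b = not a ∨ b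

count : ∀ {A : Set} → (A → Bool) → List A → ℕ
count p []       = 0
count p (x ∷ xs) = if p x then suc (count p xs) else count p xs

Graph : ℕ → Set
Graph n = Fin n → Fin n → Bool

allGraphs : (n : ℕ) → List (Graph n)
allGraphs n = funs (funs (true ∷ false ∷ []) n) n

isSimple : ∀ {n} → Graph n → Bool
isSimple {n} g = allFin? n λ i → allFin? n λ j → (g i j ⇔ᵇ g j i) ∧ not (g i i)

reach : ∀ {n} → Graph n → ℕ → Fin n → Fin n → Bool
reach g zero    i j = i ≡ᵇ j
reach {n} g (suc k) i j = reach g k i j ∨ anyFin n (λ l → reach g k i l ∧ g l j)

isConnected : ∀ {n} → Graph n → Bool
isConnected {n} g = allFin? n λ i → allFin? n λ j → reach g n i j

injectiveᵇ : ∀ {k n} → (Fin k → Fin n) → Bool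
injectiveᵇ {k} s = allFin? k λ i → allFin? k λ j → (s i ≡ᵇ s j) ⇒ᵇ (i ≡ᵇ j)

isCycle : ∀ {n} → Graph n → (k : ℕ) → (Fin (suc k) → Fin n) → Bool
isCycle g k s =
  injectiveᵇ s
  ∧ (allFin? k λ i → g (s (inject₁ i)) (s (Fin.suc i)))
  ∧ g (s (fromℕ k)) (s Fin.zero)

-- cycle lengths 3 … n+2 are tried (longer sequences cannot be injective anyway)
hasCycle : ∀ {n} → Graph n → Bool
hasCycle {n} g = any (λ k → any (isCycle g k) (funs (allFin n) (suc k))) (applyUpTo (λ j → 2 + j) n)

isTree : ∀ {n} → Graph n → Bool
isTree g = isSimple g ∧ isConnected g ∧ not (hasCycle g)

isTiering : ∀ {n m} → Graph n → (Fin n → Fin m) → Bool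
isTiering {n} g t =
  (anyFin n λ i → anyFin n λ j → not (t i ≡ᵇ t j))
  ∧ (allFin? n λ v → allFin? n λ v' → g v v' ⇒ᵇ not (t v ≡ᵇ t v'))
  ∧ (allFin? n λ v → allFin? n λ v' → (g v v' ∧ (v' <ᵇ v)) ⇒ᵇ (t v' <ᵇ t v))

tieredCount : ℕ → ℕ → ℕ
tieredCount n m =
  sum (map (λ g → if isTree g then count (isTiering g) (funs (allFin m) n) else 0)
           (allGraphs n))

multinomial : List ℕ → ℕ
multinomial []       = 1
multinomial (k ∷ ks) = ((k + sum ks) C k) * multinomial ks

compositions : (m n : ℕ) → List (Fin m → ℕ)
compositions m n = map (λ k i → toℕ (k i))
  (filterSum (funs (allFin (suc n)) m))
  where
  sumOf : (Fin m → Fin (suc n)) → ℕ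
  sumOf k = sum (tabulate (λ i → toℕ (k i)))
  filterSum : List (Fin m → Fin (suc n)) → List (Fin m → Fin (suc n))
  filterSum [] = []
  filterSum (k ∷ ks) = if ⌊ sumOf k Data.Nat.≟ n ⌋ then k ∷ filterSum ks else filterSum ks

-- (m-1)k₁ + (m-2)k₂ + … + 1·k_{m-1} + 0·k_m   (index i : Fin m stands for i+1)
weight : (m : ℕ) → (Fin m → ℕ) → ℕ
weight m k = sum (tabulate (λ i → (m Data.Nat.∸ suc (toℕ i)) * k i))

rhsSum : (n m : ℕ) → ℕ
rhsSum n m = sum (map (λ k → multinomial (tabulate k) * weight m k ^ (n Data.Nat.∸ 1))
                      (compositions m n))

{-# OPTIONS --safe #-}

-- Removing the smallest vertex of a tiered tree, of tier i say, leaves a forest of rooted trees whose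
-- roots have tiers j > i.  If R_j counts the rooted tiered trees with root of tier j, then R_i = R_{i+1}:
-- look at the component of the root in the part of the tree coloured by the tiers i and i + 1, and there
-- reverse the labels and exchange the two tiers.  So all R_j agree and the generating function R of
-- any of them satisfies m R = z (1 + e^R + … + e^{(m-1)R}).  The same equation governs the rooted
-- labelled trees in which each vertex v has a weight s(v) ∈ {0 , … , m - 1} and contributes a factor
-- s(v) for each of its children, and for fixed s the weighted count of these is (∑ s)^(n-1).

module Submission where

open import Defs
open import Data.Bool using (Bool; true; false; if_then_else_; _∧_; _∨_; not)
open import Data.Fin using (Fin; toℕ)
import Data.Fin as Fin
import Data.Fin.Properties as Fin
open import Data.Fin.Relation.Unary.Top using (view; ‵fromℕ; ‵inject₁)
open import Data.Bool.ListAction using (any; all)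
open import Data.Bool.Properties using (∨-zeroʳ)
open import Data.Nat.Combinatorics using (nCk+nC[k+1]≡[n+1]C[k+1]; k>n⇒nCk≡0) renaming (_C_ to _choose_)
open import Relation.Binary.Definitions using (Tri; tri<; tri≈; tri>)
open import Relation.Nullary.Decidable using (⌊_⌋)
open import Data.Nat using (ℕ; zero; suc; _+_; _*_; _^_; _≤_; _<_; _∸_; z≤n; s≤s; s≤s⁻¹)
open import Data.Nat.Properties
open import Data.Nat.ListAction using (sum)
open import Data.Nat.ListAction.Properties using (sum-↭)
open import Data.Nat.Tactic.RingSolver using (solve-∀)
open import Data.Product using (_×_; _,_; proj₁; proj₂; ∃)
open import Data.Sum using (_⊎_; inj₁; inj₂)
open import Data.Empty using (⊥)
open import Data.Unit using (⊤; tt)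
open import Data.List.Relation.Unary.AllPairs as AllPairs using (AllPairs; []; _∷_)
import Data.List.Relation.Unary.AllPairs.Properties as AllPairs
open import Relation.Nullary using (yes; no; contradiction)
open import Data.List using (List; []; _∷_; _++_; map; length; tabulate; allFin; concatMap; lookup; applyUpTo)
open import Data.List.Properties using (length-++; map-cong; length-map; tabulate-cong; map-tabulate; length-tabulate)
open import Data.List.Relation.Binary.Permutation.Propositional as Perm using (_↭_; ↭-sym; ↭-trans; ↭-refl; prep)
open import Data.List.Relation.Binary.Permutation.Propositional.Properties using (↭-length; shift)
import Data.List.Relation.Binary.Permutation.Propositional.Properties as ↭
open import Data.List.Relation.Ternary.Interleaving.Propositional using (Interleaving; consˡ; consʳ; toPermutation) renaming ([] to []ⁱ)
open import Relation.Binary.PropositionalEquality using (_≡_; _≢_; _≗_; refl; sym; trans; cong; cong₂; subst; module ≡-Reasoning)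
open import Data.List.Relation.Unary.All as All using (All; []; _∷_)
open import Data.List.Relation.Unary.Any as Any using (here; there)
import Data.List.Relation.Unary.All.Properties as All
open import Data.List.Membership.Propositional using (_∈_)
open import Data.List.Membership.Propositional.Properties using (∈-∃++; ∈-allFin; ∈-++⁻; ∈-lookup; ∈-map⁺; ∈-concatMap⁺; ∈-applyUpTo⁺; ∈-applyUpTo⁻)
open import Data.List.Relation.Unary.Unique.Propositional.Properties using (allFin⁺)
open ≡-Reasoning

-- Power series never appear. `Spl` distributes a list of labels over two factors and so takes the
-- place of the product of exponential generating functions; the equation for R becomes identities
-- by induction on the length of the list, with powers of `m` on one side instead of divisions.
-- Tiered trees and comparison trees are values of one weight, `Forest.forest`, with edge weights
-- `w` and root weights `a`. Two facts stand behind the equation. Admissibility of an edge is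
-- symmetric, so the weight of trees does not depend on the root; hence the sum of all R_j counts
-- every tiered tree on n vertices n times. And a tier other than i and i + 1 compares in the same
-- way with both, so what hangs off the two-coloured component depends on its labels only and
-- survives the exchange. The link to Boolean graphs goes through parent maps: weights of trees are
-- expanded over all of them, and a tree belongs to exactly one parent map towards the smallest
-- vertex.

private variable
  A B X Y : Set

-- Sums over splittings of a list

∑ : List A → (A → ℕ) → ℕ
∑ xs f = sum (map f xs)

∑-cong : ∀ (xs : List A) {f g : A → ℕ} → (∀ x → f x ≡ g x) → ∑ xs f ≡ ∑ xs g
∑-cong xs f≗g = cong sum (map-cong f≗g xs)

+-interchange : ∀ a b c d → (a + b) + (c + d) ≡ (a + c) + (b + d)
+-interchange = solve-∀

+-left-comm : ∀ a b c → a + (b + c) ≡ b + (a + c)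
+-left-comm = solve-∀

∑-+ : ∀ (xs : List A) (f g : A → ℕ) → ∑ xs (λ x → f x + g x) ≡ ∑ xs f + ∑ xs g
∑-+ []       f g = refl
∑-+ (x ∷ xs) f g = trans (cong (f x + g x +_) (∑-+ xs f g)) (+-interchange (f x) (g x) _ _)

∑-* : ∀ k (xs : List A) (f : A → ℕ) → ∑ xs (λ x → k * f x) ≡ k * ∑ xs f
∑-* k []       f = sym (*-zeroʳ k)
∑-* k (x ∷ xs) f = trans (cong (k * f x +_) (∑-* k xs f)) (sym (*-distribˡ-+ k _ _))

∑-*ʳ : ∀ k (xs : List A) (f : A → ℕ) → ∑ xs (λ x → f x * k) ≡ ∑ xs f * k
∑-*ʳ k xs f = trans (∑-cong xs (λ x → *-comm (f x) k)) (trans (∑-* k xs f) (*-comm k _))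

∑-0 : ∀ (xs : List A) → ∑ xs (λ _ → 0) ≡ 0
∑-0 []       = refl
∑-0 (x ∷ xs) = ∑-0 xs

∑-swap : ∀ (xs : List A) (ys : List B) (f : A → B → ℕ) →
  ∑ xs (λ x → ∑ ys (f x)) ≡ ∑ ys (λ y → ∑ xs (λ x → f x y))
∑-swap []       ys f = sym (∑-0 ys)
∑-swap (x ∷ xs) ys f = trans (cong (∑ ys (f x) +_) (∑-swap xs ys f)) (sym (∑-+ ys (f x) _))

∑-++ : ∀ (xs ys : List A) (f : A → ℕ) → ∑ (xs ++ ys) f ≡ ∑ xs f + ∑ ys f
∑-++ []       ys f = refl
∑-++ (x ∷ xs) ys f = trans (cong (f x +_) (∑-++ xs ys f)) (sym (+-assoc (f x) _ _))

∑-↭ : ∀ {xs ys : List A} (f : A → ℕ) → xs ↭ ys → ∑ xs f ≡ ∑ ys f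
∑-↭ f p = sum-↭ (↭.map⁺ f p)

∏ : List A → (A → ℕ) → ℕ
∏ []       f = 1
∏ (x ∷ xs) f = f x * ∏ xs f

∏-cong : ∀ (xs : List A) {f g : A → ℕ} → (∀ x → f x ≡ g x) → ∏ xs f ≡ ∏ xs g
∏-cong []       f≗g = refl
∏-cong (x ∷ xs) f≗g = cong₂ _*_ (f≗g x) (∏-cong xs f≗g)

*-interchange : ∀ a b c d → (a * b) * (c * d) ≡ (a * c) * (b * d)
*-interchange = solve-∀

*-left-comm : ∀ a b c → a * (b * c) ≡ b * (a * c)
*-left-comm = solve-∀

∏-* : ∀ (xs : List A) (f g : A → ℕ) → ∏ xs (λ x → f x * g x) ≡ ∏ xs f * ∏ xs g
∏-* []       f g = refl
∏-* (x ∷ xs) f g = trans (cong (f x * g x *_) (∏-* xs f g)) (*-interchange (f x) (g x) _ _)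

∏-↭ : ∀ {xs ys : List A} (f : A → ℕ) → xs ↭ ys → ∏ xs f ≡ ∏ ys f
∏-↭ f Perm.refl         = refl
∏-↭ f (Perm.prep x p)   = cong (f x *_) (∏-↭ f p)
∏-↭ f (Perm.swap x y p) = trans (cong (λ z → f x * (f y * z)) (∏-↭ f p)) (*-left-comm (f x) (f y) _)
∏-↭ f (Perm.trans p q)  = trans (∏-↭ f p) (∏-↭ f q)

∏-++ : ∀ (xs ys : List A) (f : A → ℕ) → ∏ (xs ++ ys) f ≡ ∏ xs f * ∏ ys f
∏-++ []       ys f = sym (*-identityˡ _)
∏-++ (x ∷ xs) ys f = trans (cong (f x *_) (∏-++ xs ys f)) (sym (*-assoc (f x) _ _))

-- The coefficient form of a product of exponential generating functions: every label chooses one of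
-- two factors.
Spl : List A → (List A → List A → ℕ) → ℕ
Spl []      f = f [] []
Spl (x ∷ V) f = Spl V (λ B C → f (x ∷ B) C) + Spl V (λ B C → f B (x ∷ C))

-- The coefficient form of distinguishing a root, which is removed from the list of the other
-- labels.
Pick : List A → (A → List A → ℕ) → ℕ
Pick []      f = 0
Pick (x ∷ V) f = f x V + Pick V (λ y V′ → f y (x ∷ V′))

-- The interleaving is the handle for inductions: it bounds the lengths of both parts and passes
-- sortedness and other conditions from `V` to them.
Spl-congⁱ : ∀ (V : List A) {f g : List A → List A → ℕ} →
  (∀ B C → Interleaving B C V → f B C ≡ g B C) → Spl V f ≡ Spl V g
Spl-congⁱ []      h = h [] [] []ⁱ
Spl-congⁱ (x ∷ V) h = cong₂ _+_ (Spl-congⁱ V (λ B C i → h (x ∷ B) C (consˡ i)))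
                                (Spl-congⁱ V (λ B C i → h B (x ∷ C) (consʳ i)))

Spl-cong : ∀ (V : List A) {f g : List A → List A → ℕ} →
  (∀ B C → f B C ≡ g B C) → Spl V f ≡ Spl V g
Spl-cong V h = Spl-congⁱ V (λ B C _ → h B C)

Spl-+ : ∀ (V : List A) (f g : List A → List A → ℕ) →
  Spl V (λ B C → f B C + g B C) ≡ Spl V f + Spl V g
Spl-+ []      f g = refl
Spl-+ (x ∷ V) f g = trans (cong₂ _+_ (Spl-+ V _ _) (Spl-+ V _ _)) (+-interchange (Spl V _) _ _ _)

Spl-* : ∀ k (V : List A) (f : List A → List A → ℕ) →
  Spl V (λ B C → k * f B C) ≡ k * Spl V f
Spl-* k []      f = refl
Spl-* k (x ∷ V) f = trans (cong₂ _+_ (Spl-* k V _) (Spl-* k V _)) (sym (*-distribˡ-+ k _ _))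

Spl-*ʳ : ∀ k (V : List A) (f : List A → List A → ℕ) →
  Spl V (λ B C → f B C * k) ≡ Spl V f * k
Spl-*ʳ k V f = trans (Spl-cong V (λ B C → *-comm (f B C) k)) (trans (Spl-* k V f) (*-comm k _))

Spl-0 : ∀ (V : List A) → Spl V (λ _ _ → 0) ≡ 0
Spl-0 []      = refl
Spl-0 (x ∷ V) = cong₂ _+_ (Spl-0 V) (Spl-0 V)

Spl-comm : ∀ (V : List A) (f : List A → List A → ℕ) → Spl V f ≡ Spl V (λ B C → f C B)
Spl-comm []      f = refl
Spl-comm (x ∷ V) f = trans (+-comm (Spl V _) _) (cong₂ _+_ (Spl-comm V _) (Spl-comm V _))

Spl-assoc : ∀ (V : List A) (f : List A → List A → List A → ℕ) →
  Spl V (λ B D → Spl B (λ B₁ B₂ → f B₁ B₂ D)) ≡ Spl V (λ B E → Spl E (λ C D → f B C D))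
Spl-assoc []      f = refl
Spl-assoc (x ∷ V) f = begin
  Spl V (λ B D → Spl B (λ B₁ B₂ → f (x ∷ B₁) B₂ D) + Spl B (λ B₁ B₂ → f B₁ (x ∷ B₂) D))
    + Spl V (λ B D → Spl B (λ B₁ B₂ → f B₁ B₂ (x ∷ D)))
    ≡⟨ cong₂ _+_ (Spl-+ V _ _) refl ⟩
  Spl V (λ B D → Spl B (λ B₁ B₂ → f (x ∷ B₁) B₂ D)) + Spl V (λ B D → Spl B (λ B₁ B₂ → f B₁ (x ∷ B₂) D))
    + Spl V (λ B D → Spl B (λ B₁ B₂ → f B₁ B₂ (x ∷ D)))
    ≡⟨ cong₂ _+_ (cong₂ _+_ (Spl-assoc V _) (Spl-assoc V _)) (Spl-assoc V _) ⟩
  Spl V (λ B E → Spl E (λ C D → f (x ∷ B) C D)) + Spl V (λ B E → Spl E (λ C D → f B (x ∷ C) D))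
    + Spl V (λ B E → Spl E (λ C D → f B C (x ∷ D)))
    ≡⟨ +-assoc (Spl V _) _ _ ⟩
  Spl V (λ B E → Spl E (λ C D → f (x ∷ B) C D)) + (Spl V (λ B E → Spl E (λ C D → f B (x ∷ C) D))
    + Spl V (λ B E → Spl E (λ C D → f B C (x ∷ D))))
    ≡⟨ cong (Spl V _ +_) (Spl-+ V _ _) ⟨
  Spl (x ∷ V) (λ B E → Spl E (λ C D → f B C D)) ∎

Spl-rotate : ∀ (V : List A) (f : List A → List A → List A → ℕ) →
  Spl V (λ B E → Spl E (λ C D → f B C D)) ≡ Spl V (λ C E → Spl E (λ B D → f B C D))
Spl-rotate V f = begin
  Spl V (λ B E → Spl E (λ C D → f B C D))     ≡⟨ Spl-assoc V f ⟨
  Spl V (λ E D → Spl E (λ B C → f B C D))     ≡⟨ Spl-cong V (λ E D → Spl-comm E _) ⟩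
  Spl V (λ E D → Spl E (λ C B → f B C D))     ≡⟨ Spl-assoc V (λ C B D → f B C D) ⟩
  Spl V (λ C E → Spl E (λ B D → f B C D))     ∎

Spl-interchange : ∀ (V : List A) (f : List A → List A → List A → List A → ℕ) →
  Spl V (λ S R → Spl S (λ S₁ S₂ → Spl R (λ R₁ R₂ → f S₁ S₂ R₁ R₂))) ≡
  Spl V (λ B C → Spl B (λ S₁ R₁ → Spl C (λ S₂ R₂ → f S₁ S₂ R₁ R₂)))
Spl-interchange V f = begin
  Spl V (λ S R → Spl S (λ S₁ S₂ → Spl R (λ R₁ R₂ → f S₁ S₂ R₁ R₂)))
    ≡⟨ Spl-assoc V (λ S₁ S₂ R → Spl R (λ R₁ R₂ → f S₁ S₂ R₁ R₂)) ⟩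
  Spl V (λ S₁ E → Spl E (λ S₂ R → Spl R (λ R₁ R₂ → f S₁ S₂ R₁ R₂)))
    ≡⟨ Spl-cong V (λ S₁ E → Spl-rotate E (λ S₂ R₁ R₂ → f S₁ S₂ R₁ R₂)) ⟩
  Spl V (λ S₁ E → Spl E (λ R₁ C → Spl C (λ S₂ R₂ → f S₁ S₂ R₁ R₂)))
    ≡⟨ Spl-assoc V (λ S₁ R₁ C → Spl C (λ S₂ R₂ → f S₁ S₂ R₁ R₂)) ⟨
  Spl V (λ B C → Spl B (λ S₁ R₁ → Spl C (λ S₂ R₂ → f S₁ S₂ R₁ R₂))) ∎

Spl-*-Spl : ∀ (V W : List A) (f g : List A → List A → ℕ) →
  Spl V f * Spl W g ≡ Spl V (λ V₁ V₂ → Spl W (λ W₁ W₂ → f V₁ V₂ * g W₁ W₂))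
Spl-*-Spl V W f g = trans (sym (Spl-*ʳ (Spl W g) V f)) (Spl-cong V (λ V₁ V₂ → sym (Spl-* (f V₁ V₂) W g)))

Respects₂ : (List A → List A → ℕ) → Set
Respects₂ f = ∀ {B B′ C C′} → B ↭ B′ → C ↭ C′ → f B C ≡ f B′ C′

-- In a swap of neighbours, the two of the four cases that separate the two labels trade places.
Spl-↭ : ∀ {V W : List A} {f : List A → List A → ℕ} → Respects₂ f → V ↭ W → Spl V f ≡ Spl W f
Spl-↭ r Perm.refl = refl
Spl-↭ r (Perm.prep x p) = cong₂ _+_ (Spl-↭ (λ b c → r (prep x b) c) p) (Spl-↭ (λ b c → r b (prep x c)) p)
Spl-↭ {V = x ∷ y ∷ V} {W = y ∷ x ∷ W} {f = f} r (Perm.swap x y p) = begin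
  (Spl V (λ B C → f (x ∷ y ∷ B) C) + Spl V (λ B C → f (x ∷ B) (y ∷ C)))
    + (Spl V (λ B C → f (y ∷ B) (x ∷ C)) + Spl V (λ B C → f B (x ∷ y ∷ C)))
    ≡⟨ cong₂ _+_
         (cong₂ _+_ (trans (Spl-↭ (λ b c → r (prep x (prep y b)) c) p) (Spl-cong W (λ B C → r (Perm.swap x y ↭-refl) ↭-refl)))
                    (Spl-↭ (λ b c → r (prep x b) (prep y c)) p))
         (cong₂ _+_ (Spl-↭ (λ b c → r (prep y b) (prep x c)) p)
                    (trans (Spl-↭ (λ b c → r b (prep x (prep y c))) p) (Spl-cong W (λ B C → r ↭-refl (Perm.swap x y ↭-refl))))) ⟩
  (Spl W (λ B C → f (y ∷ x ∷ B) C) + Spl W (λ B C → f (x ∷ B) (y ∷ C)))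
    + (Spl W (λ B C → f (y ∷ B) (x ∷ C)) + Spl W (λ B C → f B (y ∷ x ∷ C)))
    ≡⟨ +-interchange (Spl W _) _ _ _ ⟩
  Spl (y ∷ x ∷ W) f ∎
Spl-↭ r (Perm.trans p q) = trans (Spl-↭ r p) (Spl-↭ r q)

Pick-cong↭ : ∀ (V : List A) {f g : A → List A → ℕ} →
  (∀ y V′ → y ∷ V′ ↭ V → f y V′ ≡ g y V′) → Pick V f ≡ Pick V g
Pick-cong↭ []      h = refl
Pick-cong↭ (x ∷ V) h = cong₂ _+_ (h x V ↭-refl)
  (Pick-cong↭ V (λ y V′ p → h y (x ∷ V′) (↭-trans (Perm.swap y x ↭-refl) (prep x p))))

Pick-cong : ∀ (V : List A) {f g : A → List A → ℕ} →
  (∀ y V′ → f y V′ ≡ g y V′) → Pick V f ≡ Pick V g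
Pick-cong V h = Pick-cong↭ V (λ y V′ _ → h y V′)

Pick-+ : ∀ (V : List A) (f g : A → List A → ℕ) →
  Pick V (λ y V′ → f y V′ + g y V′) ≡ Pick V f + Pick V g
Pick-+ []      f g = refl
Pick-+ (x ∷ V) f g = trans (cong (f x V + g x V +_) (Pick-+ V _ _)) (+-interchange (f x V) _ _ _)

Pick-* : ∀ k (V : List A) (f : A → List A → ℕ) → Pick V (λ y V′ → k * f y V′) ≡ k * Pick V f
Pick-* k []      f = sym (*-zeroʳ k)
Pick-* k (x ∷ V) f = trans (cong (k * f x V +_) (Pick-* k V _)) (sym (*-distribˡ-+ k _ _))

Pick-*ʳ : ∀ k (V : List A) (f : A → List A → ℕ) → Pick V (λ y V′ → f y V′ * k) ≡ Pick V f * k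
Pick-*ʳ k V f = trans (Pick-cong V (λ y V′ → *-comm (f y V′) k)) (trans (Pick-* k V f) (*-comm k _))

Pick-0 : ∀ (V : List A) → Pick V (λ _ _ → 0) ≡ 0
Pick-0 []      = refl
Pick-0 (x ∷ V) = Pick-0 V

Pick-∑ : ∀ (V : List A) (f : A → ℕ) → Pick V (λ y _ → f y) ≡ ∑ V f
Pick-∑ []      f = refl
Pick-∑ (x ∷ V) f = cong (f x +_) (Pick-∑ V f)

Pick-↭ : ∀ {V W : List A} {f : A → List A → ℕ} →
  (∀ y {B C} → B ↭ C → f y B ≡ f y C) → V ↭ W → Pick V f ≡ Pick W f
Pick-↭ r Perm.refl = refl
Pick-↭ r (Perm.prep x p) = cong₂ _+_ (r x p) (Pick-↭ (λ y q → r y (prep x q)) p)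
Pick-↭ {V = x ∷ y ∷ V} {W = y ∷ x ∷ W} {f = f} r (Perm.swap x y p) = begin
  f x (y ∷ V) + (f y (x ∷ V) + Pick V (λ z V′ → f z (x ∷ y ∷ V′)))
    ≡⟨ cong₂ _+_ (r x (prep y p)) (cong₂ _+_ (r y (prep x p))
         (trans (Pick-cong V (λ z V′ → r z (Perm.swap x y ↭-refl))) (Pick-↭ (λ z q → r z (prep y (prep x q))) p))) ⟩
  f x (y ∷ W) + (f y (x ∷ W) + Pick W (λ z V′ → f z (y ∷ x ∷ V′)))
    ≡⟨ +-left-comm (f x (y ∷ W)) (f y (x ∷ W)) _ ⟩
  f y (x ∷ W) + (f x (y ∷ W) + Pick W (λ z V′ → f z (y ∷ x ∷ V′))) ∎
Pick-↭ r (Perm.trans p q) = trans (Pick-↭ r p) (Pick-↭ r q)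

-- Both sides range over a marked label together with two lists that receive the others.
Spl-Pick : ∀ (V : List A) (f : A → List A → List A → ℕ) →
  Spl V (λ B C → Pick B (λ y B′ → f y B′ C)) ≡ Pick V (λ y V′ → Spl V′ (f y))
Spl-Pick []      f = refl
Spl-Pick (x ∷ V) f = begin
  Spl V (λ B C → f x B C + Pick B (λ y B′ → f y (x ∷ B′) C)) + Spl V (λ B C → Pick B (λ y B′ → f y B′ (x ∷ C)))
    ≡⟨ cong₂ _+_ (Spl-+ V _ _) refl ⟩
  Spl V (f x) + Spl V (λ B C → Pick B (λ y B′ → f y (x ∷ B′) C)) + Spl V (λ B C → Pick B (λ y B′ → f y B′ (x ∷ C)))
    ≡⟨ +-assoc (Spl V _) _ _ ⟩
  Spl V (f x) + (Spl V (λ B C → Pick B (λ y B′ → f y (x ∷ B′) C)) + Spl V (λ B C → Pick B (λ y B′ → f y B′ (x ∷ C))))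
    ≡⟨ cong (Spl V (f x) +_) (cong₂ _+_ (Spl-Pick V _) (Spl-Pick V _)) ⟩
  Spl V (f x) + (Pick V (λ y V′ → Spl V′ (λ B C → f y (x ∷ B) C)) + Pick V (λ y V′ → Spl V′ (λ B C → f y B (x ∷ C))))
    ≡⟨ cong (Spl V (f x) +_) (Pick-+ V _ _) ⟨
  Pick (x ∷ V) (λ y V′ → Spl V′ (f y)) ∎

∏-+ : ∀ (V : List A) (a b : A → ℕ) → ∏ V (λ x → a x + b x) ≡ Spl V (λ B C → ∏ B a * ∏ C b)
∏-+ []      a b = refl
∏-+ (x ∷ V) a b = begin
  (a x + b x) * ∏ V (λ x → a x + b x)
    ≡⟨ cong ((a x + b x) *_) (∏-+ V a b) ⟩
  (a x + b x) * Spl V (λ B C → ∏ B a * ∏ C b)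
    ≡⟨ *-distribʳ-+ (Spl V (λ B C → ∏ B a * ∏ C b)) (a x) (b x) ⟩
  a x * Spl V (λ B C → ∏ B a * ∏ C b) + b x * Spl V (λ B C → ∏ B a * ∏ C b)
    ≡⟨ cong₂ _+_ (Spl-* (a x) V _) (Spl-* (b x) V _) ⟨
  Spl V (λ B C → a x * (∏ B a * ∏ C b)) + Spl V (λ B C → b x * (∏ B a * ∏ C b))
    ≡⟨ cong₂ _+_ (Spl-cong V (λ B C → sym (*-assoc (a x) _ _))) (Spl-cong V (λ B C → *-left-comm (b x) (∏ B a) _)) ⟩
  Spl (x ∷ V) (λ B C → ∏ B a * ∏ C b) ∎

Spl-map : ∀ (h : A → B) (V : List A) (f : List B → List B → ℕ) →
  Spl (map h V) f ≡ Spl V (λ L M → f (map h L) (map h M))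
Spl-map h []      f = refl
Spl-map h (x ∷ V) f = cong₂ _+_ (Spl-map h V _) (Spl-map h V _)

Pick-map : ∀ (h : A → B) (V : List A) (f : B → List B → ℕ) →
  Pick (map h V) f ≡ Pick V (λ y V′ → f (h y) (map h V′))
Pick-map h []      f = refl
Pick-map h (x ∷ V) f = cong (f (h x) (map h V) +_) (Pick-map h V _)

-- Weighted forests

length-split : ∀ {V B C : List A} → Interleaving B C V → length B + length C ≡ length V
length-split {B = B} {C = C} i = trans (sym (length-++ B)) (sym (↭-length (toPermutation i)))

length-splitˡ : ∀ {V B C : List A} → Interleaving B C V → length B ≤ length V
length-splitˡ {B = B} {C = C} i = subst (length B ≤_) (length-split i) (m≤m+n _ _)

length-splitʳ : ∀ {V B C : List A} → Interleaving B C V → length C ≤ length V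
length-splitʳ {B = B} {C = C} i = subst (length C ≤_) (length-split i) (m≤n+m _ _)

-- The forests with root set `S` and other vertices `R`, where `t q B` weighs the trees with root
-- `q` and other vertices `B`. The parameter `t` allows the recursion on fuel to pass in the
-- previous stage.
hang : (X → List X → ℕ) → List X → List X → ℕ
hang t []      []      = 1
hang t []      (_ ∷ _) = 0
hang t (q ∷ Q) V       = Spl V (λ B C → t q B * hang t Q C)

plant : (X → List X → ℕ) → (X → ℕ) → List X → ℕ
plant t a V = Spl V (λ S R → ∏ S a * hang t S R)

hang-cong : ∀ {t t′ : X → List X → ℕ} S R →
  (∀ q B → length B ≤ length R → t q B ≡ t′ q B) → hang t S R ≡ hang t′ S R
hang-cong []      []      h = refl
hang-cong []      (_ ∷ _) h = refl
hang-cong (q ∷ Q) R       h = Spl-congⁱ R λ B C i → cong₂ _*_ (h q B (length-splitˡ i))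
  (hang-cong Q C (λ q′ B′ l → h q′ B′ (≤-trans l (length-splitʳ i))))

hang-[]-cong : ∀ (t t′ : X → List X → ℕ) R → hang t [] R ≡ hang t′ [] R
hang-[]-cong t t′ []      = refl
hang-[]-cong t t′ (_ ∷ _) = refl

-- Only lists shorter than V are hung below a root, since the root itself is taken from V.
plant-cong : ∀ {t t′ : X → List X → ℕ} {a b : X → ℕ} V → (∀ x → a x ≡ b x) →
  (∀ q B → length B < length V → t q B ≡ t′ q B) → plant t a V ≡ plant t′ b V
plant-cong V a≗b h = Spl-congⁱ V λ where
  []      R i → cong (1 *_) (hang-[]-cong _ _ R)
  (s ∷ S) R i → cong₂ _*_ (∏-cong (s ∷ S) a≗b) (hang-cong (s ∷ S) R λ q B l →
    h q B (≤-trans (s≤s (≤-trans l (m≤n+m _ (length S)))) (≤-reflexive (length-split i))))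

Respects : (X → List X → ℕ) → Set
Respects t = ∀ q {B C} → B ↭ C → t q B ≡ t q C

hang-↭ʳ : ∀ {t : X → List X → ℕ} → Respects t → ∀ S {R R′} → R ↭ R′ → hang t S R ≡ hang t S R′
hang-↭ʳ {t = t} r [] p = lemma p
  where
  lemma : ∀ {R R′} → R ↭ R′ → hang t [] R ≡ hang t [] R′
  lemma Perm.refl           = refl
  lemma (Perm.prep x p)     = refl
  lemma (Perm.swap x y p)   = refl
  lemma (Perm.trans p q)    = trans (lemma p) (lemma q)
hang-↭ʳ r (q ∷ Q) p = Spl-↭ (λ b c → cong₂ _*_ (r q b) (hang-↭ʳ r Q c)) p

hang-↭ˡ : ∀ (t : X → List X → ℕ) {S S′} → S ↭ S′ → ∀ R → hang t S R ≡ hang t S′ R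
hang-↭ˡ t Perm.refl       R = refl
hang-↭ˡ t (Perm.prep x p) R = Spl-cong R (λ B C → cong (t x B *_) (hang-↭ˡ t p C))
hang-↭ˡ t {x ∷ y ∷ S} {.y ∷ .x ∷ S′} (Perm.swap x y p) R = begin
  Spl R (λ B E → t x B * Spl E (λ C D → t y C * hang t S D))
    ≡⟨ Spl-cong R (λ B E → sym (Spl-* (t x B) E _)) ⟩
  Spl R (λ B E → Spl E (λ C D → t x B * (t y C * hang t S D)))
    ≡⟨ Spl-rotate R _ ⟩
  Spl R (λ C E → Spl E (λ B D → t x B * (t y C * hang t S D)))
    ≡⟨ Spl-cong R (λ C E → Spl-cong E (λ B D →
         trans (cong (λ h → t x B * (t y C * h)) (hang-↭ˡ t p D)) (*-left-comm (t x B) (t y C) _))) ⟩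
  Spl R (λ C E → Spl E (λ B D → t y C * (t x B * hang t S′ D)))
    ≡⟨ Spl-cong R (λ C E → Spl-* (t y C) E _) ⟩
  Spl R (λ C E → t y C * Spl E (λ B D → t x B * hang t S′ D)) ∎
hang-↭ˡ t (Perm.trans p q) R = trans (hang-↭ˡ t p R) (hang-↭ˡ t q R)

plant-↭ : ∀ {t : X → List X → ℕ} → Respects t → ∀ a {V W} → V ↭ W → plant t a V ≡ plant t a W
plant-↭ {t = t} r a p = Spl-↭ (λ {B} {B′} {C} b c →
  cong₂ _*_ (∏-↭ a b) (trans (hang-↭ˡ t b C) (hang-↭ʳ r B′ c))) p

-- The vertices of `R` are first divided between the two groups of roots, then within each group.
hang-++ : ∀ (t : X → List X → ℕ) S T R →
  hang t (S ++ T) R ≡ Spl R (λ B C → hang t S B * hang t T C)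
hang-++ t [] T R = sym (lemma R (hang t T))
  where
  none : ∀ R (f : List _ → ℕ) x → Spl R (λ B C → hang t [] (x ∷ B) * f C) ≡ 0
  none R f x = Spl-0 R
  lemma : ∀ R (f : List _ → ℕ) → Spl R (λ B C → hang t [] B * f C) ≡ f R
  lemma []      f = *-identityˡ _
  lemma (x ∷ R) f = cong₂ _+_ (none R f x) (lemma R (λ C → f (x ∷ C)))
hang-++ t (q ∷ Q) T R = begin
  Spl R (λ B E → t q B * hang t (Q ++ T) E)
    ≡⟨ Spl-cong R (λ B E → trans (cong (t q B *_) (hang-++ t Q T E)) (sym (Spl-* (t q B) E _))) ⟩
  Spl R (λ B E → Spl E (λ C D → t q B * (hang t Q C * hang t T D)))
    ≡⟨ Spl-assoc R _ ⟨
  Spl R (λ E D → Spl E (λ B C → t q B * (hang t Q C * hang t T D)))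
    ≡⟨ Spl-cong R (λ E D → trans (Spl-cong E (λ B C → sym (*-assoc (t q B) _ _))) (Spl-*ʳ (hang t T D) E _)) ⟩
  Spl R (λ E D → Spl E (λ B C → t q B * hang t Q C) * hang t T D) ∎

hang-insert : ∀ (t : X → List X → ℕ) S x R →
  hang t S (x ∷ R) ≡ Pick S (λ y S′ → Spl R (λ B C → t y (x ∷ B) * hang t S′ C))
hang-insert t []      x R = refl
hang-insert t (q ∷ Q) x R = cong (Spl R (λ B C → t q (x ∷ B) * hang t Q C) +_) (begin
  Spl R (λ B E → t q B * hang t Q (x ∷ E))
    ≡⟨ Spl-cong R (λ B E → trans (cong (t q B *_) (hang-insert t Q x E)) (sym (Pick-* (t q B) Q _))) ⟩
  Spl R (λ B E → Pick Q (λ y Q′ → t q B * Spl E (λ C D → t y (x ∷ C) * hang t Q′ D)))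
    ≡⟨ Spl-Pick-swap R Q ⟩
  Pick Q (λ y Q′ → Spl R (λ B E → t q B * Spl E (λ C D → t y (x ∷ C) * hang t Q′ D)))
    ≡⟨ Pick-cong Q (λ y Q′ → begin
         Spl R (λ B E → t q B * Spl E (λ C D → t y (x ∷ C) * hang t Q′ D))
           ≡⟨ Spl-cong R (λ B E → sym (Spl-* (t q B) E _)) ⟩
         Spl R (λ B E → Spl E (λ C D → t q B * (t y (x ∷ C) * hang t Q′ D)))
           ≡⟨ Spl-rotate R _ ⟩
         Spl R (λ C E → Spl E (λ B D → t q B * (t y (x ∷ C) * hang t Q′ D)))
           ≡⟨ Spl-cong R (λ C E → trans (Spl-cong E (λ B D → *-left-comm (t q B) (t y (x ∷ C)) _)) (Spl-* (t y (x ∷ C)) E _)) ⟩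
         Spl R (λ C E → t y (x ∷ C) * hang t (q ∷ Q′) E) ∎) ⟩
  Pick Q (λ y Q′ → Spl R (λ C E → t y (x ∷ C) * hang t (q ∷ Q′) E)) ∎)
  where
  Spl-Pick-swap : ∀ {A B : Set} (V : List A) (W : List B) {f : List A → List A → B → List B → ℕ} →
    Spl V (λ B C → Pick W (f B C)) ≡ Pick W (λ y W′ → Spl V (λ B C → f B C y W′))
  Spl-Pick-swap V []      = Spl-0 V
  Spl-Pick-swap V (y ∷ W) = trans (Spl-+ V _ _) (cong (Spl V _ +_) (Spl-Pick-swap V W))

-- w q v is the weight of making v a child of q, and a v that of making v a root.
module Forest {X : Set} (w : X → X → ℕ) where

  -- The first argument is fuel; length V of it suffices.
  treeₙ : ℕ → X → List X → ℕ
  treeₙ zero    q []      = 1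
  treeₙ zero    q (_ ∷ _) = 0
  treeₙ (suc k) q V       = plant (treeₙ k) (w q) V

  tree : X → List X → ℕ
  tree q V = treeₙ (length V) q V

  forest : (X → ℕ) → List X → ℕ
  forest a V = plant tree a V

  treeₙ-fuel : ∀ j k q V → length V ≤ j → length V ≤ k → treeₙ j q V ≡ treeₙ k q V
  treeₙ-fuel zero    zero    q []      _ _ = refl
  treeₙ-fuel zero    (suc k) q []      _ _ = refl
  treeₙ-fuel (suc j) zero    q []      _ _ = refl
  treeₙ-fuel (suc j) (suc k) q V V≤j V≤k = plant-cong V (λ _ → refl) λ q′ B B<V →
    treeₙ-fuel j k q′ B (s≤s⁻¹ (≤-trans B<V V≤j)) (s≤s⁻¹ (≤-trans B<V V≤k))

  -- The children of `q` are the roots of a forest with root weights `w q`. The lists below them are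
  -- shorter than `V`, so one unit of fuel less is still sufficient.
  tree≡forest : ∀ q V → tree q V ≡ forest (w q) V
  tree≡forest q []      = refl
  tree≡forest q (x ∷ V) = plant-cong (x ∷ V) (λ _ → refl) λ q′ B B<V →
    treeₙ-fuel (length V) (length B) q′ B (s≤s⁻¹ B<V) ≤-refl

  forest-cong : ∀ {a b : X → ℕ} V → (∀ x → a x ≡ b x) → forest a V ≡ forest b V
  forest-cong V a≗b = plant-cong V a≗b (λ _ _ _ → refl)

  treeₙ-↭ : ∀ k → Respects (treeₙ k)
  treeₙ-↭ zero    q {[]}    {[]}    p = refl
  treeₙ-↭ zero    q {[]}    {_ ∷ _} p with () ← ↭-length p
  treeₙ-↭ zero    q {_ ∷ _} {[]}    p with () ← ↭-length p
  treeₙ-↭ zero    q {_ ∷ _} {_ ∷ _} p = refl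
  treeₙ-↭ (suc k) q p = plant-↭ (treeₙ-↭ k) (w q) p

  tree-↭ : Respects tree
  tree-↭ q {B} {C} p = trans (treeₙ-↭ (length B) q p)
    (treeₙ-fuel (length B) (length C) q C (≤-reflexive (sym (↭-length p))) ≤-refl)

  forest-↭ : ∀ a {V W} → V ↭ W → forest a V ≡ forest a W
  forest-↭ = plant-↭ tree-↭

  -- The law exp (F + G) = exp F exp G: each root decides for one of its two weights and takes its
  -- tree along.
  forest-+ : ∀ a b V → forest (λ x → a x + b x) V ≡ Spl V (λ B C → forest a B * forest b C)
  forest-+ a b V = begin
    Spl V (λ S R → ∏ S (λ x → a x + b x) * hang tree S R)
      ≡⟨ Spl-cong V (λ S R → trans (cong (_* hang tree S R) (∏-+ S a b)) (sym (Spl-*ʳ (hang tree S R) S _))) ⟩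
    Spl V (λ S R → Spl S (λ S₁ S₂ → ∏ S₁ a * ∏ S₂ b * hang tree S R))
      ≡⟨ Spl-cong V (λ S R → Spl-congⁱ S (λ S₁ S₂ i → begin
           ∏ S₁ a * ∏ S₂ b * hang tree S R
             ≡⟨ cong (∏ S₁ a * ∏ S₂ b *_) (trans (hang-↭ˡ tree (toPermutation i) R) (hang-++ tree S₁ S₂ R)) ⟩
           ∏ S₁ a * ∏ S₂ b * Spl R (λ R₁ R₂ → hang tree S₁ R₁ * hang tree S₂ R₂)
             ≡⟨ Spl-* (∏ S₁ a * ∏ S₂ b) R _ ⟨
           Spl R (λ R₁ R₂ → ∏ S₁ a * ∏ S₂ b * (hang tree S₁ R₁ * hang tree S₂ R₂))
             ≡⟨ Spl-cong R (λ R₁ R₂ → *-interchange (∏ S₁ a) (∏ S₂ b) _ _) ⟩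
           Spl R (λ R₁ R₂ → ∏ S₁ a * hang tree S₁ R₁ * (∏ S₂ b * hang tree S₂ R₂)) ∎)) ⟩
    Spl V (λ S R → Spl S (λ S₁ S₂ → Spl R (λ R₁ R₂ → ∏ S₁ a * hang tree S₁ R₁ * (∏ S₂ b * hang tree S₂ R₂))))
      ≡⟨ Spl-interchange V _ ⟩
    Spl V (λ B C → Spl B (λ S₁ R₁ → Spl C (λ S₂ R₂ → ∏ S₁ a * hang tree S₁ R₁ * (∏ S₂ b * hang tree S₂ R₂))))
      ≡⟨ Spl-cong V (λ B C → Spl-*-Spl B C _ _) ⟨
    Spl V (λ B C → forest a B * forest b C) ∎

  -- Either `x` is a root, and deleting it makes its children roots beside the old ones, hence the
  -- weight `w x v + a v`; or the tree containing `x` has another root `y`.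
  forest-∷ : ∀ a x V → forest a (x ∷ V) ≡
    a x * forest (λ v → w x v + a v) V + Pick V (λ y V′ → a y * Spl V′ (λ B C → tree y (x ∷ B) * forest a C))
  forest-∷ a x V = cong₂ _+_ root inner
    where
    root : Spl V (λ S R → a x * ∏ S a * hang tree (x ∷ S) R) ≡ a x * forest (λ v → w x v + a v) V
    root = begin
      Spl V (λ S R → a x * ∏ S a * Spl R (λ B C → tree x B * hang tree S C))
        ≡⟨ Spl-cong V (λ S R → trans (*-assoc (a x) _ _) (cong (a x *_) (sym (Spl-* (∏ S a) R _)))) ⟩
      Spl V (λ S R → a x * Spl R (λ B C → ∏ S a * (tree x B * hang tree S C)))
        ≡⟨ Spl-* (a x) V _ ⟩
      a x * Spl V (λ S R → Spl R (λ B C → ∏ S a * (tree x B * hang tree S C)))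
        ≡⟨ cong (a x *_) (Spl-rotate V _) ⟩
      a x * Spl V (λ B E → Spl E (λ S C → ∏ S a * (tree x B * hang tree S C)))
        ≡⟨ cong (a x *_) (Spl-cong V (λ B E → begin
             Spl E (λ S C → ∏ S a * (tree x B * hang tree S C))  ≡⟨ Spl-cong E (λ S C → *-left-comm (∏ S a) (tree x B) _) ⟩
             Spl E (λ S C → tree x B * (∏ S a * hang tree S C))  ≡⟨ Spl-* (tree x B) E _ ⟩
             tree x B * forest a E                               ≡⟨ cong (_* forest a E) (tree≡forest x B) ⟩
             forest (w x) B * forest a E                         ∎)) ⟩
      a x * Spl V (λ B E → forest (w x) B * forest a E)
        ≡⟨ cong (a x *_) (forest-+ (w x) a V) ⟨
      a x * forest (λ v → w x v + a v) V ∎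
    inner : Spl V (λ S R → ∏ S a * hang tree S (x ∷ R)) ≡
      Pick V (λ y V′ → a y * Spl V′ (λ B C → tree y (x ∷ B) * forest a C))
    inner = begin
      Spl V (λ S R → ∏ S a * hang tree S (x ∷ R))
        ≡⟨ Spl-cong V (λ S R → trans (cong (∏ S a *_) (hang-insert tree S x R)) (sym (Pick-* (∏ S a) S _))) ⟩
      Spl V (λ S R → Pick S (λ y S′ → ∏ S a * Spl R (λ B C → tree y (x ∷ B) * hang tree S′ C)))
        ≡⟨ Spl-cong V (λ S R → Pick-cong↭ S (λ y S′ p → cong (_* Spl R (λ B C → tree y (x ∷ B) * hang tree S′ C)) (∏-↭ a (↭-sym p)))) ⟩
      Spl V (λ S R → Pick S (λ y S′ → a y * ∏ S′ a * Spl R (λ B C → tree y (x ∷ B) * hang tree S′ C)))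
        ≡⟨ Spl-Pick V _ ⟩
      Pick V (λ y V′ → Spl V′ (λ S R → a y * ∏ S a * Spl R (λ B C → tree y (x ∷ B) * hang tree S C)))
        ≡⟨ Pick-cong V (λ y V′ → begin
             Spl V′ (λ S R → a y * ∏ S a * Spl R (λ B C → tree y (x ∷ B) * hang tree S C))
               ≡⟨ Spl-cong V′ (λ S R → trans (*-assoc (a y) _ _) (cong (a y *_) (sym (Spl-* (∏ S a) R _)))) ⟩
             Spl V′ (λ S R → a y * Spl R (λ B C → ∏ S a * (tree y (x ∷ B) * hang tree S C)))
               ≡⟨ Spl-* (a y) V′ _ ⟩
             a y * Spl V′ (λ S R → Spl R (λ B C → ∏ S a * (tree y (x ∷ B) * hang tree S C)))
               ≡⟨ cong (a y *_) (Spl-rotate V′ _) ⟩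
             a y * Spl V′ (λ B E → Spl E (λ S C → ∏ S a * (tree y (x ∷ B) * hang tree S C)))
               ≡⟨ cong (a y *_) (Spl-cong V′ (λ B E → trans
                    (Spl-cong E (λ S C → *-left-comm (∏ S a) (tree y (x ∷ B)) _)) (Spl-* (tree y (x ∷ B)) E _))) ⟩
             a y * Spl V′ (λ B E → tree y (x ∷ B) * forest a E) ∎) ⟩
      Pick V (λ y V′ → a y * Spl V′ (λ B C → tree y (x ∷ B) * forest a C)) ∎

  -- The law (exp F)′ = F′ exp F: the component of the first vertex, whatever its root `y`, is
  -- separated from the rest.
  forest-component : ∀ a x V → forest a (x ∷ V) ≡
    Spl V (λ B C → Pick (x ∷ B) (λ y B′ → a y * tree y B′) * forest a C)
  forest-component a x V = begin
    forest a (x ∷ V)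
      ≡⟨ forest-∷ a x V ⟩
    a x * forest (λ v → w x v + a v) V + Pick V (λ y V′ → a y * Spl V′ (λ B C → tree y (x ∷ B) * forest a C))
      ≡⟨ cong₂ _+_ head tail ⟩
    Spl V (λ B C → a x * tree x B * forest a C) + Spl V (λ B C → Pick B (λ y B′ → a y * tree y (x ∷ B′)) * forest a C)
      ≡⟨ Spl-+ V _ _ ⟨
    Spl V (λ B C → a x * tree x B * forest a C + Pick B (λ y B′ → a y * tree y (x ∷ B′)) * forest a C)
      ≡⟨ Spl-cong V (λ B C → *-distribʳ-+ (forest a C) (a x * tree x B) _) ⟨
    Spl V (λ B C → Pick (x ∷ B) (λ y B′ → a y * tree y B′) * forest a C) ∎
    where
    head : a x * forest (λ v → w x v + a v) V ≡ Spl V (λ B C → a x * tree x B * forest a C)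
    head = begin
      a x * forest (λ v → w x v + a v) V                    ≡⟨ cong (a x *_) (forest-+ (w x) a V) ⟩
      a x * Spl V (λ B C → forest (w x) B * forest a C)     ≡⟨ Spl-* (a x) V _ ⟨
      Spl V (λ B C → a x * (forest (w x) B * forest a C))   ≡⟨ Spl-cong V (λ B C → trans (sym (*-assoc (a x) _ _))
                                                                 (cong (λ t → a x * t * forest a C) (sym (tree≡forest x B)))) ⟩
      Spl V (λ B C → a x * tree x B * forest a C)           ∎
    tail : Pick V (λ y V′ → a y * Spl V′ (λ B C → tree y (x ∷ B) * forest a C)) ≡
      Spl V (λ B C → Pick B (λ y B′ → a y * tree y (x ∷ B′)) * forest a C)
    tail = begin
      Pick V (λ y V′ → a y * Spl V′ (λ B C → tree y (x ∷ B) * forest a C))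
        ≡⟨ Pick-cong V (λ y V′ → trans (sym (Spl-* (a y) V′ _)) (Spl-cong V′ (λ B C → sym (*-assoc (a y) _ _)))) ⟩
      Pick V (λ y V′ → Spl V′ (λ B C → a y * tree y (x ∷ B) * forest a C))
        ≡⟨ Spl-Pick V _ ⟨
      Spl V (λ B C → Pick B (λ y B′ → a y * tree y (x ∷ B′) * forest a C))
        ≡⟨ Spl-cong V (λ B C → Pick-*ʳ (forest a C) B _) ⟩
      Spl V (λ B C → Pick B (λ y B′ → a y * tree y (x ∷ B′)) * forest a C) ∎

  forest-0 : ∀ {a} x V → (∀ v → a v ≡ 0) → forest a (x ∷ V) ≡ 0
  forest-0 {a} x V a≡0 = begin
    forest a (x ∷ V)                                                          ≡⟨ forest-component a x V ⟩
    Spl V (λ B C → Pick (x ∷ B) (λ y B′ → a y * tree y B′) * forest a C)     ≡⟨ Spl-cong V (λ B C → cong (_* forest a C)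
                                                                                  (trans (Pick-cong (x ∷ B) (λ y B′ → cong (_* tree y B′) (a≡0 y))) (Pick-0 (x ∷ B)))) ⟩
    Spl V (λ B C → 0)                                                         ≡⟨ Spl-0 V ⟩
    0                                                                         ∎

-- Cutting trees along the boundary of a region

module Blob {X : Set} (w : X → X → ℕ) (χ χ′ : X → ℕ) (χ+χ′≡1 : ∀ v → χ v + χ′ v ≡ 1) where
  open Forest w

  -- The weight of hanging an outside vertex `v` from some member of `S`; these are the edges that
  -- get cut.
  boundary : List X → X → ℕ
  boundary S v = χ′ v * ∑ S (λ s → w s v)

  boundary-++ : ∀ S T v → boundary S v + boundary T v ≡ boundary (S ++ T) v
  boundary-++ S T v = trans (sym (*-distribˡ-+ (χ′ v) _ _)) (cong (χ′ v *_) (sym (∑-++ S T (λ s → w s v))))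

  forest-boundary-↭ : ∀ {S T} → S ↭ T → ∀ C → forest (boundary S) C ≡ forest (boundary T) C
  forest-boundary-↭ p C = forest-cong C (λ v → cong (χ′ v *_) (∑-↭ (λ s → w s v) p))

  forest-boundary-++ : ∀ S T C →
    Spl C (λ C₁ C₂ → forest (boundary S) C₁ * forest (boundary T) C₂) ≡ forest (boundary (S ++ T)) C
  forest-boundary-++ S T C = trans (sym (forest-+ _ _ C)) (forest-cong C (boundary-++ S T))

  -- The trees hanging from S are cut along the edges leaving the region χ = 1; B is what stays attached to S.
  Cut : List X → List X → Set
  Cut S R = hang tree S R ≡ Spl R (λ B C → ∏ B χ * hang tree S B * forest (boundary (S ++ B)) C)

  TreeCut : X → List X → Set
  TreeCut q V = tree q V ≡ Spl V (λ B C → ∏ B χ * tree q B * forest (boundary (q ∷ B)) C)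

  -- For nonempty `R` both sides vanish: a nonempty `B` cannot hang from nothing, and an empty `B`
  -- leaves a nonempty `C` without a possible root.
  hang-cut-[] : ∀ R → Cut [] R
  hang-cut-[] []      = refl
  hang-cut-[] (x ∷ R) = sym (cong₂ _+_
    (trans (Spl-cong R (λ B C → cong (_* forest (boundary (x ∷ B)) C) (*-zeroʳ (∏ (x ∷ B) χ)))) (Spl-0 R))
    (trans (Spl-cong R (λ { []      C → trans (*-identityˡ _) (forest-0 x C (λ v → *-zeroʳ (χ′ v)))
                          ; (b ∷ B) C → cong (_* forest (boundary (b ∷ B)) (x ∷ C)) (*-zeroʳ (∏ (b ∷ B) χ)) })) (Spl-0 R)))

  -- Each root has its own attached part and its own cut-off part. The cut-off parts recombine
  -- because `boundary` is additive in `S` and `forest-+` turns sums of root weights into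
  -- convolutions.
  hang-cut : ∀ S R → (∀ q B → length B ≤ length R → TreeCut q B) → Cut S R
  hang-cut []      R h = hang-cut-[] R
  hang-cut (q ∷ Q) R h = begin
    Spl R (λ R₁ R₂ → tree q R₁ * hang tree Q R₂)
      ≡⟨ Spl-congⁱ R (λ R₁ R₂ i → trans (cong₂ _*_ (h q R₁ (length-splitˡ i))
           (hang-cut Q R₂ (λ q′ B l → h q′ B (≤-trans l (length-splitʳ i))))) (Spl-*-Spl R₁ R₂ _ _)) ⟩
    Spl R (λ R₁ R₂ → Spl R₁ (λ B₁ C₁ → Spl R₂ (λ B₂ C₂ →
      ∏ B₁ χ * tree q B₁ * φ (q ∷ B₁) C₁ * (∏ B₂ χ * hang tree Q B₂ * φ (Q ++ B₂) C₂))))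
      ≡⟨ Spl-interchange R _ ⟨
    Spl R (λ B C → Spl B (λ B₁ B₂ → Spl C (λ C₁ C₂ →
      ∏ B₁ χ * tree q B₁ * φ (q ∷ B₁) C₁ * (∏ B₂ χ * hang tree Q B₂ * φ (Q ++ B₂) C₂))))
      ≡⟨ Spl-cong R (λ B C → trans (Spl-congⁱ B (λ B₁ B₂ i → merge C B B₁ B₂ i)) (begin
           Spl B (λ B₁ B₂ → tree q B₁ * hang tree Q B₂ * (∏ B χ * φ (q ∷ Q ++ B) C))
             ≡⟨ Spl-*ʳ _ B _ ⟩
           hang tree (q ∷ Q) B * (∏ B χ * φ (q ∷ Q ++ B) C)
             ≡⟨ rearrange₂ (hang tree (q ∷ Q) B) (∏ B χ) _ ⟩
           ∏ B χ * hang tree (q ∷ Q) B * φ (q ∷ Q ++ B) C ∎)) ⟩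
    Spl R (λ B C → ∏ B χ * hang tree (q ∷ Q) B * forest (boundary (q ∷ Q ++ B)) C) ∎
    where
    φ : List X → List X → ℕ
    φ S C = forest (boundary S) C
    rearrange₁ : ∀ a b c d e f → a * b * c * (d * e * f) ≡ a * d * b * e * (c * f)
    rearrange₁ = solve-∀
    rearrange₂ : ∀ a b c → a * (b * c) ≡ b * a * c
    rearrange₂ = solve-∀
    rearrange₃ : ∀ a b c d → a * b * c * d ≡ b * c * (a * d)
    rearrange₃ = solve-∀
    merge : ∀ C B B₁ B₂ → Interleaving B₁ B₂ B →
      Spl C (λ C₁ C₂ → ∏ B₁ χ * tree q B₁ * φ (q ∷ B₁) C₁ * (∏ B₂ χ * hang tree Q B₂ * φ (Q ++ B₂) C₂)) ≡
      tree q B₁ * hang tree Q B₂ * (∏ B χ * φ (q ∷ Q ++ B) C)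
    merge C B B₁ B₂ i = begin
      Spl C (λ C₁ C₂ → ∏ B₁ χ * tree q B₁ * φ (q ∷ B₁) C₁ * (∏ B₂ χ * hang tree Q B₂ * φ (Q ++ B₂) C₂))
        ≡⟨ Spl-cong C (λ C₁ C₂ → rearrange₁ (∏ B₁ χ) (tree q B₁) _ (∏ B₂ χ) (hang tree Q B₂) _) ⟩
      Spl C (λ C₁ C₂ → ∏ B₁ χ * ∏ B₂ χ * tree q B₁ * hang tree Q B₂ * (φ (q ∷ B₁) C₁ * φ (Q ++ B₂) C₂))
        ≡⟨ Spl-* (∏ B₁ χ * ∏ B₂ χ * tree q B₁ * hang tree Q B₂) C _ ⟩
      ∏ B₁ χ * ∏ B₂ χ * tree q B₁ * hang tree Q B₂ * Spl C (λ C₁ C₂ → φ (q ∷ B₁) C₁ * φ (Q ++ B₂) C₂)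
        ≡⟨ cong₂ (λ p z → p * tree q B₁ * hang tree Q B₂ * z)
             (trans (sym (∏-++ B₁ B₂ χ)) (∏-↭ χ (↭-sym (toPermutation i))))
             (trans (forest-boundary-++ (q ∷ B₁) (Q ++ B₂) C) (forest-boundary-↭ (prep q perm) C)) ⟩
      ∏ B χ * tree q B₁ * hang tree Q B₂ * φ (q ∷ Q ++ B) C
        ≡⟨ rearrange₃ (∏ B χ) (tree q B₁) _ _ ⟩
      tree q B₁ * hang tree Q B₂ * (∏ B χ * φ (q ∷ Q ++ B) C) ∎
      where
      perm : B₁ ++ (Q ++ B₂) ↭ Q ++ B
      perm = ↭-trans (↭.shifts B₁ Q) (↭.++⁺ˡ Q (↭-sym (toPermutation i)))

  -- The equation `χ + χ′ = 1` separates the inner children of `q` from the outer ones. The outer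
  -- ones are cut off at `q`; below the inner ones the induction applies, and what it cuts off is
  -- merged with the former.
  tree-cut : ∀ k q V → length V ≤ k → TreeCut q V
  tree-cut zero    q [] _   = cong (_+ 0) refl
  tree-cut (suc k) q V V≤k = begin
    tree q V
      ≡⟨ trans (tree≡forest q V) (forest-cong V (λ v → sym (split v))) ⟩
    -- The term `w q v + 0` is the value of `∑ (q ∷ []) (λ s → w s v)`, so the second summand is
    -- `boundary (q ∷ [])` by definition.
    forest (λ v → χ v * w q v + χ′ v * (w q v + 0)) V
      ≡⟨ forest-+ _ _ V ⟩
    Spl V (λ D E → forest (λ v → χ v * w q v) D * φ (q ∷ []) E)
      ≡⟨ Spl-congⁱ V (λ D E i → trans (cong (_* φ (q ∷ []) E) (inside D (≤-trans (length-splitˡ i) V≤k))) (sym (Spl-*ʳ _ D _))) ⟩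
    Spl V (λ D E → Spl D (λ B C → ∏ B χ * tree q B * φ B C * φ (q ∷ []) E))
      ≡⟨ Spl-assoc V _ ⟩
    Spl V (λ B F → Spl F (λ C E → ∏ B χ * tree q B * φ B C * φ (q ∷ []) E))
      ≡⟨ Spl-cong V (λ B F → trans (Spl-cong F (λ C E → *-assoc (∏ B χ * tree q B) _ _)) (trans (Spl-* (∏ B χ * tree q B) F _)
           (cong (∏ B χ * tree q B *_) (trans (forest-boundary-++ B (q ∷ []) F) (forest-boundary-↭ (↭-sym (↭.∷↭∷ʳ q B)) F))))) ⟩
    Spl V (λ B C → ∏ B χ * tree q B * φ (q ∷ B) C) ∎
    where
    φ : List X → List X → ℕ
    φ S C = forest (boundary S) C
    split : ∀ v → χ v * w q v + χ′ v * (w q v + 0) ≡ w q v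
    split v = begin
      χ v * w q v + χ′ v * (w q v + 0)  ≡⟨ cong (λ z → χ v * w q v + χ′ v * z) (+-identityʳ _) ⟩
      χ v * w q v + χ′ v * w q v        ≡⟨ *-distribʳ-+ (w q v) (χ v) (χ′ v) ⟨
      (χ v + χ′ v) * w q v              ≡⟨ cong (_* w q v) (χ+χ′≡1 v) ⟩
      1 * w q v                         ≡⟨ *-identityˡ _ ⟩
      w q v                             ∎
    rearrange : ∀ a b c d e → a * b * (c * d * e) ≡ (a * c) * (b * d) * e
    rearrange = solve-∀
    inside : ∀ D → length D ≤ suc k →
      forest (λ v → χ v * w q v) D ≡ Spl D (λ B C → ∏ B χ * tree q B * φ B C)
    inside D D≤k = begin
      Spl D (λ S R → ∏ S (λ v → χ v * w q v) * hang tree S R)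
        ≡⟨ Spl-congⁱ D (λ S R i → trans (cong₂ _*_ (∏-* S χ (w q)) (cut S R i)) (sym (Spl-* (∏ S χ * ∏ S (w q)) R _))) ⟩
      Spl D (λ S R → Spl R (λ B C → ∏ S χ * ∏ S (w q) * (∏ B χ * hang tree S B * φ (S ++ B) C)))
        ≡⟨ Spl-cong D (λ S R → Spl-cong R (λ B C → rearrange (∏ S χ) (∏ S (w q)) (∏ B χ) _ _)) ⟩
      Spl D (λ S R → Spl R (λ B C → (∏ S χ * ∏ B χ) * (∏ S (w q) * hang tree S B) * φ (S ++ B) C))
        ≡⟨ Spl-assoc D _ ⟨
      Spl D (λ B C → Spl B (λ S R → (∏ S χ * ∏ R χ) * (∏ S (w q) * hang tree S R) * φ (S ++ R) C))
        ≡⟨ Spl-cong D (λ B C → begin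
             Spl B (λ S R → (∏ S χ * ∏ R χ) * (∏ S (w q) * hang tree S R) * φ (S ++ R) C)
               ≡⟨ Spl-congⁱ B (λ S R i → cong₂ (λ p z → p * (∏ S (w q) * hang tree S R) * z)
                    (trans (sym (∏-++ S R χ)) (∏-↭ χ (↭-sym (toPermutation i))))
                    (forest-boundary-↭ (↭-sym (toPermutation i)) C)) ⟩
             Spl B (λ S R → ∏ B χ * (∏ S (w q) * hang tree S R) * φ B C)
               ≡⟨ trans (Spl-*ʳ (φ B C) B _) (cong (_* φ B C) (Spl-* (∏ B χ) B _)) ⟩
             ∏ B χ * forest (w q) B * φ B C
               ≡⟨ cong (λ t → ∏ B χ * t * φ B C) (sym (tree≡forest q B)) ⟩
             ∏ B χ * tree q B * φ B C ∎) ⟩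
      Spl D (λ B C → ∏ B χ * tree q B * φ B C) ∎
      where
      cut : ∀ S R → Interleaving S R D → Cut S R
      -- Without roots `R` need not be shorter than `D`; this case is settled without the induction.
      cut []      R i = hang-cut-[] R
      cut (s ∷ S) R i = hang-cut (s ∷ S) R (λ q′ B l → tree-cut k q′ B
        (s≤s⁻¹ (≤-trans (s≤s (≤-trans l (m≤n+m _ (length S)))) (≤-trans (≤-reflexive (length-split i)) D≤k))))

-- Transport of weights along maps of vertices

All-split : ∀ {P : A → Set} {V B C} → Interleaving B C V → All P V → All P B × All P C
All-split {B = B} i pV = All.++⁻ B (↭.All-resp-↭ (toPermutation i) pV)

module _ {X Y : Set} (w : X → X → ℕ) (w′ : Y → Y → ℕ) (h : X → Y) (P : X → Set)
  (h-weight : ∀ {u v} → P u → P v → w u v ≡ w′ (h u) (h v)) where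
  private
    module F = Forest w
    module F′ = Forest w′

  hang-map : ∀ {t : X → List X → ℕ} {t′ : Y → List Y → ℕ} S R → All P S → All P R →
    (∀ q B → P q → All P B → t q B ≡ t′ (h q) (map h B)) → hang t S R ≡ hang t′ (map h S) (map h R)
  hang-map []      []      _ _ _ = refl
  hang-map []      (_ ∷ _) _ _ _ = refl
  hang-map (q ∷ Q) R (pq ∷ pQ) pR e = trans
    (Spl-congⁱ R (λ B C i → let pB , pC = All-split i pR in
      cong₂ _*_ (e q B pq pB) (hang-map Q C pQ pC e)))
    (sym (Spl-map h R _))

  plant-map : ∀ {t : X → List X → ℕ} {t′ : Y → List Y → ℕ} {a a′} V → All P V →
    (∀ q B → P q → All P B → t q B ≡ t′ (h q) (map h B)) → (∀ {v} → P v → a v ≡ a′ (h v)) →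
    plant t a V ≡ plant t′ a′ (map h V)
  plant-map {a = a} {a′} V pV e e′ = trans
    (Spl-congⁱ V (λ S R i → let pS , pR = All-split i pV in cong₂ _*_ (∏-map S pS) (hang-map S R pS pR e)))
    (sym (Spl-map h V _))
    where
    ∏-map : ∀ S → All P S → ∏ S a ≡ ∏ (map h S) a′
    ∏-map []      []        = refl
    ∏-map (s ∷ S) (ps ∷ pS) = cong₂ _*_ (e′ ps) (∏-map S pS)

  treeₙ-map : ∀ k q V → P q → All P V → F.treeₙ k q V ≡ F′.treeₙ k (h q) (map h V)
  treeₙ-map zero    q []      _  _  = refl
  treeₙ-map zero    q (_ ∷ _) _  _  = refl
  treeₙ-map (suc k) q V       pq pV = plant-map V pV (treeₙ-map k) (h-weight pq)

  -- Weights see the vertices through `w` only. The predicate `P` confines the comparison to the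
  -- vertices at hand, as the mirroring of labels preserves admissibility within one list only.
  tree-map : ∀ q V → P q → All P V → F.tree q V ≡ F′.tree (h q) (map h V)
  tree-map q V pq pV = trans (treeₙ-map (length V) q V pq pV)
    (cong (λ k → F′.treeₙ k (h q) (map h V)) (sym (length-map h V)))

-- Independence of the root

module Root {X : Set} (w : X → X → ℕ) (w-sym : ∀ u v → w u v ≡ w v u) where
  open Forest w

  SwapRoot : ℕ → Set
  SwapRoot k = ∀ x y V → length V ≤ k → tree x (y ∷ V) ≡ tree y (x ∷ V)

  swapRoot⇒anyRoot : ∀ {k} → SwapRoot k → ∀ {x y V W} → x ∷ V ↭ y ∷ W → length V ≤ suc k → tree x V ≡ tree y W
  swapRoot⇒anyRoot s {x} {y} {V} {W} p V≤k with ↭.∈-resp-↭ (↭-sym p) (here refl)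
  ... | here refl = tree-↭ x (↭.drop-∷ p)
  ... | there y∈V with U₁ , U₂ , refl ← ∈-∃++ y∈V = begin
    tree x V        ≡⟨ tree-↭ x V↭ ⟩
    tree x (y ∷ U)  ≡⟨ s x y U (s≤s⁻¹ (subst (_≤ suc _) (↭-length V↭) V≤k)) ⟩
    tree y (x ∷ U)  ≡⟨ tree-↭ y (↭.drop-∷ (↭-trans (Perm.swap y x ↭-refl) (↭-trans (prep x (↭-sym V↭)) p))) ⟩
    tree y W        ∎
    where
    U = U₁ ++ U₂
    V↭ : V ↭ y ∷ U
    V↭ = shift y U₁ U₂

  -- All trees are rerooted at `y`, after which the weight of the original root sums freely.
  Pick-root : ∀ {k} → SwapRoot k → ∀ (a : X → ℕ) y B → length B ≤ suc k →
    Pick (y ∷ B) (λ z B′ → a z * tree z B′) ≡ ∑ (y ∷ B) a * tree y B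
  Pick-root s a y B B≤k = begin
    Pick (y ∷ B) (λ z B′ → a z * tree z B′)
      ≡⟨ Pick-cong↭ (y ∷ B) (λ z B′ p → cong (a z *_) (sym (swapRoot⇒anyRoot s (↭-sym p) B≤k))) ⟩
    Pick (y ∷ B) (λ z _ → a z * tree y B)
      ≡⟨ trans (Pick-*ʳ (tree y B) (y ∷ B) (λ z _ → a z)) (cong (_* tree y B) (Pick-∑ (y ∷ B) a)) ⟩
    ∑ (y ∷ B) a * tree y B ∎

  -- K is the component through which x and y are joined, b and z are its vertices attached to x and y.
  link : X → X → List X → ℕ
  link x y K = Pick K (λ b K′ → Pick K (λ z _ → w x b * w y z * tree b K′))

  Pick-swap : ∀ (V W : List X) (f : X → List X → X → List X → ℕ) →
    Pick V (λ y V′ → Pick W (f y V′)) ≡ Pick W (λ z W′ → Pick V (λ y V′ → f y V′ z W′))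
  Pick-swap []      W f = sym (Pick-0 W)
  Pick-swap (x ∷ V) W f = trans (cong (Pick W (f x V) +_) (Pick-swap V W _)) (sym (Pick-+ W _ _))

  -- The tree on `K` is rerooted from `b`, the neighbour of `x`, to `z`, the neighbour of `y`.
  link-sym : ∀ {k} → SwapRoot k → ∀ x y K → length K ≤ suc (suc k) → link x y K ≡ link y x K
  link-sym s x y K K≤k = begin
    Pick K (λ b K′ → Pick K (λ z K″ → w x b * w y z * tree b K′))
      ≡⟨ Pick-cong↭ K (λ b K′ p → Pick-cong↭ K (λ z K″ q → cong₂ _*_ (*-comm (w x b) (w y z))
           (swapRoot⇒anyRoot s (↭-trans p (↭-sym q)) (s≤s⁻¹ (≤-trans (≤-reflexive (↭-length p)) K≤k))))) ⟩
    Pick K (λ b K′ → Pick K (λ z K″ → w y z * w x b * tree z K″))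
      ≡⟨ Pick-swap K K _ ⟩
    link y x K ∎

  -- In a tree, `x` and `y` are either adjacent, or exactly one component `K` of the tree without
  -- them has edges to both. `expand` sorts the trees accordingly, leaving a tree at `x` and a tree
  -- at `y` as further factors. The result is symmetric because `w` is and because the smaller tree
  -- on `K` can be rerooted by induction.
  swapRoot : ∀ k → SwapRoot k
  swapRoot′ : ∀ k x y V → length V ≤ k →
    (∀ a y B → length B ≤ length V → Pick (y ∷ B) (λ z B′ → a z * tree z B′) ≡ ∑ (y ∷ B) a * tree y B) →
    (∀ x y K → length K ≤ length V → link x y K ≡ link y x K) →
    tree x (y ∷ V) ≡ tree y (x ∷ V)

  swapRoot′ k x y V V≤k pick linkSym = begin
    tree x (y ∷ V)
      ≡⟨ expand x y ⟩
    w x y * Spl V (λ B C → tree y B * tree x C) + Spl V (λ K E → Spl E (λ B C → link x y K * (tree y B * tree x C)))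
      ≡⟨ cong₂ _+_ (cong₂ _*_ (w-sym x y) (trans (Spl-comm V _) (Spl-cong V (λ B C → *-comm (tree y C) (tree x B)))))
           (Spl-congⁱ V (λ K E i → trans (Spl-comm E _) (Spl-cong E (λ B C → cong₂ _*_ (linkSym x y K (length-splitˡ i)) (*-comm (tree y C) _))))) ⟩
    w y x * Spl V (λ B C → tree x B * tree y C) + Spl V (λ K E → Spl E (λ B C → link y x K * (tree x B * tree y C)))
      ≡⟨ expand y x ⟨
    tree y (x ∷ V) ∎
    where
    -- The tree on `y ∷ B` is attached to `x` by `b`. Deleting `y` isolates the component `K` of
    -- `b`, while `C` stays below `y`.
    through : ∀ x y B → length B ≤ length V →
      ∑ B (w x) * tree y B ≡ Spl B (λ K C → link x y K * tree y C)
    through x y B B≤V = begin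
      ∑ B (w x) * tree y B
        ≡⟨ trans (cong (_* tree y B) (sym (Pick-∑ B (w x)))) (sym (Pick-*ʳ (tree y B) B _)) ⟩
      Pick B (λ b B′ → w x b * tree y B)
        ≡⟨ Pick-cong↭ B (λ b B′ p → cong (w x b *_) (trans (tree-↭ y (↭-sym p)) (trans (tree≡forest y (b ∷ B′)) (forest-component (w y) b B′)))) ⟩
      Pick B (λ b B′ → w x b * Spl B′ (λ K C → Pick (b ∷ K) (λ z K′ → w y z * tree z K′) * forest (w y) C))
        ≡⟨ Pick-cong↭ B (λ b B′ p → trans (sym (Spl-* (w x b) B′ _)) (Spl-congⁱ B′ (λ K C i →
             cong₂ (λ s t → w x b * (s * t)) (pick (w y) b K (≤-trans (length-splitˡ i)
               (≤-trans (≤-trans (n≤1+n _) (≤-reflexive (↭-length p))) B≤V))) (sym (tree≡forest y C))))) ⟩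
      Pick B (λ b B′ → Spl B′ (λ K C → w x b * (∑ (b ∷ K) (w y) * tree b K * tree y C)))
        ≡⟨ Spl-Pick B _ ⟨
      Spl B (λ K C → Pick K (λ b K′ → w x b * (∑ (b ∷ K′) (w y) * tree b K′ * tree y C)))
        ≡⟨ Spl-cong B (λ K C → trans (Pick-cong↭ K (λ b K′ p → attach b K K′ C p)) (Pick-*ʳ (tree y C) K _)) ⟩
      Spl B (λ K C → link x y K * tree y C) ∎
      where
      rearrange : ∀ a b c d → a * (b * c * d) ≡ b * (a * c) * d
      rearrange = solve-∀
      rearrange′ : ∀ a b c → a * (b * c) ≡ b * a * c
      rearrange′ = solve-∀
      attach : ∀ b K K′ C → b ∷ K′ ↭ K → w x b * (∑ (b ∷ K′) (w y) * tree b K′ * tree y C) ≡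
        Pick K (λ z _ → w x b * w y z * tree b K′) * tree y C
      attach b K K′ C p = begin
        w x b * (∑ (b ∷ K′) (w y) * tree b K′ * tree y C)
          ≡⟨ cong (λ s → w x b * (s * tree b K′ * tree y C)) (trans (∑-↭ (w y) p) (sym (Pick-∑ K (w y)))) ⟩
        w x b * (Pick K (λ z _ → w y z) * tree b K′ * tree y C)
          ≡⟨ rearrange (w x b) (Pick K (λ z _ → w y z)) (tree b K′) (tree y C) ⟩
        Pick K (λ z _ → w y z) * (w x b * tree b K′) * tree y C
          ≡⟨ cong (_* tree y C) (trans (sym (Pick-*ʳ (w x b * tree b K′) K _)) (Pick-cong K (λ z _ → rearrange′ (w y z) (w x b) (tree b K′)))) ⟩
        Pick K (λ z _ → w x b * w y z * tree b K′) * tree y C ∎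
    -- The component of `y` below `x` hangs from `x` by any one of its vertices. Once it is rerooted
    -- at `y`, the sum over that vertex consists of `y` itself and of `B`.
    expand : ∀ x y → tree x (y ∷ V) ≡
      w x y * Spl V (λ B C → tree y B * tree x C) + Spl V (λ K E → Spl E (λ B C → link x y K * (tree y B * tree x C)))
    expand x y = begin
      tree x (y ∷ V)
        ≡⟨ trans (tree≡forest x (y ∷ V)) (forest-component (w x) y V) ⟩
      Spl V (λ B C → Pick (y ∷ B) (λ z B′ → w x z * tree z B′) * forest (w x) C)
        ≡⟨ Spl-congⁱ V (λ B C i → cong₂ _*_ (pick (w x) y B (length-splitˡ i)) (sym (tree≡forest x C))) ⟩
      Spl V (λ B C → (w x y + ∑ B (w x)) * tree y B * tree x C)
        ≡⟨ Spl-cong V (λ B C → rearrange (w x y) (∑ B (w x)) (tree y B) (tree x C)) ⟩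
      Spl V (λ B C → w x y * (tree y B * tree x C) + ∑ B (w x) * tree y B * tree x C)
        ≡⟨ trans (Spl-+ V _ _) (cong₂ _+_ (Spl-* (w x y) V _) (begin
             Spl V (λ B C → ∑ B (w x) * tree y B * tree x C)
               ≡⟨ Spl-congⁱ V (λ B C i → trans (cong (_* tree x C) (through x y B (length-splitˡ i))) (sym (Spl-*ʳ (tree x C) B _))) ⟩
             Spl V (λ E C → Spl E (λ K B → link x y K * tree y B * tree x C))
               ≡⟨ Spl-assoc V _ ⟩
             Spl V (λ K E → Spl E (λ B C → link x y K * tree y B * tree x C))
               ≡⟨ Spl-cong V (λ K E → Spl-cong E (λ B C → *-assoc (link x y K) _ _)) ⟩
             Spl V (λ K E → Spl E (λ B C → link x y K * (tree y B * tree x C))) ∎)) ⟩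
      w x y * Spl V (λ B C → tree y B * tree x C) + Spl V (λ K E → Spl E (λ B C → link x y K * (tree y B * tree x C))) ∎
      where
      rearrange : ∀ a b c d → (a + b) * c * d ≡ a * (c * d) + b * c * d
      rearrange = solve-∀

  swapRoot zero    x y []      z≤n = swapRoot′ zero x y [] z≤n
    (λ { a y [] _ → trans (+-identityʳ _) (cong (_* tree y []) (sym (+-identityʳ (a y)))) })
    (λ { x y [] _ → refl })
  swapRoot (suc k) x y V V≤k = swapRoot′ (suc k) x y V V≤k
    (λ a y B B≤V → Pick-root (swapRoot k) a y B (≤-trans B≤V V≤k))
    (λ x y K K≤V → link-sym (swapRoot k) x y K (≤-trans K≤V (≤-trans V≤k (n≤1+n _))))

  anyRoot : ∀ {x y V W} → x ∷ V ↭ y ∷ W → tree x V ≡ tree y W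
  anyRoot {V = V} p = swapRoot⇒anyRoot (swapRoot (length V)) p (n≤1+n _)

-- Sums over labellings

-- A linear functional ∫ l for each l extends to lists of pairs (l , c) with prescribed first components.
module Labelling {A C : Set} (∫ : A → (C → ℕ) → ℕ) (Ok : C → Set)
  (∫-congᴼ : ∀ l {f g : C → ℕ} → (∀ c → Ok c → f c ≡ g c) → ∫ l f ≡ ∫ l g)
  (∫-+ : ∀ l (f g : C → ℕ) → ∫ l (λ c → f c + g c) ≡ ∫ l f + ∫ l g)
  (∫-* : ∀ l k (f : C → ℕ) → ∫ l (λ c → k * f c) ≡ k * ∫ l f)
  (∫-swap : ∀ l l′ (f : C → C → ℕ) → ∫ l (λ c → ∫ l′ (f c)) ≡ ∫ l′ (λ c′ → ∫ l (λ c → f c c′))) where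

  Lab : List A → (List (A × C) → ℕ) → ℕ
  Lab []      f = f []
  Lab (l ∷ V) f = ∫ l (λ c → Lab V (λ K → f ((l , c) ∷ K)))

  ∫-cong : ∀ l {f g} → (∀ c → f c ≡ g c) → ∫ l f ≡ ∫ l g
  ∫-cong l h = ∫-congᴼ l (λ c _ → h c)

  -- Only under the sum is it known that the labels of `K` are `V` and that its second components
  -- satisfy `Ok`.
  Lab-congᴼ : ∀ V {f g} → (∀ K → map proj₁ K ≡ V → All (λ k → Ok (proj₂ k)) K → f K ≡ g K) → Lab V f ≡ Lab V g
  Lab-congᴼ []      h = h [] refl []
  Lab-congᴼ (l ∷ V) h = ∫-congᴼ l (λ c ok → Lab-congᴼ V (λ K e oks → h ((l , c) ∷ K) (cong (l ∷_) e) (ok ∷ oks)))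

  Lab-cong : ∀ V {f g} → (∀ K → f K ≡ g K) → Lab V f ≡ Lab V g
  Lab-cong V h = Lab-congᴼ V (λ K _ _ → h K)

  Lab-+ : ∀ V f g → Lab V (λ K → f K + g K) ≡ Lab V f + Lab V g
  Lab-+ []      f g = refl
  Lab-+ (l ∷ V) f g = trans (∫-cong l (λ c → Lab-+ V _ _)) (∫-+ l _ _)

  Lab-* : ∀ k V f → Lab V (λ K → k * f K) ≡ k * Lab V f
  Lab-* k []      f = refl
  Lab-* k (l ∷ V) f = trans (∫-cong l (λ c → Lab-* k V _)) (∫-* l k _)

  Lab-*ʳ : ∀ k V f → Lab V (λ K → f K * k) ≡ Lab V f * k
  Lab-*ʳ k V f = trans (Lab-cong V (λ K → *-comm (f K) k)) (trans (Lab-* k V f) (*-comm k _))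

  Lab-*-Lab : ∀ V W f g → Lab V f * Lab W g ≡ Lab V (λ K → Lab W (λ L → f K * g L))
  Lab-*-Lab V W f g = trans (sym (Lab-*ʳ (Lab W g) V f)) (Lab-cong V (λ K → sym (Lab-* (f K) W g)))

  ∫-0 : ∀ l → ∫ l (λ _ → 0) ≡ 0
  ∫-0 l = ∫-* l 0 (λ _ → 0)

  ∫-Spl : ∀ l (V : List X) (f : C → List X → List X → ℕ) →
    ∫ l (λ c → Spl V (f c)) ≡ Spl V (λ B D → ∫ l (λ c → f c B D))
  ∫-Spl l []      f = refl
  ∫-Spl l (x ∷ V) f = trans (∫-+ l _ _) (cong₂ _+_ (∫-Spl l V _) (∫-Spl l V _))

  ∫-Pick : ∀ l (V : List X) (f : C → X → List X → ℕ) →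
    ∫ l (λ c → Pick V (f c)) ≡ Pick V (λ y V′ → ∫ l (λ c → f c y V′))
  ∫-Pick l []      f = ∫-0 l
  ∫-Pick l (x ∷ V) f = trans (∫-+ l _ _) (cong (∫ l (λ c → f c x V) +_) (∫-Pick l V _))

  ∫-Lab : ∀ l V (f : C → List (A × C) → ℕ) → ∫ l (λ c → Lab V (f c)) ≡ Lab V (λ K → ∫ l (λ c → f c K))
  ∫-Lab l []       f = refl
  ∫-Lab l (l′ ∷ V) f = trans (∫-swap l l′ (λ c d → Lab V (λ K → f c ((l′ , d) ∷ K)))) (∫-cong l′ (λ c′ → ∫-Lab l V _))

  -- Second components are chosen independently, so each part of a splitting is labelled by itself;
  -- labelled sums of convolutions are convolutions again.
  Lab-Spl : ∀ V (f : List (A × C) → List (A × C) → ℕ) →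
    Lab V (λ K → Spl K f) ≡ Spl V (λ B D → Lab B (λ K → Lab D (f K)))
  Lab-Spl []      f = refl
  Lab-Spl (x ∷ V) f = begin
    ∫ x (λ c → Lab V (λ K → Spl K (λ L M → f ((x , c) ∷ L) M) + Spl K (λ L M → f L ((x , c) ∷ M))))
      ≡⟨ trans (∫-cong x (λ c → trans (Lab-+ V _ _) (cong₂ _+_ (Lab-Spl V _) (Lab-Spl V _)))) (∫-+ x _ _) ⟩
    ∫ x (λ c → Spl V (λ B D → Lab B (λ K → Lab D (λ L → f ((x , c) ∷ K) L))))
      + ∫ x (λ c → Spl V (λ B D → Lab B (λ K → Lab D (λ L → f K ((x , c) ∷ L)))))
      ≡⟨ cong₂ _+_ (∫-Spl x V _) (trans (∫-Spl x V _) (Spl-cong V (λ B D → ∫-Lab x B _))) ⟩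
    Spl (x ∷ V) (λ B D → Lab B (λ K → Lab D (f K))) ∎

  Lab-Pick : ∀ V (f : A × C → List (A × C) → ℕ) →
    Lab V (λ K → Pick K f) ≡ Pick V (λ l V′ → ∫ l (λ c → Lab V′ (f (l , c))))
  Lab-Pick []      f = refl
  Lab-Pick (x ∷ V) f = begin
    ∫ x (λ c → Lab V (λ K → f (x , c) K + Pick K (λ y K′ → f y ((x , c) ∷ K′))))
      ≡⟨ trans (∫-cong x (λ c → Lab-+ V _ _)) (∫-+ x _ _) ⟩
    ∫ x (λ c → Lab V (f (x , c))) + ∫ x (λ c → Lab V (λ K → Pick K (λ y K′ → f y ((x , c) ∷ K′))))
      ≡⟨ cong (∫ x (λ c → Lab V (f (x , c))) +_) (begin
           ∫ x (λ c → Lab V (λ K → Pick K (λ y K′ → f y ((x , c) ∷ K′))))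
             ≡⟨ trans (∫-cong x (λ c → Lab-Pick V _)) (∫-Pick x V _) ⟩
           Pick V (λ l V′ → ∫ x (λ c → ∫ l (λ d → Lab V′ (λ K′ → f (l , d) ((x , c) ∷ K′)))))
             ≡⟨ Pick-cong V (λ l V′ → ∫-swap x l (λ c d → Lab V′ (λ K′ → f (l , d) ((x , c) ∷ K′)))) ⟩
           Pick V (λ l V′ → ∫ l (λ d → Lab (x ∷ V′) (f (l , d)))) ∎) ⟩
    Pick (x ∷ V) (λ l V′ → ∫ l (λ c → Lab V′ (f (l , c)))) ∎

  Lab-↭ : ∀ {V W f} → (∀ {K L} → K ↭ L → f K ≡ f L) → V ↭ W → Lab V f ≡ Lab W f
  Lab-↭ r Perm.refl = refl
  Lab-↭ r (Perm.prep x p) = ∫-cong x (λ c → Lab-↭ (λ q → r (prep _ q)) p)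
  Lab-↭ {x ∷ y ∷ V} {f = f} r (Perm.swap x y p) = trans (∫-swap x y (λ c d → Lab V (λ K → f ((x , c) ∷ (y , d) ∷ K)))) (∫-cong y (λ d → ∫-cong x (λ c →
    trans (Lab-cong V (λ K → r (Perm.swap (x , c) (y , d) ↭-refl))) (Lab-↭ (λ q → r (prep _ (prep _ q))) p))))
  Lab-↭ r (Perm.trans p q) = trans (Lab-↭ r p) (Lab-↭ r q)

-- Weights depending on the parent only

module Cayley {X : Set} (s : X → ℕ) where
  open Forest (λ q (_ : X) → s q)

  -- Cayley's formula for forests: `n` vertices of total weight `M`, with weight `c` for every root,
  -- give c (c + M)^(n-1), and the empty forest gives 1.
  cayley : ℕ → ℕ → ℕ → ℕ
  cayley c M zero    = 1
  cayley c M (suc n) = c * (c + M) ^ n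

  ∏-const : ∀ c (V : List X) → ∏ V (λ _ → c) ≡ c ^ length V
  ∏-const c []      = refl
  ∏-const c (x ∷ V) = cong (c *_) (∏-const c V)

  -- A child of a member of `S` contributes the weight of that member, so `S` acts like a single
  -- parent of weight `∑ S s`.
  hang-parent : ∀ S R → hang tree S R ≡ forest (λ _ → ∑ S s) R
  hang-parent []      []      = refl
  hang-parent []      (x ∷ R) = sym (forest-0 x R (λ _ → refl))
  hang-parent (q ∷ Q) R = trans (Spl-cong R (λ B C → cong₂ _*_ (tree≡forest q B) (hang-parent Q C)))
                                (sym (forest-+ (λ _ → s q) (λ _ → ∑ Q s) R))

  module _ (c M : ℕ) where
    binomial : ∀ (V : List X) → Spl V (λ S R → c ^ length S * M ^ length R) ≡ (c + M) ^ length V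
    binomial V = begin
      Spl V (λ S R → c ^ length S * M ^ length R)             ≡⟨ Spl-cong V (λ S R → cong₂ _*_ (∏-const c S) (∏-const M R)) ⟨
      Spl V (λ S R → ∏ S (λ _ → c) * ∏ R (λ _ → M))           ≡⟨ ∏-+ V _ _ ⟨
      ∏ V (λ _ → c + M)                                       ≡⟨ ∏-const (c + M) V ⟩
      (c + M) ^ length V                                      ∎

    -- In a list of length n, the splittings with a fixed vertex `y` in `S` have total weight c (c +
    -- M)^(n-1); this is then summed with the factors `s y`.
    binomial-∑ : ∀ x V → Spl (x ∷ V) (λ S R → c ^ length S * (∑ S s * M ^ length R)) ≡ c * ∑ (x ∷ V) s * (c + M) ^ length V
    -- The additional factor `c + M` removes the predecessor from the exponent and so includes the
    -- empty list, which lets the induction start.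
    binomial-∑′ : ∀ V → (c + M) * Spl V (λ S R → c ^ length S * (∑ S s * M ^ length R)) ≡ c * ∑ V s * (c + M) ^ length V

    binomial-∑ x V = begin
      Spl V (λ S R → c * c ^ length S * ((s x + ∑ S s) * M ^ length R)) + Spl V (λ S R → c ^ length S * (∑ S s * (M * M ^ length R)))
        ≡⟨ cong₂ _+_ (trans (Spl-cong V (λ S R → rearrange₁ c (c ^ length S) (s x) (∑ S s) (M ^ length R))) (Spl-+ V _ _))
             (trans (Spl-cong V (λ S R → rearrange₂ (c ^ length S) (∑ S s) M (M ^ length R))) (Spl-* M V _)) ⟩
      Spl V (λ S R → c * s x * (c ^ length S * M ^ length R)) + Spl V (λ S R → c * (c ^ length S * (∑ S s * M ^ length R))) + M * E
        ≡⟨ cong₂ (λ y z → y + z + M * E) (trans (Spl-* (c * s x) V _) (cong (c * s x *_) (binomial V))) (Spl-* c V _) ⟩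
      c * s x * (c + M) ^ length V + c * E + M * E
        ≡⟨ rearrange₃ (c * s x * (c + M) ^ length V) c M E ⟩
      c * s x * (c + M) ^ length V + (c + M) * E
        ≡⟨ cong (c * s x * (c + M) ^ length V +_) (binomial-∑′ V) ⟩
      c * s x * (c + M) ^ length V + c * ∑ V s * (c + M) ^ length V
        ≡⟨ rearrange₄ c (s x) (∑ V s) _ ⟩
      c * ∑ (x ∷ V) s * (c + M) ^ length V ∎
      where
      E = Spl V (λ S R → c ^ length S * (∑ S s * M ^ length R))
      rearrange₁ : ∀ c p x y q → c * p * ((x + y) * q) ≡ c * x * (p * q) + c * (p * (y * q))
      rearrange₁ = solve-∀
      rearrange₂ : ∀ p y m q → p * (y * (m * q)) ≡ m * (p * (y * q))
      rearrange₂ = solve-∀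
      rearrange₃ : ∀ a c m e → a + c * e + m * e ≡ a + (c + m) * e
      rearrange₃ = solve-∀
      rearrange₄ : ∀ c x y q → c * x * q + c * y * q ≡ c * (x + y) * q
      rearrange₄ = solve-∀

    binomial-∑′ []      = trans (*-zeroʳ (c + M)) (cong (_* 1) (sym (*-zeroʳ c)))
    binomial-∑′ (x ∷ V) = trans (cong ((c + M) *_) (binomial-∑ x V)) (*-left-comm (c + M) (c * ∑ (x ∷ V) s) _)

  ∑-split : ∀ {V S R : List X} → Interleaving S R V → ∑ S s + ∑ R s ≡ ∑ V s
  ∑-split {S = S} {R} i = trans (sym (∑-++ S R s)) (∑-↭ s (↭-sym (toPermutation i)))

  cayley-0 : ∀ c (V : List X) → Spl V (λ S R → c ^ length S * cayley 0 0 (length R)) ≡ c ^ length V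
  cayley-0 c []      = refl
  cayley-0 c (x ∷ V) = trans (cong₂ _+_
    (trans (Spl-cong V (λ S R → *-assoc c _ _)) (trans (Spl-* c V _) (cong (c *_) (cayley-0 c V))))
    (trans (Spl-cong V (λ S R → *-zeroʳ (c ^ length S))) (Spl-0 V))) (+-identityʳ _)

  -- Multiplying by M makes the summand with R = [] uniform with the others.
  layers : ∀ c x V → Spl (x ∷ V) (λ S R → c ^ length S * cayley (∑ S s) (∑ R s) (length R)) ≡
    cayley c (∑ (x ∷ V) s) (length (x ∷ V))
  layers c x V with ∑ (x ∷ V) s in eq
  -- A zero total cannot be cancelled. Here every member of `S` has weight 0, so only the summand
  -- with empty `R` survives.
  ... | zero = begin
    Spl (x ∷ V) (λ S R → c ^ length S * cayley (∑ S s) (∑ R s) (length R))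
      ≡⟨ Spl-congⁱ (x ∷ V) (λ S R i → let e = trans (∑-split i) eq in
           cong₂ (λ a b → c ^ length S * cayley a b (length R)) (m+n≡0⇒m≡0 (∑ S s) e) (m+n≡0⇒n≡0 (∑ S s) e)) ⟩
    Spl (x ∷ V) (λ S R → c ^ length S * cayley 0 0 (length R))
      ≡⟨ cayley-0 c (x ∷ V) ⟩
    c ^ length (x ∷ V)
      ≡⟨ cong (λ d → c * d ^ length V) (+-identityʳ c) ⟨
    c * (c + 0) ^ length V ∎
  ... | M@(suc _) = *-cancelˡ-≡ _ _ M (begin
    M * Spl (x ∷ V) (λ S R → c ^ length S * cayley (∑ S s) (∑ R s) (length R))
      ≡⟨ Spl-* M (x ∷ V) (λ S R → c ^ length S * cayley (∑ S s) (∑ R s) (length R)) ⟨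
    Spl (x ∷ V) (λ S R → M * (c ^ length S * cayley (∑ S s) (∑ R s) (length R)))
      ≡⟨ Spl-congⁱ (x ∷ V) (λ S R i → trans (*-left-comm M (c ^ length S) _) (cong (c ^ length S *_) (scale S R (trans (∑-split i) eq)))) ⟩
    Spl (x ∷ V) (λ S R → c ^ length S * (∑ S s * M ^ length R))
      ≡⟨ binomial-∑ c M x V ⟩
    c * ∑ (x ∷ V) s * (c + M) ^ length V
      ≡⟨ trans (cong (λ y → c * y * (c + M) ^ length V) eq) (rearrange c M ((c + M) ^ length V)) ⟩
    M * (c * (c + M) ^ length V) ∎)
    where
    rearrange : ∀ c m p → c * m * p ≡ m * (c * p)
    rearrange = solve-∀
    scale : ∀ S R → ∑ S s + ∑ R s ≡ M → M * cayley (∑ S s) (∑ R s) (length R) ≡ ∑ S s * M ^ length R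
    scale S []      e = cong (_* 1) (trans (sym e) (+-identityʳ _))
    scale S (r ∷ R) e = trans (cong (λ y → M * (∑ S s * y ^ length R)) e) (*-left-comm M (∑ S s) _)

  -- Forests are sorted by their set of roots `S`; below it lies a smaller forest with the constant
  -- root weight `∑ S s`.
  forest-cayley : ∀ k c V → length V ≤ k → forest (λ _ → c) V ≡ cayley c (∑ V s) (length V)
  forest-cayley k       c []      _   = refl
  forest-cayley (suc k) c (x ∷ V) V≤k = trans (Spl-congⁱ (x ∷ V) (λ S R i → cong₂ _*_ (∏-const c S) (rest S R i))) (layers c x V)
    where
    rest : ∀ S R → Interleaving S R (x ∷ V) → hang tree S R ≡ cayley (∑ S s) (∑ R s) (length R)
    rest []      []      i = refl
    rest []      (r ∷ R) i = refl
    rest (q ∷ Q) R       i = trans (hang-parent (q ∷ Q) R) (forest-cayley k _ R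
      (s≤s⁻¹ (≤-trans (s≤s (m≤n+m _ (length Q))) (≤-trans (≤-reflexive (length-split i)) V≤k))))

  forest-const : ∀ c V → forest (λ _ → c) V ≡ cayley c (∑ V s) (length V)
  forest-const c V = forest-cayley (length V) c V ≤-refl

  -- With total weight M and n ≥ 2 vertices, the trees with root `y` contribute s(y) M^(n-2), since
  -- below `y` there is a forest with root weight `s y`; summing over `y` gives another factor M.
  Pick-tree : ∀ x V → Pick (x ∷ V) tree ≡ ∑ (x ∷ V) s ^ length V
  Pick-tree x V = trans (Pick-cong↭ (x ∷ V) (λ y V′ p → trans (tree≡forest y V′) (trans (forest-const (s y) V′)
    (cong₂ (cayley (s y)) refl (suc-injective (↭-length p)))))) (sumUp V)
    where
    sumUp : ∀ V → Pick (x ∷ V) (λ y V′ → cayley (s y) (∑ V′ s) (length V)) ≡ ∑ (x ∷ V) s ^ length V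
    sumUp []      = refl
    sumUp (z ∷ V) = begin
      Pick (x ∷ z ∷ V) (λ y V′ → s y * (s y + ∑ V′ s) ^ length V)
        ≡⟨ Pick-cong↭ (x ∷ z ∷ V) (λ y V′ p → cong (λ t → s y * t ^ length V) (∑-↭ s p)) ⟩
      Pick (x ∷ z ∷ V) (λ y V′ → s y * ∑ (x ∷ z ∷ V) s ^ length V)
        ≡⟨ Pick-*ʳ (∑ (x ∷ z ∷ V) s ^ length V) (x ∷ z ∷ V) (λ y _ → s y) ⟩
      Pick (x ∷ z ∷ V) (λ y V′ → s y) * ∑ (x ∷ z ∷ V) s ^ length V
        ≡⟨ cong (_* ∑ (x ∷ z ∷ V) s ^ length V) (Pick-∑ (x ∷ z ∷ V) s) ⟩
      ∑ (x ∷ z ∷ V) s ^ length (z ∷ V) ∎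

-- Finite sums and adjacent tiers

∑< : ℕ → (ℕ → ℕ) → ℕ
∑< zero    f = 0
∑< (suc m) f = f 0 + ∑< m (λ c → f (suc c))

∑<-cong : ∀ m {f g : ℕ → ℕ} → (∀ c → c < m → f c ≡ g c) → ∑< m f ≡ ∑< m g
∑<-cong zero    h = refl
∑<-cong (suc m) h = cong₂ _+_ (h 0 (s≤s z≤n)) (∑<-cong m (λ c c<m → h (suc c) (s≤s c<m)))

∑<-+ : ∀ m (f g : ℕ → ℕ) → ∑< m (λ c → f c + g c) ≡ ∑< m f + ∑< m g
∑<-+ zero    f g = refl
∑<-+ (suc m) f g = trans (cong (f 0 + g 0 +_) (∑<-+ m _ _)) (+-interchange (f 0) _ _ _)

∑<-* : ∀ m k (f : ℕ → ℕ) → ∑< m (λ c → k * f c) ≡ k * ∑< m f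
∑<-* zero    k f = sym (*-zeroʳ k)
∑<-* (suc m) k f = trans (cong (k * f 0 +_) (∑<-* m k _)) (sym (*-distribˡ-+ k _ _))

∑<-const : ∀ m k → ∑< m (λ _ → k) ≡ m * k
∑<-const zero    k = refl
∑<-const (suc m) k = cong (k +_) (∑<-const m k)

∑<-swap : ∀ m n (f : ℕ → ℕ → ℕ) → ∑< m (λ c → ∑< n (f c)) ≡ ∑< n (λ d → ∑< m (λ c → f c d))
∑<-swap zero    n f = sym (trans (∑<-const n 0) (*-zeroʳ n))
∑<-swap (suc m) n f = trans (cong (∑< n (f 0) +_) (∑<-swap m n _)) (sym (∑<-+ n _ _))

lt : ℕ → ℕ → ℕ
lt _       zero    = 0
lt zero    (suc _) = 1
lt (suc a) (suc b) = lt a b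

<⇒lt≡1 : ∀ {a b} → a < b → lt a b ≡ 1
<⇒lt≡1 {zero}  (s≤s _)   = refl
<⇒lt≡1 {suc a} (s≤s a<b) = <⇒lt≡1 a<b

≤⇒lt≡0 : ∀ {a b} → b ≤ a → lt a b ≡ 0
≤⇒lt≡0 {a}     z≤n       = refl
≤⇒lt≡0 {suc a} (s≤s b≤a) = ≤⇒lt≡0 b≤a

∑<-lt : ∀ m c → ∑< m (lt c) ≡ m ∸ suc c
∑<-lt zero    c       = refl
∑<-lt (suc m) zero    = trans (∑<-const m 1) (*-identityʳ m)
∑<-lt (suc m) (suc c) = ∑<-lt m c

δ : ℕ → ℕ → ℕ
δ zero    zero    = 1
δ zero    (suc _) = 0
δ (suc _) zero    = 0
δ (suc i) (suc c) = δ i c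

∑<-δ : ∀ m (a : ℕ → ℕ) c → c < m → ∑< m (λ j → a j * δ j c) ≡ a c
∑<-δ (suc m) a zero    _ = trans (cong₂ _+_ (*-identityʳ (a 0))
  (trans (∑<-cong m (λ j _ → *-zeroʳ (a (suc j)))) (trans (∑<-const m 0) (*-zeroʳ m)))) (+-identityʳ _)
∑<-δ (suc m) a (suc c) (s≤s c<m) = cong₂ _+_ (*-zeroʳ (a 0)) (∑<-δ m (λ j → a (suc j)) c c<m)

-- adj i is the indicator of {i , i + 1}, coadj i that of the complement, swp i the transposition (i , i + 1).
adj coadj swp : ℕ → ℕ → ℕ
adj zero    zero          = 1
adj zero    (suc zero)    = 1
adj zero    (suc (suc _)) = 0
adj (suc i) zero          = 0
adj (suc i) (suc c)       = adj i c
coadj zero    zero          = 0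
coadj zero    (suc zero)    = 0
coadj zero    (suc (suc _)) = 1
coadj (suc i) zero          = 1
coadj (suc i) (suc c)       = coadj i c
swp zero    zero            = 1
swp zero    (suc zero)      = 0
swp zero    c@(suc (suc _)) = c
swp (suc i) zero            = 0
swp (suc i) (suc c)         = suc (swp i c)

adj+coadj : ∀ i c → adj i c + coadj i c ≡ 1
adj+coadj zero    zero          = refl
adj+coadj zero    (suc zero)    = refl
adj+coadj zero    (suc (suc c)) = refl
adj+coadj (suc i) zero          = refl
adj+coadj (suc i) (suc c)       = adj+coadj i c

adj∈01 : ∀ i c → adj i c ≡ 0 ⊎ adj i c ≡ 1
adj∈01 zero    zero          = inj₂ refl
adj∈01 zero    (suc zero)    = inj₂ refl
adj∈01 zero    (suc (suc c)) = inj₁ refl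
adj∈01 (suc i) zero          = inj₁ refl
adj∈01 (suc i) (suc c)       = adj∈01 i c

δ-adj : ∀ i c → δ i c * adj i c ≡ δ i c
δ-adj zero    zero    = refl
δ-adj zero    (suc c) = refl
δ-adj (suc i) zero    = refl
δ-adj (suc i) (suc c) = δ-adj i c

δ-suc-adj : ∀ i c → δ (suc i) c * adj i c ≡ δ (suc i) c
δ-suc-adj i       zero          = refl
δ-suc-adj zero    (suc zero)    = refl
δ-suc-adj zero    (suc (suc c)) = refl
δ-suc-adj (suc i) (suc c)       = δ-suc-adj i c

δ-swp : ∀ i c → δ (suc i) (swp i c) ≡ δ i c
δ-swp zero    zero          = refl
δ-swp zero    (suc zero)    = refl
δ-swp zero    (suc (suc c)) = refl
δ-swp (suc i) zero          = refl
δ-swp (suc i) (suc c)       = δ-swp i c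

adj-swp : ∀ i c → adj i (swp i c) ≡ adj i c
adj-swp zero    zero          = refl
adj-swp zero    (suc zero)    = refl
adj-swp zero    (suc (suc c)) = refl
adj-swp (suc i) zero          = refl
adj-swp (suc i) (suc c)       = adj-swp i c

∑<-swp : ∀ m i (f : ℕ → ℕ) → suc i < m → ∑< m (λ c → f (swp i c)) ≡ ∑< m f
∑<-swp (suc (suc m)) zero    f _         = +-left-comm (f 1) (f 0) _
∑<-swp (suc m)       (suc i) f (s≤s i<m) = cong (f 0 +_) (∑<-swp m i (λ c → f (suc c)) i<m)

-- Inside the pair the transposition reverses the order of tiers, to be compensated by a reversal of
-- labels.
lt-swp : ∀ i c d → adj i c ≡ 1 → adj i d ≡ 1 → lt (swp i c) (swp i d) ≡ lt d c
lt-swp zero    zero       zero       _ _ = refl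
lt-swp zero    zero       (suc zero) _ _ = refl
lt-swp zero    (suc zero) zero       _ _ = refl
lt-swp zero    (suc zero) (suc zero) _ _ = refl
lt-swp (suc i) (suc c)    (suc d)    p q = lt-swp i c d p q

-- No tier lies strictly between i and i + 1, so a tier outside the pair cannot tell the two apart.
-- This is why only neighbouring tiers are exchanged.
coadj-ltˡ : ∀ i c d → adj i c ≡ 1 → coadj i d * lt c d ≡ coadj i d * lt i d
coadj-ltˡ zero    zero       d             _ = refl
coadj-ltˡ zero    (suc zero) zero          _ = refl
coadj-ltˡ zero    (suc zero) (suc zero)    _ = refl
coadj-ltˡ zero    (suc zero) (suc (suc d)) _ = refl
coadj-ltˡ (suc i) (suc c)    zero          _ = refl
coadj-ltˡ (suc i) (suc c)    (suc d)       p = coadj-ltˡ i c d p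

coadj-ltʳ : ∀ i c d → adj i c ≡ 1 → coadj i d * lt d c ≡ coadj i d * lt d i
coadj-ltʳ zero    zero       d             _ = refl
coadj-ltʳ zero    (suc zero) zero          _ = refl
coadj-ltʳ zero    (suc zero) (suc zero)    _ = refl
coadj-ltʳ zero    (suc zero) (suc (suc d)) _ = refl
coadj-ltʳ (suc i) (suc c)    zero          _ = refl
coadj-ltʳ (suc i) (suc c)    (suc d)       p = coadj-ltʳ i c d p

-- Ordered lists, their reversals, and products of indicators

AllPairs-split : ∀ {R : A → A → Set} {V B C} → Interleaving B C V → AllPairs R V → AllPairs R B × AllPairs R C
AllPairs-split []ⁱ       []       = [] , []
AllPairs-split (consˡ i) (r ∷ rs) = let b , c = AllPairs-split i rs in (proj₁ (All-split i r) ∷ b) , c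
AllPairs-split (consʳ i) (r ∷ rs) = let b , c = AllPairs-split i rs in b , (proj₂ (All-split i r) ∷ c)

AllPairs-reverse : ∀ {R : A → A → Set} {V} → AllPairs R V → ∃ λ W → W ↭ V × AllPairs (λ x y → R y x) W
AllPairs-reverse [] = [] , ↭-refl , []
AllPairs-reverse {V = x ∷ V} (r ∷ rs) = let W , p , s = AllPairs-reverse rs in
  W ++ x ∷ [] , ↭-trans (↭-sym (↭.∷↭∷ʳ x W)) (prep x p) ,
  AllPairs.++⁺ s ([] ∷ []) (All.map (λ r → r ∷ []) (↭.All-resp-↭ (↭-sym p) r))

-- Applied to an increasing list and its reversal, it pairs each label with its mirror image, the
-- orders of the two components being opposite.
AllPairs-zip : ∀ {R : A → A → Set} {S : B → B → Set} {V W} → length V ≡ length W → AllPairs R V → AllPairs S W →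
  ∃ λ L → map proj₁ L ≡ V × map proj₂ L ≡ W × AllPairs (λ x y → R (proj₁ x) (proj₁ y) × S (proj₂ x) (proj₂ y)) L
AllPairs-zip {W = []} _ [] [] = [] , refl , refl , []
AllPairs-zip {V = x ∷ V} {y ∷ W} e (r ∷ rs) (s ∷ ss) with AllPairs-zip (suc-injective e) rs ss
... | L , refl , refl , ps = (x , y) ∷ L , refl , refl , All.zip (All.map⁻ r , All.map⁻ s) ∷ ps

AllPairs-lookup : ∀ {R : A → A → Set} {V x y} → AllPairs R V → x ∈ V → y ∈ V → x ≡ y ⊎ R x y ⊎ R y x
AllPairs-lookup (r ∷ rs) (here refl) (here refl) = inj₁ refl
AllPairs-lookup (r ∷ rs) (here refl) (there y∈)  = inj₂ (inj₁ (All.lookup r y∈))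
AllPairs-lookup (r ∷ rs) (there x∈)  (here refl) = inj₂ (inj₂ (All.lookup r x∈))
AllPairs-lookup (r ∷ rs) (there x∈)  (there y∈)  = AllPairs-lookup rs x∈ y∈

Pick-const : ∀ (V : List A) k → Pick V (λ _ _ → k) ≡ length V * k
Pick-const []      k = refl
Pick-const (x ∷ V) k = cong (k +_) (Pick-const V k)

-- A product of indicators serves as a case distinction under a sum: it annihilates the summand, or
-- its condition holds throughout the list.
∏∈01 : ∀ (V : List A) (f : A → ℕ) → (∀ x → f x ≡ 0 ⊎ f x ≡ 1) → ∏ V f ≡ 0 ⊎ All (λ x → f x ≡ 1) V
∏∈01 []      f h = inj₂ []
∏∈01 (x ∷ V) f h with h x | ∏∈01 V f h
... | inj₁ fx≡0 | _          = inj₁ (cong (_* ∏ V f) fx≡0)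
... | inj₂ _    | inj₁ ∏≡0   = inj₁ (trans (cong (f x *_) ∏≡0) (*-zeroʳ (f x)))
... | inj₂ fx≡1 | inj₂ all≡1 = inj₂ (fx≡1 ∷ all≡1)

-- Tiered forests

module Colouring (m : ℕ) (A : Set) = Labelling {A} {ℕ} (λ _ → ∑< m) (_< m)
  (λ _ → ∑<-cong m) (λ _ → ∑<-+ m) (λ _ → ∑<-* m) (λ _ _ → ∑<-swap m m)

Vertex : Set
Vertex = ℕ × ℕ

tier : Vertex → ℕ
tier = proj₂

-- The indicator that an edge is admissible, with labels and tiers strictly ordered in the same way.
-- At most one summand is nonzero.
w : Vertex → Vertex → ℕ
w (l , c) (k , d) = lt l k * lt c d + lt k l * lt d c

w-sym : ∀ u v → w u v ≡ w v u
w-sym (l , c) (k , d) = +-comm (lt l k * lt c d) _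

w-< : ∀ {l k} c d → l < k → w (l , c) (k , d) ≡ lt c d
w-< {l} {k} c d l<k = trans (cong₂ (λ a b → a * lt c d + b * lt d c) (<⇒lt≡1 l<k) (≤⇒lt≡0 (<⇒≤ l<k)))
  (trans (+-identityʳ _) (*-identityˡ _))

w-> : ∀ {l k} c d → k < l → w (l , c) (k , d) ≡ lt d c
w-> {l} {k} c d k<l = trans (w-sym (l , c) (k , d)) (w-< d c k<l)

w-≡ : ∀ l c d → w (l , c) (l , d) ≡ 0
w-≡ l c d = cong₂ (λ a b → a * lt c d + b * lt d c) (≤⇒lt≡0 {l} ≤-refl) (≤⇒lt≡0 {l} ≤-refl)

forest-congᴾ : ∀ {X : Set} (w : X → X → ℕ) {P : X → Set} {a b : X → ℕ} V → All P V →
  (∀ v → P v → a v ≡ b v) → Forest.forest w a V ≡ Forest.forest w b V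
forest-congᴾ w {P} {a} {b} V pV h = Spl-congⁱ V (λ S R i → cong (_* _) (go S (proj₁ (All-split i pV))))
  where
  go : ∀ S → All P S → ∏ S a ≡ ∏ S b
  go []      []        = refl
  go (s ∷ S) (ps ∷ pS) = cong₂ _*_ (h s ps) (go S pS)

module Tiers (m : ℕ) where
  open Colouring m ℕ public
  open Forest w
  open Root w w-sym using (anyRoot)

  -- The number of tiers above `c`, that is `∑< m (lt c)`: the tiers open to a larger neighbour of a
  -- vertex of tier `c`.
  s : Vertex → ℕ
  s (_ , c) = m ∸ suc c

  open Cayley s using (cayley; forest-const; Pick-tree)
  private module C = Forest (λ q (_ : Vertex) → s q)

  Forests : (ℕ → ℕ) → List ℕ → ℕ
  Forests a V = Lab V (λ K → forest (λ v → a (tier v)) K)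

  Rooted-at : ℕ → List ℕ → ℕ
  Rooted-at j V = Lab V (λ K → Pick K (λ x K′ → δ j (tier x) * tree x K′))

  -- In the comparison model a colour `c` stands for the vertex weight `m ∸ suc c`, so colourings
  -- run through the weight functions with values below `m`.
  CForests : ℕ → List ℕ → ℕ
  CForests c V = Lab V (λ K → C.forest (λ _ → c) K)

  CRooted : List ℕ → ℕ
  CRooted V = Lab V (λ K → Pick K C.tree)

  Lab-component : ∀ (G : Vertex → List Vertex → ℕ) (H : List Vertex → ℕ) l V →
    ∑< m (λ c → Lab V (λ K → Spl K (λ B D → Pick ((l , c) ∷ B) G * H D))) ≡
    Spl V (λ B D → Lab (l ∷ B) (λ K → Pick K G) * Lab D H)
  Lab-component G H l V = begin
    ∑< m (λ c → Lab V (λ K → Spl K (λ B D → Pick ((l , c) ∷ B) G * H D)))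
      ≡⟨ ∫-cong l (λ c → Lab-Spl V _) ⟩
    ∑< m (λ c → Spl V (λ B D → Lab B (λ K → Lab D (λ L → Pick ((l , c) ∷ K) G * H L))))
      ≡⟨ ∫-Spl l V _ ⟩
    Spl V (λ B D → Lab (l ∷ B) (λ K → Lab D (λ L → Pick K G * H L)))
      ≡⟨ Spl-cong V (λ B D → Lab-*-Lab (l ∷ B) D (λ K → Pick K G) H) ⟨
    Spl V (λ B D → Lab (l ∷ B) (λ K → Pick K G) * Lab D H) ∎

  -- Trees are sorted by the tier of their root. `Lab` assigns only colours below `m`, as `∑<-δ`
  -- requires.
  Lab-Pick-tier : ∀ a V → Lab V (λ K → Pick K (λ y K′ → a (tier y) * tree y K′)) ≡ ∑< m (λ j → a j * Rooted-at j V)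
  Lab-Pick-tier a V = begin
    Lab V (λ K → Pick K (λ y K′ → a (tier y) * tree y K′))
      ≡⟨ Lab-congᴼ V (λ K _ oks → Pick-cong↭ K (λ y K′ p →
           cong (_* tree y K′) (sym (∑<-δ m a (tier y) (All.head (↭.All-resp-↭ (↭-sym p) oks)))))) ⟩
    Lab V (λ K → Pick K (λ y K′ → ∑< m (λ j → a j * δ j (tier y)) * tree y K′))
      ≡⟨ Lab-cong V (λ K → trans (Pick-cong K (λ y K′ → begin
           ∑< m (λ j → a j * δ j (tier y)) * tree y K′    ≡⟨ *-comm _ (tree y K′) ⟩
           tree y K′ * ∑< m (λ j → a j * δ j (tier y))    ≡⟨ ∑<-* m (tree y K′) _ ⟨
           ∑< m (λ j → tree y K′ * (a j * δ j (tier y)))  ≡⟨ ∑<-cong m (λ j _ → rearrange (tree y K′) (a j) _) ⟩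
           ∑< m (λ j → a j * (δ j (tier y) * tree y K′))  ∎)) (sym (∫-Pick 0 K _))) ⟩
    Lab V (λ K → ∑< m (λ j → Pick K (λ y K′ → a j * (δ j (tier y) * tree y K′))))
      ≡⟨ ∫-Lab 0 V _ ⟨
    ∑< m (λ j → Lab V (λ K → Pick K (λ y K′ → a j * (δ j (tier y) * tree y K′))))
      ≡⟨ ∑<-cong m (λ j _ → trans (Lab-cong V (λ K → Pick-* (a j) K _)) (Lab-* (a j) V _)) ⟩
    ∑< m (λ j → a j * Rooted-at j V) ∎
    where
    rearrange : ∀ t a d → t * (a * d) ≡ a * (d * t)
    rearrange = solve-∀

  Forests-∷ : ∀ a l V → Forests a (l ∷ V) ≡ Spl V (λ B D → ∑< m (λ j → a j * Rooted-at j (l ∷ B)) * Forests a D)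
  Forests-∷ a l V = begin
    Forests a (l ∷ V)
      ≡⟨ ∫-cong l (λ c → Lab-cong V (λ K → forest-component _ (l , c) K)) ⟩
    ∑< m (λ c → Lab V (λ K → Spl K (λ B D → Pick ((l , c) ∷ B) (λ y B′ → a (tier y) * tree y B′) * forest _ D)))
      ≡⟨ Lab-component (λ y B′ → a (tier y) * tree y B′) _ l V ⟩
    Spl V (λ B D → Lab (l ∷ B) (λ K → Pick K (λ y B′ → a (tier y) * tree y B′)) * Forests a D)
      ≡⟨ Spl-cong V (λ B D → cong (_* Forests a D) (Lab-Pick-tier a (l ∷ B))) ⟩
    Spl V (λ B D → ∑< m (λ j → a j * Rooted-at j (l ∷ B)) * Forests a D) ∎

  CForests-∷ : ∀ c l V → CForests c (l ∷ V) ≡ Spl V (λ B D → c * CRooted (l ∷ B) * CForests c D)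
  CForests-∷ c l V = begin
    CForests c (l ∷ V)
      ≡⟨ ∫-cong l (λ d → Lab-cong V (λ K → C.forest-component _ (l , d) K)) ⟩
    ∑< m (λ d → Lab V (λ K → Spl K (λ B D → Pick ((l , d) ∷ B) (λ y B′ → c * C.tree y B′) * C.forest (λ _ → c) D)))
      ≡⟨ Lab-component (λ y B′ → c * C.tree y B′) _ l V ⟩
    Spl V (λ B D → Lab (l ∷ B) (λ K → Pick K (λ y B′ → c * C.tree y B′)) * CForests c D)
      ≡⟨ Spl-cong V (λ B D → cong (_* CForests c D)
           (trans (Lab-cong (l ∷ B) (λ K → Pick-* c K C.tree)) (Lab-* c (l ∷ B) (λ K → Pick K C.tree)))) ⟩
    Spl V (λ B D → c * CRooted (l ∷ B) * CForests c D) ∎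

  module Adjacent (i : ℕ) where
    χ χ′ : Vertex → ℕ
    χ  v = adj i (tier v)
    χ′ v = coadj i (tier v)

    open Blob w χ χ′ (λ v → adj+coadj i (tier v))

    -- This is `boundary` with all tiers of the inner vertices replaced by `i`. It depends on labels
    -- only, which decouples the outer part of a tree from the colouring of its core.
    outside : List ℕ → Vertex → ℕ
    outside B v = χ′ v * ∑ B (λ l → w (l , i) v)

    boundary≡outside : ∀ K → All (λ v → χ v ≡ 1) K → ∀ v → boundary K v ≡ outside (map proj₁ K) v
    boundary≡outside K χK v@(k , d) = trans (sym (∑-* (χ′ v) K _)) (trans (go K χK) (∑-* (χ′ v) (map proj₁ K) _))
      where
      one : ∀ l c → adj i c ≡ 1 → χ′ v * w (l , c) v ≡ χ′ v * w (l , i) v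
      one l c p = begin
        coadj i d * (lt l k * lt c d + lt k l * lt d c)
          ≡⟨ distrib (coadj i d) (lt l k) (lt c d) (lt k l) (lt d c) ⟩
        lt l k * (coadj i d * lt c d) + lt k l * (coadj i d * lt d c)
          ≡⟨ cong₂ (λ a b → lt l k * a + lt k l * b) (coadj-ltˡ i c d p) (coadj-ltʳ i c d p) ⟩
        lt l k * (coadj i d * lt i d) + lt k l * (coadj i d * lt d i)
          ≡⟨ distrib (coadj i d) (lt l k) (lt i d) (lt k l) (lt d i) ⟨
        coadj i d * (lt l k * lt i d + lt k l * lt d i) ∎
        where
        distrib : ∀ x a b e f → x * (a * b + e * f) ≡ a * (x * b) + e * (x * f)
        distrib = solve-∀
      go : ∀ K → All (λ v → χ v ≡ 1) K → ∑ K (λ s → χ′ v * w s v) ≡ ∑ (map proj₁ K) (λ l → χ′ v * w (l , i) v)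
      go []            []       = refl
      go ((l , c) ∷ K) (p ∷ ps) = cong₂ _+_ (one l c p) (go K ps)

    Core : ℕ → List ℕ → ℕ
    Core j B = Lab B (λ K → ∏ K χ * Pick K (λ x K′ → δ j (tier x) * tree x K′))

    -- The second factor does not involve `j`, so neighbouring tiers differ in their cores only. The
    -- hypothesis places the root in the region, so that it can be included in the product of `χ`.
    Rooted-at-cut : ∀ j → (∀ c → δ j c * adj i c ≡ δ j c) → ∀ V →
      Rooted-at j V ≡ Spl V (λ B D → Core j B * Lab D (forest (outside B)))
    Rooted-at-cut j δχ V = begin
      Rooted-at j V
        ≡⟨ Lab-cong V cut ⟩
      Lab V (λ K → Spl K (λ B D → ∏ B χ * root B * forest (boundary B) D))
        ≡⟨ Lab-Spl V _ ⟩
      Spl V (λ B D → Lab B (λ K → Lab D (λ L → ∏ K χ * root K * forest (boundary K) L)))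
        ≡⟨ Spl-cong V (λ B D → trans (Lab-congᴼ B (λ K e _ → Lab-cong D (λ L → replace B K e L))) (sym (Lab-*-Lab B D _ _))) ⟩
      Spl V (λ B D → Core j B * Lab D (forest (outside B))) ∎
      where
      root : List Vertex → ℕ
      root K = Pick K (λ x K′ → δ j (tier x) * tree x K′)
      rearrange : ∀ d p t f → d * (p * t * f) ≡ d * t * (p * f)
      rearrange = solve-∀
      rearrange′ : ∀ d x p t f → (d * x) * t * (p * f) ≡ (x * p) * f * (d * t)
      rearrange′ = solve-∀
      rearrange″ : ∀ p f r → p * f * r ≡ p * r * f
      rearrange″ = solve-∀
      cut : ∀ K → root K ≡ Spl K (λ B D → ∏ B χ * root B * forest (boundary B) D)
      cut K = begin
        Pick K (λ x K′ → δ j (tier x) * tree x K′)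
          ≡⟨ Pick-cong K (λ x K′ → trans (cong (δ j (tier x) *_) (tree-cut (length K′) x K′ ≤-refl)) (trans (sym (Spl-* (δ j (tier x)) K′ _))
               (Spl-cong K′ (λ B D → begin
                  δ j (tier x) * (∏ B χ * tree x B * forest (boundary (x ∷ B)) D)
                    ≡⟨ rearrange (δ j (tier x)) (∏ B χ) _ _ ⟩
                  δ j (tier x) * tree x B * (∏ B χ * forest (boundary (x ∷ B)) D)
                    ≡⟨ cong (λ z → z * tree x B * (∏ B χ * forest (boundary (x ∷ B)) D)) (sym (δχ (tier x))) ⟩
                  δ j (tier x) * χ x * tree x B * (∏ B χ * forest (boundary (x ∷ B)) D)
                    ≡⟨ rearrange′ (δ j (tier x)) (χ x) (∏ B χ) (tree x B) _ ⟩
                  ∏ (x ∷ B) χ * forest (boundary (x ∷ B)) D * (δ j (tier x) * tree x B) ∎)))) ⟩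
        Pick K (λ x K′ → Spl K′ (λ B D → ∏ (x ∷ B) χ * forest (boundary (x ∷ B)) D * (δ j (tier x) * tree x B)))
          ≡⟨ Spl-Pick K _ ⟨
        Spl K (λ B D → Pick B (λ x B′ → ∏ (x ∷ B′) χ * forest (boundary (x ∷ B′)) D * (δ j (tier x) * tree x B′)))
          ≡⟨ Spl-cong K (λ B D → trans
               (Pick-cong↭ B (λ x B′ p → cong₂ (λ z f → z * f * (δ j (tier x) * tree x B′)) (∏-↭ χ p) (forest-boundary-↭ p D)))
               (trans (Pick-* (∏ B χ * forest (boundary B) D) B _) (rearrange″ (∏ B χ) (forest (boundary B) D) (root B)))) ⟩
        Spl K (λ B D → ∏ B χ * root B * forest (boundary B) D) ∎
      -- If `K` leaves the two tiers both sides are 0; otherwise `boundary` and `outside` agree.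
      replace : ∀ B K → map proj₁ K ≡ B → ∀ L → ∏ K χ * root K * forest (boundary K) L ≡ ∏ K χ * root K * forest (outside B) L
      replace B K refl L with ∏∈01 K χ (λ v → adj∈01 i (tier v))
      ... | inj₁ ∏≡0 = trans (cong (λ z → z * root K * forest (boundary K) L) ∏≡0) (cong (λ z → z * root K * forest (outside B) L) (sym ∏≡0))
      ... | inj₂ χK  = cong (∏ K χ * root K *_) (forest-cong L (boundary≡outside K χK))

    private module P = Colouring m (ℕ × ℕ)

    -- Two readings of one colouring of pairs: the label with its colour, and the mirrored label
    -- with the exchanged colour.
    fst snd : (ℕ × ℕ) × ℕ → Vertex
    fst ((l , _) , c) = l , c
    snd ((_ , l) , c) = l , swp i c

    Lab-fst : ∀ L f → Lab (map proj₁ L) f ≡ P.Lab L (λ K → f (map fst K))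
    Lab-fst []            f = refl
    Lab-fst ((l , k) ∷ L) f = ∫-cong l (λ c → Lab-fst L (λ K → f ((l , c) ∷ K)))

    Lab-snd : suc i < m → ∀ L f → Lab (map proj₂ L) f ≡ P.Lab L (λ K → f (map snd K))
    Lab-snd i<m []            f = refl
    Lab-snd i<m ((l , k) ∷ L) f = trans (sym (∑<-swp m i (λ c → Lab (map proj₂ L) (λ K → f ((k , c) ∷ K))) i<m))
      (∫-cong l (λ c → Lab-snd i<m L (λ K → f ((k , swp i c) ∷ K))))

    -- Reversing the labels and exchanging the two tiers preserves adjacency inside two adjacent tiers.
    Core-sym : suc i < m → ∀ {V} → AllPairs _<_ V → Core i V ≡ Core (suc i) V
    Core-sym i<m {V} sorted with AllPairs-reverse sorted
    ... | W , W↭V , rev with AllPairs-zip (sym (↭-length W↭V)) sorted rev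
    ... | L , refl , refl , opposite = begin
      Core i (map proj₁ L)
        ≡⟨ Lab-fst L _ ⟩
      P.Lab L (λ K → ∏ (map fst K) χ * root i (map fst K))
        ≡⟨ P.Lab-congᴼ L (λ K e _ → compare K e) ⟩
      P.Lab L (λ K → ∏ (map snd K) χ * root (suc i) (map snd K))
        ≡⟨ Lab-snd i<m L _ ⟨
      Core (suc i) (map proj₂ L)
        -- The mirrored labels are the original ones in another order.
        ≡⟨ Lab-↭ (λ p → cong₂ _*_ (∏-↭ χ p) (Pick-↭ (λ y q → cong (δ (suc i) (tier y) *_) (tree-↭ y q)) p)) W↭V ⟩
      Core (suc i) (map proj₁ L) ∎
      where
      root : ℕ → List Vertex → ℕ
      root j K = Pick K (λ x K′ → δ j (tier x) * tree x K′)
      ∏-fst-snd : ∀ K → ∏ (map fst K) χ ≡ ∏ (map snd K) χ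
      ∏-fst-snd []      = refl
      ∏-fst-snd (v ∷ K) = cong₂ _*_ (sym (adj-swp i (proj₂ v))) (∏-fst-snd K)
      compare : ∀ K → map proj₁ K ≡ L → ∏ (map fst K) χ * root i (map fst K) ≡ ∏ (map snd K) χ * root (suc i) (map snd K)
      compare K refl with ∏∈01 (map fst K) χ (λ v → adj∈01 i (tier v))
      ... | inj₁ ∏≡0 = trans (cong (_* root i (map fst K)) ∏≡0) (cong (_* root (suc i) (map snd K)) (trans (sym ∏≡0) (∏-fst-snd K)))
      ... | inj₂ χK  = cong₂ _*_ (∏-fst-snd K) (begin
        root i (map fst K)
          ≡⟨ Pick-map fst K _ ⟩
        Pick K (λ y K′ → δ i (proj₂ y) * tree (fst y) (map fst K′))
          ≡⟨ Pick-cong↭ K (λ y K′ p → cong₂ _*_ (sym (δ-swp i (proj₂ y))) (trans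
               (sym (tree-map w₁ w fst (λ _ → ⊤) (λ _ _ → refl) y K′ tt (All.universal (λ _ → tt) K′)))
               (tree-map w₁ w snd (_∈ K) same y K′ (↭.∈-resp-↭ p (here refl))
                 (All.tabulate (λ v∈ → ↭.∈-resp-↭ p (there v∈)))))) ⟩
        Pick K (λ y K′ → δ (suc i) (swp i (proj₂ y)) * tree (snd y) (map snd K′))
          ≡⟨ Pick-map snd K _ ⟨
        root (suc i) (map snd K) ∎)
        where
        w₁ : (ℕ × ℕ) × ℕ → (ℕ × ℕ) × ℕ → ℕ
        w₁ u v = w (fst u) (fst v)
        same : ∀ {u v} → u ∈ K → v ∈ K → w₁ u v ≡ w (snd u) (snd v)
        same {(l , l′) , c} {(k , k′) , d} u∈ v∈ with AllPairs-lookup (AllPairs.map⁻ opposite) u∈ v∈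
        ... | inj₁ refl = trans (w-≡ l c c) (sym (w-≡ l′ (swp i c) (swp i c)))
        ... | inj₂ (inj₁ (l<k , k′<l′)) = trans (w-< c d l<k)
          (sym (trans (w-> (swp i c) (swp i d) k′<l′) (lt-swp i d c (All.lookup (All.map⁻ χK) v∈) (All.lookup (All.map⁻ χK) u∈))))
        ... | inj₂ (inj₂ (k<l , l′<k′)) = trans (w-> c d k<l)
          (sym (trans (w-< (swp i c) (swp i d) l′<k′) (lt-swp i c d (All.lookup (All.map⁻ χK) u∈) (All.lookup (All.map⁻ χK) v∈))))

    Rooted-at-suc : suc i < m → ∀ {V} → AllPairs _<_ V → Rooted-at i V ≡ Rooted-at (suc i) V
    Rooted-at-suc i<m {V} sorted = begin
      Rooted-at i V                                           ≡⟨ Rooted-at-cut i (δ-adj i) V ⟩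
      Spl V (λ B D → Core i B * Lab D (forest (outside B)))
        ≡⟨ Spl-congⁱ V (λ B D sp → cong (_* Lab D (forest (outside B))) (Core-sym i<m (proj₁ (AllPairs-split sp sorted)))) ⟩
      Spl V (λ B D → Core (suc i) B * Lab D (forest (outside B)))  ≡⟨ Rooted-at-cut (suc i) (δ-suc-adj i) V ⟨
      Rooted-at (suc i) V                                     ∎

  Rooted-at-0 : ∀ j → j < m → ∀ {V} → AllPairs _<_ V → Rooted-at j V ≡ Rooted-at 0 V
  Rooted-at-0 zero    _   sorted = refl
  Rooted-at-0 (suc j) j<m sorted = trans (sym (Adjacent.Rooted-at-suc j j<m sorted)) (Rooted-at-0 j (<⇒≤ j<m) sorted)

-- Comparison with parent-weighted trees

module Counting (m : ℕ) where
  open Tiers m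
  open Forest w
  open Root w w-sym using (anyRoot)
  open Cayley s using (cayley; forest-const; Pick-tree)
  private module C = Forest (λ q (_ : Vertex) → s q)

  Trees : ℕ → List ℕ → ℕ
  Trees l V = ∑< m (λ c → Lab V (λ K → tree (l , c) K))

  Trees-Forests : ∀ l V → All (l <_) V → Trees l V ≡ ∑< m (λ c → Forests (lt c) V)
  Trees-Forests l V l<V = ∑<-cong m (λ c _ → Lab-congᴼ V (λ { K refl _ →
    trans (tree≡forest (l , c) K) (forest-congᴾ w K (All.map⁻ l<V) (λ { (k , d) l<k → w-< c d l<k })) }))

  -- Summing over tiers drops the condition on the root, and all choices of the root give the same
  -- weight as the root `l`.
  ∑-Rooted-at : ∀ l V → ∑< m (λ j → Rooted-at j (l ∷ V)) ≡ suc (length V) * Trees l V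
  ∑-Rooted-at l V = begin
    ∑< m (λ j → Rooted-at j (l ∷ V))
      ≡⟨ ∑<-cong m (λ j _ → sym (*-identityˡ _)) ⟩
    ∑< m (λ j → 1 * Rooted-at j (l ∷ V))
      ≡⟨ Lab-Pick-tier (λ _ → 1) (l ∷ V) ⟨
    Lab (l ∷ V) (λ K → Pick K (λ y K′ → 1 * tree y K′))
      ≡⟨ ∫-cong l (λ c → Lab-congᴼ V (λ { K refl _ → begin
           Pick ((l , c) ∷ K) (λ y K′ → 1 * tree y K′)   ≡⟨ Pick-cong↭ ((l , c) ∷ K) (λ y K′ p → trans (*-identityˡ _) (anyRoot p)) ⟩
           Pick ((l , c) ∷ K) (λ _ _ → tree (l , c) K)   ≡⟨ Pick-const ((l , c) ∷ K) _ ⟩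
           suc (length K) * tree (l , c) K               ≡⟨ cong (λ n → suc n * tree (l , c) K) (length-map proj₁ K) ⟨
           suc (length (map proj₁ K)) * tree (l , c) K   ∎ })) ⟩
    ∑< m (λ c → Lab V (λ K → suc (length V) * tree (l , c) K))
      ≡⟨ trans (∫-cong l (λ c → Lab-* (suc (length V)) V _)) (∑<-* m (suc (length V)) _) ⟩
    suc (length V) * Trees l V ∎

  Lab-relabel : ∀ V W → length V ≡ length W → ∀ (f : List ℕ → ℕ) →
    Lab V (λ K → f (map proj₂ K)) ≡ Lab W (λ K → f (map proj₂ K))
  Lab-relabel []      []      _ f = refl
  Lab-relabel (x ∷ V) (y ∷ W) e f = ∫-cong x (λ c → Lab-relabel V W (suc-injective e) (λ cs → f (c ∷ cs)))

  -- By Cayley's formula the weight of a forest depends on the colours alone, and these are drawn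
  -- without regard to the labels.
  CForests-length : ∀ c V W → length V ≡ length W → CForests c V ≡ CForests c W
  CForests-length c V W e = trans (colours V) (trans (Lab-relabel V W e f) (sym (colours W)))
    where
    f : List ℕ → ℕ
    f cs = cayley c (∑ cs (λ d → m ∸ suc d)) (length cs)
    ∑-tiers : ∀ K → ∑ K s ≡ ∑ (map proj₂ K) (λ d → m ∸ suc d)
    ∑-tiers []      = refl
    ∑-tiers (v ∷ K) = cong (s v +_) (∑-tiers K)
    colours : ∀ V → CForests c V ≡ Lab V (λ K → f (map proj₂ K))
    colours V = Lab-cong V (λ K → trans (forest-const c K) (cong₂ (cayley c) (∑-tiers K) (sym (length-map proj₂ K))))

  CRooted-∷ : ∀ l V → CRooted (l ∷ V) ≡ suc (length V) * ∑< m (λ c → CForests (m ∸ suc c) V)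
  CRooted-∷ l V = begin
    Lab (l ∷ V) (λ K → Pick K C.tree)
      ≡⟨ Lab-Pick (l ∷ V) C.tree ⟩
    Pick (l ∷ V) (λ k V′ → ∑< m (λ c → Lab V′ (C.tree (k , c))))
      ≡⟨ Pick-cong↭ (l ∷ V) (λ k V′ p → ∑<-cong m (λ c _ → trans (Lab-cong V′ (λ K → C.tree≡forest (k , c) K))
           (CForests-length (m ∸ suc c) V′ V (suc-injective (↭-length p))))) ⟩
    Pick (l ∷ V) (λ _ _ → ∑< m (λ c → CForests (m ∸ suc c) V))
      ≡⟨ Pick-const (l ∷ V) _ ⟩
    suc (length V) * ∑< m (λ c → CForests (m ∸ suc c) V) ∎

  -- The comparison series is R(m z), hence one factor `m` per vertex. As all R_j agree, forests
  -- with root weights `a` have the series exp ((∑ a) R), hence the single parameter `∑< m a`.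
  ForestFormula RootFormula : List ℕ → Set
  ForestFormula V = ∀ a → m ^ length V * Forests a V ≡ CForests (∑< m a) V
  RootFormula   V = ∀ j → j < m → m ^ length V * Rooted-at j V ≡ CRooted V

  Trees-formula : ∀ {l V} → AllPairs _<_ (l ∷ V) → ForestFormula V →
    m ^ length V * Trees l V ≡ ∑< m (λ c → CForests (m ∸ suc c) V)
  Trees-formula {l} {V} (l<V ∷ _) formula = begin
    m ^ length V * Trees l V                                ≡⟨ cong (m ^ length V *_) (Trees-Forests l V l<V) ⟩
    m ^ length V * ∑< m (λ c → Forests (lt c) V)            ≡⟨ ∑<-* m (m ^ length V) _ ⟨
    ∑< m (λ c → m ^ length V * Forests (lt c) V)            ≡⟨ ∑<-cong m (λ c _ → trans (formula (lt c))
                                                               (cong (λ n → CForests n V) (∑<-lt m c))) ⟩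
    ∑< m (λ c → CForests (m ∸ suc c) V)                     ∎

  -- `m` copies of `Rooted-at j` add up to all tiers of the root, hence to trees with an arbitrary
  -- root; the factor `suc (length V)` for that root occurs on both sides.
  rootFormula-∷ : ∀ {l V} → AllPairs _<_ (l ∷ V) → ForestFormula V → RootFormula (l ∷ V)
  -- The pattern on `j<m` exposes `m` as a successor, so that it can be cancelled.
  rootFormula-∷ {l} {V} sorted formula j j<m@(s≤s _) = *-cancelˡ-≡ _ _ m (begin
    m * (m ^ suc (length V) * Rooted-at j (l ∷ V))
      ≡⟨ *-left-comm m (m ^ suc (length V)) _ ⟩
    m ^ suc (length V) * (m * Rooted-at j (l ∷ V))
      ≡⟨ cong (m ^ suc (length V) *_) (begin
           m * Rooted-at j (l ∷ V)             ≡⟨ ∑<-const m _ ⟨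
           ∑< m (λ _ → Rooted-at j (l ∷ V))    ≡⟨ ∑<-cong m (λ c c<m → trans (Rooted-at-0 j j<m sorted) (sym (Rooted-at-0 c c<m sorted))) ⟩
           ∑< m (λ c → Rooted-at c (l ∷ V))    ≡⟨ ∑-Rooted-at l V ⟩
           suc (length V) * Trees l V          ∎) ⟩
    m * m ^ length V * (suc (length V) * Trees l V)
      ≡⟨ rearrange m (m ^ length V) (suc (length V)) (Trees l V) ⟩
    m * (suc (length V) * (m ^ length V * Trees l V))
      ≡⟨ cong (λ t → m * (suc (length V) * t)) (Trees-formula sorted formula) ⟩
    m * (suc (length V) * ∑< m (λ c → CForests (m ∸ suc c) V))
      ≡⟨ cong (m *_) (CRooted-∷ l V) ⟨
    m * CRooted (l ∷ V) ∎)
    where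
    rearrange : ∀ a b c d → a * b * (c * d) ≡ a * (c * (b * d))
    rearrange = solve-∀

  -- `Forests-∷` and `CForests-∷` are recursions of the same shape. The component on `l ∷ B` is
  -- handled by the forest formula for `B`, and `length B + length D ≡ length V` distributes the
  -- powers of `m`.
  forestFormula-∷ : ∀ {l V} → AllPairs _<_ (l ∷ V) →
    (∀ W → length W ≤ length V → AllPairs _<_ W → ForestFormula W) → ForestFormula (l ∷ V)
  forestFormula-∷ {l} {V} sorted@(l<V ∷ sortedV) formula a = begin
    m ^ suc (length V) * Forests a (l ∷ V)
      ≡⟨ trans (cong (m ^ suc (length V) *_) (Forests-∷ a l V)) (sym (Spl-* (m ^ suc (length V)) V _)) ⟩
    Spl V (λ B D → m ^ suc (length V) * (∑< m (λ j → a j * Rooted-at j (l ∷ B)) * Forests a D))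
      ≡⟨ Spl-congⁱ V (λ B D i → step B D i) ⟩
    Spl V (λ B D → ∑< m a * CRooted (l ∷ B) * CForests (∑< m a) D)
      ≡⟨ CForests-∷ (∑< m a) l V ⟨
    CForests (∑< m a) (l ∷ V) ∎
    where
    root : ∀ B → AllPairs _<_ (l ∷ B) → length B ≤ length V →
      m ^ suc (length B) * ∑< m (λ j → a j * Rooted-at j (l ∷ B)) ≡ ∑< m a * CRooted (l ∷ B)
    root B sortedB B≤V = begin
      m ^ suc (length B) * ∑< m (λ j → a j * Rooted-at j (l ∷ B))
        ≡⟨ ∑<-* m (m ^ suc (length B)) _ ⟨
      ∑< m (λ j → m ^ suc (length B) * (a j * Rooted-at j (l ∷ B)))
        ≡⟨ ∑<-cong m (λ j j<m → trans (*-left-comm (m ^ suc (length B)) (a j) _) (trans (cong (a j *_)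
             (rootFormula-∷ sortedB (formula B B≤V (AllPairs.tail sortedB)) j j<m)) (*-comm (a j) _))) ⟩
      ∑< m (λ j → CRooted (l ∷ B) * a j)
        ≡⟨ trans (∑<-* m (CRooted (l ∷ B)) a) (*-comm (CRooted (l ∷ B)) _) ⟩
      ∑< m a * CRooted (l ∷ B) ∎
    step : ∀ B D → Interleaving B D V → m ^ suc (length V) * (∑< m (λ j → a j * Rooted-at j (l ∷ B)) * Forests a D) ≡
      ∑< m a * CRooted (l ∷ B) * CForests (∑< m a) D
    step B D i = begin
      m ^ suc (length V) * (∑< m (λ j → a j * Rooted-at j (l ∷ B)) * Forests a D)
        ≡⟨ cong (λ n → m ^ suc n * (∑< m (λ j → a j * Rooted-at j (l ∷ B)) * Forests a D)) (sym (length-split i)) ⟩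
      m ^ (suc (length B) + length D) * (∑< m (λ j → a j * Rooted-at j (l ∷ B)) * Forests a D)
        ≡⟨ trans (cong (_* (∑< m (λ j → a j * Rooted-at j (l ∷ B)) * Forests a D)) (^-distribˡ-+-* m (suc (length B)) (length D)))
             (*-interchange (m ^ suc (length B)) (m ^ length D) _ _) ⟩
      m ^ suc (length B) * ∑< m (λ j → a j * Rooted-at j (l ∷ B)) * (m ^ length D * Forests a D)
        ≡⟨ cong₂ _*_ (root B (proj₁ (All-split i l<V) ∷ proj₁ (AllPairs-split i sortedV)) (length-splitˡ i))
             (formula D (length-splitʳ i) (proj₂ (AllPairs-split i sortedV)) a) ⟩
      ∑< m a * CRooted (l ∷ B) * CForests (∑< m a) D ∎

  forestFormula : ∀ k V → length V ≤ k → AllPairs _<_ V → ForestFormula V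
  forestFormula k       []      _         _      a = refl
  forestFormula (suc k) (l ∷ V) (s≤s V≤k) sorted   = forestFormula-∷ sorted
    (λ W W≤V → forestFormula k W (≤-trans W≤V V≤k))

  Trees-count : ∀ l V → AllPairs _<_ (l ∷ V) →
    suc (length V) * m ^ length V * Trees l V ≡ Lab (l ∷ V) (λ K → ∑ K s ^ length V)
  Trees-count l V sorted@(_ ∷ sortedV) = begin
    suc (length V) * m ^ length V * Trees l V
      ≡⟨ *-assoc (suc (length V)) (m ^ length V) (Trees l V) ⟩
    suc (length V) * (m ^ length V * Trees l V)
      ≡⟨ cong (suc (length V) *_) (Trees-formula sorted (forestFormula (length V) V ≤-refl sortedV)) ⟩
    suc (length V) * ∑< m (λ c → CForests (m ∸ suc c) V)
      ≡⟨ CRooted-∷ l V ⟨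
    Lab (l ∷ V) (λ K → Pick K C.tree)
      ≡⟨ ∫-cong l (λ c → Lab-congᴼ V (λ { K refl _ → trans (Pick-tree (l , c) K)
           (cong (∑ ((l , c) ∷ K) s ^_) (sym (length-map proj₁ K))) })) ⟩
    Lab (l ∷ V) (λ K → ∑ K s ^ length V) ∎

-- The multinomial sum

cons : ∀ {k} → A → (Fin k → A) → Fin (suc k) → A
cons x f Fin.zero    = x
cons x f (Fin.suc i) = f i

∑-concatMap : ∀ (g : A → List B) xs (F : B → ℕ) → ∑ (concatMap g xs) F ≡ ∑ xs (λ x → ∑ (g x) F)
∑-concatMap g []       F = refl
∑-concatMap g (x ∷ xs) F = trans (∑-++ (g x) (concatMap g xs) F) (cong (∑ (g x) F +_) (∑-concatMap g xs F))

∑-map : ∀ (h : A → B) xs (F : B → ℕ) → ∑ (map h xs) F ≡ ∑ xs (λ x → F (h x))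
∑-map h []       F = refl
∑-map h (x ∷ xs) F = cong (F (h x) +_) (∑-map h xs F)

Extensional : {k : ℕ} → ((Fin k → A) → ℕ) → Set
Extensional F = ∀ {f g} → f ≗ g → F f ≡ F g

-- The tuples listed by `funs` agree with `cons x f` only pointwise, hence the extensionality of
-- `F`.
∑-funs-suc : ∀ (xs : List A) k (F : (Fin (suc k) → A) → ℕ) → Extensional F →
  ∑ (funs xs (suc k)) F ≡ ∑ xs (λ x → ∑ (funs xs k) (λ f → F (cons x f)))
∑-funs-suc xs k F ext = trans (∑-concatMap _ xs F) (∑-cong xs (λ x →
  trans (∑-map _ (funs xs k) F) (∑-cong (funs xs k) (λ f → ext (λ { Fin.zero → refl ; (Fin.suc i) → refl })))))

∑-allFin : ∀ m (f : ℕ → ℕ) → ∑ (allFin m) (λ i → f (toℕ i)) ≡ ∑< m f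
∑-allFin m f = trans (cong sum (map-tabulate {n = m} (λ i → i) (λ i → f (toℕ i)))) (go m f)
  where
  go : ∀ m (f : ℕ → ℕ) → sum (tabulate {n = m} (λ i → f (toℕ i))) ≡ ∑< m f
  go zero    f = refl
  go (suc m) f = cong (f 0 +_) (go m (λ c → f (suc c)))

-- The uncollected side of the multinomial theorem: words of `N` letters, with `f` evaluated at the
-- sum of the letters.
words : List ℕ → ℕ → (ℕ → ℕ) → ℕ
words gs zero    f = f 0
words gs (suc N) f = ∑ gs (λ x → words gs N (λ y → f (x + y)))

words-cong : ∀ gs N {f g : ℕ → ℕ} → (∀ y → f y ≡ g y) → words gs N f ≡ words gs N g
words-cong gs zero    h = h 0
words-cong gs (suc N) h = ∑-cong gs (λ x → words-cong gs N (λ y → h (x + y)))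

-- The occurrence of `x` at the head of the list takes `j` of the `N` positions. Terms with `j > N`
-- vanish, so any bound `b ≥ N` will do, and one bound can serve all parts of a composition. The
-- induction removes the first letter of the word and closes with Pascal's rule.
words-∷ : ∀ x xs b N → N ≤ b → ∀ f →
  words (x ∷ xs) N f ≡ ∑< (suc b) (λ j → (N choose j) * words xs (N ∸ j) (λ y → f (x * j + y)))
words-∷ x xs b zero _ f = sym (begin
  (0 choose 0) * f (x * 0 + 0) + ∑< b (λ j → (0 choose suc j) * words xs 0 (λ y → f (x * suc j + y)))
    ≡⟨ cong₂ _+_ (trans (*-identityˡ _) (cong f (trans (+-identityʳ (x * 0)) (*-zeroʳ x))))
         (trans (∑<-cong b (λ j _ → cong (_* words xs 0 (λ y → f (x * suc j + y))) (k>n⇒nCk≡0 {0} {suc j} (s≤s z≤n))))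
                (trans (∑<-const b 0) (*-zeroʳ b))) ⟩
  f 0 + 0
    ≡⟨ +-identityʳ _ ⟩
  f 0 ∎)
words-∷ x xs (suc b) (suc N) (s≤s N≤b) f = begin
  words (x ∷ xs) N (λ y → f (x + y)) + ∑ xs (λ z → words (x ∷ xs) N (λ y → f (z + y)))
    ≡⟨ cong₂ _+_ first second ⟩
  ∑< (suc b) (λ j → (N choose j) * U (suc j)) + ∑< (suc (suc b)) (λ j → (N choose j) * U j)
    ≡⟨ +-left-comm (∑< (suc b) (λ j → (N choose j) * U (suc j))) ((N choose 0) * U 0) _ ⟩
  (N choose 0) * U 0 + (∑< (suc b) (λ j → (N choose j) * U (suc j)) + ∑< (suc b) (λ j → (N choose suc j) * U (suc j)))
    ≡⟨ cong ((N choose 0) * U 0 +_) (∑<-+ (suc b) (λ j → (N choose j) * U (suc j)) (λ j → (N choose suc j) * U (suc j))) ⟨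
  (N choose 0) * U 0 + ∑< (suc b) (λ j → (N choose j) * U (suc j) + (N choose suc j) * U (suc j))
    ≡⟨ cong ((N choose 0) * U 0 +_) (∑<-cong (suc b) (λ j _ → trans (sym (*-distribʳ-+ (U (suc j)) (N choose j) (N choose suc j)))
         (cong (_* U (suc j)) (nCk+nC[k+1]≡[n+1]C[k+1] N j)))) ⟩
  ∑< (suc (suc b)) (λ j → (suc N choose j) * U j) ∎
  where
  U : ℕ → ℕ
  U j = words xs (suc N ∸ j) (λ y → f (x * j + y))
  shift-x : ∀ x j y → x + (x * j + y) ≡ x * suc j + y
  shift-x = solve-∀
  first : words (x ∷ xs) N (λ y → f (x + y)) ≡ ∑< (suc b) (λ j → (N choose j) * U (suc j))
  first = trans (words-∷ x xs b N N≤b _) (∑<-cong (suc b) (λ j _ → cong ((N choose j) *_)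
    (words-cong xs (N ∸ j) (λ y → cong f (shift-x x j y)))))
  term : ∀ j → (N choose j) * ∑ xs (λ z → words xs (N ∸ j) (λ y → f (z + (x * j + y)))) ≡ (N choose j) * U j
  term j with ≤-<-connex j N
  ... | inj₁ j≤N = cong ((N choose j) *_) (begin
    ∑ xs (λ z → words xs (N ∸ j) (λ y → f (z + (x * j + y))))  ≡⟨ ∑-cong xs (λ z → words-cong xs (N ∸ j) (λ y → cong f (+-left-comm z (x * j) y))) ⟩
    words xs (suc (N ∸ j)) (λ y → f (x * j + y))               ≡⟨ cong (λ n → words xs n (λ y → f (x * j + y))) (+-∸-assoc 1 j≤N) ⟨
    U j                                                        ∎)
  -- Truncated subtraction makes the two sides differ in word length here, but the binomial
  -- coefficient is 0.
  ... | inj₂ N<j = trans (cong (_* ∑ xs (λ z → words xs (N ∸ j) (λ y → f (z + (x * j + y))))) (k>n⇒nCk≡0 N<j)) (sym (cong (_* U j) (k>n⇒nCk≡0 N<j)))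
  second : ∑ xs (λ z → words (x ∷ xs) N (λ y → f (z + y))) ≡ ∑< (suc (suc b)) (λ j → (N choose j) * U j)
  second = begin
    ∑ xs (λ z → words (x ∷ xs) N (λ y → f (z + y)))
      ≡⟨ ∑-cong xs (λ z → words-∷ x xs (suc b) N (≤-trans N≤b (n≤1+n b)) _) ⟩
    ∑ xs (λ z → ∑< (suc (suc b)) (λ j → (N choose j) * words xs (N ∸ j) (λ y → f (z + (x * j + y)))))
      ≡⟨ ∑-∑< xs (suc (suc b)) (λ z j → (N choose j) * words xs (N ∸ j) (λ y → f (z + (x * j + y)))) ⟩
    ∑< (suc (suc b)) (λ j → ∑ xs (λ z → (N choose j) * words xs (N ∸ j) (λ y → f (z + (x * j + y)))))
      ≡⟨ ∑<-cong (suc (suc b)) (λ j _ → trans (∑-* (N choose j) xs _) (term j)) ⟩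
    ∑< (suc (suc b)) (λ j → (N choose j) * U j) ∎
    where
    ∑-∑< : ∀ (xs : List A) n (g : A → ℕ → ℕ) → ∑ xs (λ z → ∑< n (g z)) ≡ ∑< n (λ j → ∑ xs (λ z → g z j))
    ∑-∑< xs zero    g = ∑-0 xs
    ∑-∑< xs (suc n) g = trans (∑-+ xs _ _) (cong (∑ xs (λ z → g z 0) +_) (∑-∑< xs n _))

δ-refl : ∀ n → δ n n ≡ 1
δ-refl zero    = refl
δ-refl (suc n) = δ-refl n

δ-+ : ∀ j s N → j ≤ N → δ N (j + s) ≡ δ (N ∸ j) s
δ-+ zero    s N       _         = refl
δ-+ (suc j) s (suc N) (s≤s j≤N) = δ-+ j s N j≤N

δ-> : ∀ j s N → N < j → δ N (j + s) ≡ 0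
δ-> (suc j) s zero    _         = refl
δ-> (suc j) s (suc N) (s≤s N<j) = δ-> j s N N<j

δ-subst : ∀ a b (f : ℕ → ℕ) → δ a b * f b ≡ δ a b * f a
δ-subst zero    zero    f = refl
δ-subst zero    (suc b) f = refl
δ-subst (suc a) zero    f = refl
δ-subst (suc a) (suc b) f = δ-subst a b (λ n → f (suc n))

parts : ∀ {m b} → (Fin m → Fin (suc b)) → List ℕ
parts k = tabulate (λ i → toℕ (k i))

dot : ∀ {m b} → (Fin m → ℕ) → (Fin m → Fin (suc b)) → ℕ
dot g k = sum (tabulate (λ i → g i * toℕ (k i)))

parts-cong : ∀ {m b} {k k′ : Fin m → Fin (suc b)} → k ≗ k′ → parts k ≡ parts k′
parts-cong e = tabulate-cong (λ i → cong toℕ (e i))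

dot-cong : ∀ {m b} (g : Fin m → ℕ) {k k′ : Fin m → Fin (suc b)} → k ≗ k′ → dot g k ≡ dot g k′
dot-cong g e = cong sum (tabulate-cong (λ i → cong (λ n → g i * toℕ n) (e i)))

-- The condition on the sum of the parts is kept as a factor `δ`. It turns the top of the binomial
-- coefficient in `multinomial` into the fixed `N`, after which `words-∷` treats one part at a time.
multinomial-words : ∀ m b N → N ≤ b → ∀ (g : Fin m → ℕ) f →
  ∑ (funs (allFin (suc b)) m) (λ k → δ N (sum (parts k)) * (multinomial (parts k) * f (dot g k))) ≡ words (tabulate g) N f
multinomial-words zero b zero    _ g f = trans (+-identityʳ _) (trans (*-identityˡ _) (*-identityˡ _))
multinomial-words zero b (suc N) _ g f = refl
multinomial-words (suc m) b N N≤b g f = begin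
  ∑ (funs (allFin (suc b)) (suc m)) (λ k → δ N (sum (parts k)) * (multinomial (parts k) * f (dot g k)))
    ≡⟨ ∑-funs-suc (allFin (suc b)) m _ (λ e → cong₂ (λ p d → δ N (sum p) * (multinomial p * f d)) (parts-cong e) (dot-cong g e)) ⟩
  ∑ (allFin (suc b)) (λ j → ∑ (funs (allFin (suc b)) m) (λ k →
    δ N (toℕ j + sum (parts k)) * (((toℕ j + sum (parts k)) choose toℕ j) * multinomial (parts k) * f (g Fin.zero * toℕ j + dot (λ i → g (Fin.suc i)) k))))
    ≡⟨ ∑-cong (allFin (suc b)) (λ j → term (toℕ j)) ⟩
  ∑ (allFin (suc b)) (λ j → (N choose toℕ j) * words (tabulate (λ i → g (Fin.suc i))) (N ∸ toℕ j) (λ y → f (g Fin.zero * toℕ j + y)))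
    ≡⟨ ∑-allFin (suc b) (λ j → (N choose j) * words (tabulate (λ i → g (Fin.suc i))) (N ∸ j) (λ y → f (g Fin.zero * j + y))) ⟩
  ∑< (suc b) (λ j → (N choose j) * words (tabulate (λ i → g (Fin.suc i))) (N ∸ j) (λ y → f (g Fin.zero * j + y)))
    ≡⟨ words-∷ (g Fin.zero) _ b N N≤b f ⟨
  words (tabulate g) N f ∎
  where
  ks = funs (allFin (suc b)) m
  g′ : Fin m → ℕ
  g′ i = g (Fin.suc i)
  rearrange : ∀ d c p q → d * (c * p * q) ≡ d * c * (p * q)
  rearrange = solve-∀
  rearrange′ : ∀ d c p q → d * c * (p * q) ≡ c * (d * (p * q))
  rearrange′ = solve-∀
  term : ∀ j → ∑ ks (λ k → δ N (j + sum (parts k)) * (((j + sum (parts k)) choose j) * multinomial (parts k) * f (g Fin.zero * j + dot g′ k))) ≡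
    (N choose j) * words (tabulate g′) (N ∸ j) (λ y → f (g Fin.zero * j + y))
  term j with ≤-<-connex j N
  ... | inj₁ j≤N = begin
    ∑ ks (λ k → δ N (j + sum (parts k)) * (((j + sum (parts k)) choose j) * multinomial (parts k) * f (g Fin.zero * j + dot g′ k)))
      ≡⟨ ∑-cong ks (λ k → begin
           δ N (j + sum (parts k)) * (((j + sum (parts k)) choose j) * multinomial (parts k) * f (g Fin.zero * j + dot g′ k))
             ≡⟨ rearrange (δ N (j + sum (parts k))) _ (multinomial (parts k)) (f (g Fin.zero * j + dot g′ k)) ⟩
           δ N (j + sum (parts k)) * ((j + sum (parts k)) choose j) * (multinomial (parts k) * f (g Fin.zero * j + dot g′ k))
             ≡⟨ cong (_* (multinomial (parts k) * f (g Fin.zero * j + dot g′ k))) (δ-subst N (j + sum (parts k)) (_choose j)) ⟩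
           δ N (j + sum (parts k)) * (N choose j) * (multinomial (parts k) * f (g Fin.zero * j + dot g′ k))
             ≡⟨ cong (λ d → d * (N choose j) * (multinomial (parts k) * f (g Fin.zero * j + dot g′ k))) (δ-+ j _ N j≤N) ⟩
           δ (N ∸ j) (sum (parts k)) * (N choose j) * (multinomial (parts k) * f (g Fin.zero * j + dot g′ k))
             ≡⟨ rearrange′ (δ (N ∸ j) (sum (parts k))) (N choose j) (multinomial (parts k)) (f (g Fin.zero * j + dot g′ k)) ⟩
           (N choose j) * (δ (N ∸ j) (sum (parts k)) * (multinomial (parts k) * f (g Fin.zero * j + dot g′ k))) ∎) ⟩
    ∑ ks (λ k → (N choose j) * (δ (N ∸ j) (sum (parts k)) * (multinomial (parts k) * f (g Fin.zero * j + dot g′ k))))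
      ≡⟨ ∑-* (N choose j) ks _ ⟩
    (N choose j) * ∑ ks (λ k → δ (N ∸ j) (sum (parts k)) * (multinomial (parts k) * f (g Fin.zero * j + dot g′ k)))
      ≡⟨ cong ((N choose j) *_) (multinomial-words m b (N ∸ j) (≤-trans (m∸n≤m N j) N≤b) g′ _) ⟩
    (N choose j) * words (tabulate g′) (N ∸ j) (λ y → f (g Fin.zero * j + y)) ∎
  ... | inj₂ N<j = begin
    ∑ ks (λ k → δ N (j + sum (parts k)) * (((j + sum (parts k)) choose j) * multinomial (parts k) * f (g Fin.zero * j + dot g′ k)))
      ≡⟨ trans (∑-cong ks (λ k → cong (_* (((j + sum (parts k)) choose j) * multinomial (parts k) * f (g Fin.zero * j + dot g′ k))) (δ-> j _ N N<j))) (∑-0 ks) ⟩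
    0
      ≡⟨ cong (_* words (tabulate g′) (N ∸ j) (λ y → f (g Fin.zero * j + y))) (k>n⇒nCk≡0 N<j) ⟨
    (N choose j) * words (tabulate g′) (N ∸ j) (λ y → f (g Fin.zero * j + y)) ∎

if≡δ : ∀ a b x → (if ⌊ a Data.Nat.≟ b ⌋ then x else 0) ≡ δ b a * x
if≡δ a b x with a Data.Nat.≟ b
... | yes refl = trans (sym (*-identityˡ x)) (cong (_* x) (sym (δ-refl a)))
... | no a≢b   = cong (_* x) (sym (δ-≢ a b a≢b))
  where
  δ-≢ : ∀ a b → (a ≡ b → ⊥) → δ b a ≡ 0
  δ-≢ zero    zero    h = contradiction refl h
  δ-≢ zero    (suc b) h = refl
  δ-≢ (suc a) zero    h = refl
  δ-≢ (suc a) (suc b) h = δ-≢ a b (λ e → h (cong suc e))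

∑-filter : ∀ (p : A → Bool) (F : List A → List A) → F [] ≡ [] →
  (∀ x xs → F (x ∷ xs) ≡ (if p x then x ∷ F xs else F xs)) → ∀ xs (G : A → ℕ) →
  ∑ (F xs) G ≡ ∑ xs (λ x → if p x then G x else 0)
∑-filter p F F[] F∷ []       G rewrite F[] = refl
∑-filter p F F[] F∷ (x ∷ xs) G rewrite F∷ x xs with p x
... | true  = cong (G x +_) (∑-filter p F F[] F∷ xs G)
... | false = ∑-filter p F F[] F∷ xs G

-- The filter inside compositions is local to its definition, hence only known through its equations.
compositions-filter : ∀ m n → ∃ λ (F : List (Fin m → Fin (suc n)) → List (Fin m → Fin (suc n))) →
  F [] ≡ [] ×
  (∀ k ks → F (k ∷ ks) ≡ (if ⌊ sum (parts k) Data.Nat.≟ n ⌋ then k ∷ F ks else F ks)) ×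
  compositions m n ≡ map (λ k i → toℕ (k i)) (F (funs (allFin (suc n)) m))
compositions-filter m n = F , refl , (λ _ _ → refl) , unfold
  where
  F : List (Fin m → Fin (suc n)) → List (Fin m → Fin (suc n))
  F = _
  unfold : compositions m n ≡ map (λ k i → toℕ (k i)) (F (funs (allFin (suc n)) m))
  -- Once the enumeration is a variable `ks`, the equation is a pattern that determines `F` by
  -- unification.
  unfold with funs (allFin (suc n)) m
  ... | ks = refl {x = map (λ k i → toℕ (k i)) (F ks)}

rhsSum-funs : ∀ n m → rhsSum n m ≡ ∑ (funs (allFin (suc n)) m) (λ k →
  δ n (sum (parts k)) * (multinomial (parts k) * dot (λ i → m ∸ suc (toℕ i)) k ^ (n ∸ 1)))
rhsSum-funs n m with compositions-filter m n
... | F , F[] , F∷ , e = begin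
  ∑ (compositions m n) G
    ≡⟨ cong (λ ks → ∑ ks G) e ⟩
  ∑ (map (λ k i → toℕ (k i)) (F ks)) G
    ≡⟨ ∑-map (λ k i → toℕ (k i)) (F ks) G ⟩
  ∑ (F ks) (λ k → G (λ i → toℕ (k i)))
    ≡⟨ ∑-filter (λ k → ⌊ sum (parts k) Data.Nat.≟ n ⌋) F F[] F∷ ks _ ⟩
  ∑ ks (λ k → if ⌊ sum (parts k) Data.Nat.≟ n ⌋ then G (λ i → toℕ (k i)) else 0)
    ≡⟨ ∑-cong ks (λ k → if≡δ (sum (parts k)) n _) ⟩
  ∑ ks (λ k → δ n (sum (parts k)) * G (λ i → toℕ (k i))) ∎
  where
  ks = funs (allFin (suc n)) m
  G : (Fin m → ℕ) → ℕ
  G k = multinomial (tabulate k) * weight m k ^ (n ∸ 1)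

words-Lab : ∀ m V f → words (tabulate {n = m} (λ i → m ∸ suc (toℕ i))) (length V) f ≡
  Tiers.Lab m V (λ K → f (∑ K (Tiers.s m)))
words-Lab m []      f = refl
words-Lab m (l ∷ V) f = begin
  ∑ (tabulate (λ (i : Fin m) → m ∸ suc (toℕ i))) (λ x → words (tabulate (λ i → m ∸ suc (toℕ i))) (length V) (λ y → f (x + y)))
    ≡⟨ cong sum (map-tabulate {n = m} (λ i → m ∸ suc (toℕ i)) (λ x → words (tabulate (λ i → m ∸ suc (toℕ i))) (length V) (λ y → f (x + y)))) ⟩
  sum (tabulate (λ (i : Fin m) → words (tabulate (λ i → m ∸ suc (toℕ i))) (length V) (λ y → f (m ∸ suc (toℕ i) + y))))
    ≡⟨ cong sum (map-tabulate {n = m} (λ i → i) (λ i → words (tabulate (λ i → m ∸ suc (toℕ i))) (length V) (λ y → f (m ∸ suc (toℕ i) + y)))) ⟨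
  ∑ (allFin m) (λ i → words (tabulate (λ i → m ∸ suc (toℕ i))) (length V) (λ y → f (m ∸ suc (toℕ i) + y)))
    ≡⟨ ∑-allFin m (λ c → words (tabulate (λ i → m ∸ suc (toℕ i))) (length V) (λ y → f (m ∸ suc c + y))) ⟩
  ∑< m (λ c → words (tabulate (λ i → m ∸ suc (toℕ i))) (length V) (λ y → f (m ∸ suc c + y)))
    ≡⟨ ∑<-cong m (λ c _ → words-Lab m V (λ y → f (m ∸ suc c + y))) ⟩
  Tiers.Lab m (l ∷ V) (λ K → f (∑ K (Tiers.s m))) ∎

rhsSum-Lab : ∀ m l V → rhsSum (suc (length V)) m ≡ Tiers.Lab m (l ∷ V) (λ K → ∑ K (Tiers.s m) ^ length V)
rhsSum-Lab m l V = trans (rhsSum-funs (suc (length V)) m) (trans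
  (multinomial-words m (suc (length V)) (suc (length V)) ≤-refl _ (_^ length V)) (words-Lab m (l ∷ V) (_^ length V)))

-- Parent maps

[_] : Bool → ℕ
[ true  ] = 1
[ false ] = 0

≡ᵇ-refl : ∀ {n} (i : Fin n) → (i ≡ᵇ i) ≡ true
≡ᵇ-refl i with i Fin.≟ i
... | yes _  = refl
... | no i≢i = contradiction refl i≢i

≡ᵇ⇒≡ᶠ : ∀ {n} {i j : Fin n} → (i ≡ᵇ j) ≡ true → i ≡ j
≡ᵇ⇒≡ᶠ {i = i} {j} e with i Fin.≟ j
... | yes p = p

eq : ∀ {n} → Fin n → Fin n → ℕ
eq i j = [ i ≡ᵇ j ]

eq-refl : ∀ {n} (i : Fin n) → eq i i ≡ 1
eq-refl i = cong [_] (≡ᵇ-refl i)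

eq-≢ : ∀ {n} {i j : Fin n} → i ≢ j → eq i j ≡ 0
eq-≢ {i = i} {j} i≢j with i Fin.≟ j
... | yes p = contradiction p i≢j
... | no  _ = refl

eq∈01 : ∀ {n} (i j : Fin n) → eq i j ≡ 0 ⊎ i ≡ j
eq∈01 i j with i Fin.≟ j
... | yes p = inj₂ p
... | no  _ = inj₁ refl

∑-eq-∉ : ∀ {n} (A : List (Fin n)) y → All (y ≢_) A → ∑ A (eq y) ≡ 0
∑-eq-∉ []      y []       = refl
∑-eq-∉ (x ∷ A) y (p ∷ ps) = cong₂ _+_ (eq-≢ p) (∑-eq-∉ A y ps)

∑-eq-∈ : ∀ {n} (A : List (Fin n)) y → y ∈ A → AllPairs _≢_ A → ∑ A (eq y) ≡ 1
∑-eq-∈ (x ∷ A) y (here refl) (u ∷ us) = cong₂ _+_ (eq-refl y) (∑-eq-∉ A y u)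
∑-eq-∈ (x ∷ A) y (there y∈A) (u ∷ us) = cong₂ _+_ (eq-≢ (λ { refl → All.lookup u y∈A refl })) (∑-eq-∈ A y y∈A us)

∑-eq≢0 : ∀ {n} (A : List (Fin n)) y → ∑ A (eq y) ≢ 0 → y ∈ A
∑-eq≢0 []      y h = contradiction refl h
∑-eq≢0 (x ∷ A) y h with eq∈01 y x
... | inj₂ refl = here refl
... | inj₁ e    = there (∑-eq≢0 A y (λ e′ → h (cong₂ _+_ e e′)))

∑-allFin-eq : ∀ n (y : Fin n) → ∑ (allFin n) (eq y) ≡ 1
∑-allFin-eq n y = ∑-eq-∈ (allFin n) y (∈-allFin y) (allFin⁺ n)

∑-eq-* : ∀ n (y : Fin n) (f : Fin n → ℕ) → ∑ (allFin n) (λ b → f b * eq b y) ≡ f y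
∑-eq-* n y f = begin
  ∑ (allFin n) (λ b → f b * eq b y)  ≡⟨ ∑-cong (allFin n) (λ b → swap-eq b) ⟩
  ∑ (allFin n) (λ b → f y * eq y b)  ≡⟨ ∑-* (f y) (allFin n) (eq y) ⟩
  f y * ∑ (allFin n) (eq y)          ≡⟨ cong (f y *_) (∑-allFin-eq n y) ⟩
  f y * 1                            ≡⟨ *-identityʳ _ ⟩
  f y                                ∎
  where
  swap-eq : ∀ b → f b * eq b y ≡ f y * eq y b
  swap-eq b with eq∈01 b y
  ... | inj₂ refl = refl
  ... | inj₁ e with eq∈01 y b
  ...   | inj₂ refl = refl
  ...   | inj₁ e′   = trans (cong (f b *_) e) (trans (*-zeroʳ (f b)) (sym (trans (cong (f y *_) e′) (*-zeroʳ (f y)))))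

∏ᶠ : ∀ k → (Fin k → ℕ) → ℕ
∏ᶠ zero    f = 1
∏ᶠ (suc k) f = f Fin.zero * ∏ᶠ k (λ i → f (Fin.suc i))

∏ᶠ-cong : ∀ k {f g : Fin k → ℕ} → f ≗ g → ∏ᶠ k f ≡ ∏ᶠ k g
∏ᶠ-cong zero    e = refl
∏ᶠ-cong (suc k) e = cong₂ _*_ (e Fin.zero) (∏ᶠ-cong k (λ i → e (Fin.suc i)))

∏ᶠ≡1 : ∀ k {f : Fin k → ℕ} → (∀ i → f i ≡ 1) → ∏ᶠ k f ≡ 1
∏ᶠ≡1 zero    e = refl
∏ᶠ≡1 (suc k) e = cong₂ _*_ (e Fin.zero) (∏ᶠ≡1 k (λ i → e (Fin.suc i)))

∏ᶠ∈01 : ∀ k {P : Fin k → Set} (f : Fin k → ℕ) → (∀ i → f i ≡ 0 ⊎ P i) → ∏ᶠ k f ≡ 0 ⊎ (∀ i → P i)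
∏ᶠ∈01 zero    f h = inj₂ (λ ())
∏ᶠ∈01 (suc k) f h with h Fin.zero | ∏ᶠ∈01 k (λ i → f (Fin.suc i)) (λ i → h (Fin.suc i))
... | inj₁ e | _      = inj₁ (cong (_* ∏ᶠ k (λ i → f (Fin.suc i))) e)
... | inj₂ p | inj₁ e = inj₁ (trans (cong (f Fin.zero *_) e) (*-zeroʳ (f Fin.zero)))
... | inj₂ p | inj₂ q = inj₂ (λ { Fin.zero → p ; (Fin.suc i) → q i })

module _ {X : Set} (w : X → X → ℕ) where
  open Forest w

  -- Another vertex `y` would have to be the root of the component of `x`; among the vertices below
  -- `y` the same situation recurs with a shorter list.
  forest-orphan : ∀ k a x V → length V ≤ k → a x ≡ 0 → All (λ y → w y x ≡ 0) V → forest a (x ∷ V) ≡ 0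
  forest-orphan k a x V V≤k ax≡0 orphan = begin
    forest a (x ∷ V)
      ≡⟨ forest-component a x V ⟩
    Spl V (λ B C → Pick (x ∷ B) (λ y B′ → a y * tree y B′) * forest a C)
      ≡⟨ Spl-congⁱ V (λ B C i → cong (_* forest a C) (cong₂ _+_ (cong (_* tree x B) ax≡0)
           (trans (Pick-cong↭ B (λ y B′ p → trans (cong (a y *_) (branch k V≤k B C i y B′ p)) (*-zeroʳ (a y)))) (Pick-0 B)))) ⟩
    Spl V (λ B C → 0)
      ≡⟨ Spl-0 V ⟩
    0 ∎
    where
    branch : ∀ k → length V ≤ k → ∀ B C → Interleaving B C V → ∀ y B′ → y ∷ B′ ↭ B → tree y (x ∷ B′) ≡ 0
    branch k V≤k B C i y B′ p with ↭.All-resp-↭ (↭-sym p) (proj₁ (All-split i orphan))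
    ... | wyx≡0 ∷ rest with k | ≤-trans (≤-trans (≤-reflexive (↭-length p)) (length-splitˡ i)) V≤k
    ...   | suc k′ | s≤s B′≤k = trans (tree≡forest y (x ∷ B′)) (forest-orphan k′ (w y) x B′ B′≤k wyx≡0 rest)

module ParentMap {n′ : ℕ} (p : Fin n′ → Fin (suc n′)) where
  n = suc n′

  -- The root 0 is its own parent; this value plays no role.
  parent : Fin n → Fin n
  parent Fin.zero    = Fin.zero
  parent (Fin.suc v) = p v

  data Rooted : Fin n → Set where
    root : Rooted Fin.zero
    step : ∀ {v} → Rooted (p v) → Rooted (Fin.suc v)

  wp : Fin n → Fin n → ℕ
  wp q v = eq (parent v) q

  open Forest wp

  others : List (Fin n)
  others = tabulate Fin.suc

  Φ : ℕ
  Φ = tree Fin.zero others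

  attached : List (Fin n) → Fin n → ℕ
  attached A v = ∑ A (λ q → wp q v)

  Distinct : List (Fin n) → Set
  Distinct = AllPairs _≢_

  Distinct-↭ : ∀ {V W} → V ↭ W → Distinct V → Distinct W
  Distinct-↭ Perm.refl u = u
  Distinct-↭ (Perm.prep x p) (u ∷ us) = ↭.All-resp-↭ p u ∷ Distinct-↭ p us
  Distinct-↭ (Perm.swap x y p) ((x≢y ∷ u) ∷ v ∷ us) =
    ((λ e → x≢y (sym e)) ∷ ↭.All-resp-↭ p v) ∷ ↭.All-resp-↭ p u ∷ Distinct-↭ p us
  Distinct-↭ (Perm.trans p q) u = Distinct-↭ q (Distinct-↭ p u)

  Distinct-++ : ∀ A {V} → Distinct (A ++ V) → Distinct A × All (λ x → All (x ≢_) V) A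
  Distinct-++ []      u        = [] , []
  Distinct-++ (x ∷ A) (u ∷ us) = let d , e = Distinct-++ A us in
    (All.++⁻ˡ A u ∷ d) , (All.++⁻ʳ A u ∷ e)

  -- The parent of `x` lies in `A`, so no vertex of `V` is its parent and `x` must be a root. Moving
  -- it into `A` turns its children into roots.
  absorb : ∀ A x V → Distinct (A ++ x ∷ V) → parent x ∈ A → forest (attached A) (x ∷ V) ≡ forest (attached (x ∷ A)) V
  absorb A x V distinct px∈A = begin
    forest (attached A) (x ∷ V)
      ≡⟨ forest-∷ (attached A) x V ⟩
    attached A x * forest (attached (x ∷ A)) V + Pick V (λ y V′ → attached A y * Spl V′ (λ B C → tree y (x ∷ B) * forest (attached A) C))
      ≡⟨ cong₂ _+_ (cong (_* forest (attached (x ∷ A)) V) (∑-eq-∈ A (parent x) px∈A (proj₁ (Distinct-++ A distinct))))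
           (trans (Pick-cong↭ V (λ y V′ q → trans (cong (attached A y *_) (vanish y V′ (↭.All-resp-↭ (↭-sym q) none))) (*-zeroʳ (attached A y)))) (Pick-0 V)) ⟩
    1 * forest (attached (x ∷ A)) V + 0
      ≡⟨ trans (+-identityʳ _) (*-identityˡ _) ⟩
    forest (attached (x ∷ A)) V ∎
    where
    none : All (λ y → wp y x ≡ 0) V
    none = All.map (λ ne → eq-≢ ne) (All.tail (All.lookup (proj₂ (Distinct-++ A distinct)) px∈A))
    vanish : ∀ y V′ → All (λ y → wp y x ≡ 0) (y ∷ V′) → Spl V′ (λ B C → tree y (x ∷ B) * forest (attached A) C) ≡ 0
    vanish y V′ (wyx≡0 ∷ rest) = trans (Spl-congⁱ V′ (λ B C i → cong (_* forest (attached A) C)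
      (trans (tree≡forest y (x ∷ B)) (forest-orphan wp (length B) (wp y) x B ≤-refl wyx≡0 (proj₁ (All-split i rest)))))) (Spl-0 V′)

  nextOf : ∀ A V → All (λ v → attached A v ≡ 0) V ⊎ (∃ λ x → ∃ λ V′ → x ∷ V′ ↭ V × parent x ∈ A)
  nextOf A [] = inj₁ []
  nextOf A (v ∷ V) with attached A v in e | nextOf A V
  ... | suc _ | _ = inj₂ (v , V , ↭-refl , ∑-eq≢0 A (parent v) (λ e′ → contradiction (trans (sym e) e′) λ ()))
  ... | zero  | inj₁ all = inj₁ (e ∷ all)
  ... | zero  | inj₂ (x , V′ , q , x∈) = inj₂ (x , v ∷ V′ , ↭-trans (Perm.swap x v ↭-refl) (prep v q) , x∈)

  Distinct-next : ∀ A {x V V′} → x ∷ V′ ↭ V → Distinct (A ++ V) → Distinct (A ++ x ∷ V′)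
  Distinct-next A q = Distinct-↭ (↭.++⁺ˡ A (↭-sym q))

  -- A search from the root absorbs vertices whose parents have been reached. Were it to stop early,
  -- the remaining forest would have no possible root and weigh 0.
  forest≢0⇒rooted : ∀ k A V → length V ≤ k → Distinct (A ++ V) → All Rooted A → forest (attached A) V ≢ 0 → All Rooted V
  forest≢0⇒rooted k       A []      _   _        _  _  = []
  forest≢0⇒rooted (suc k) A (v ∷ V) V≤k distinct rA ≢0 with nextOf A (v ∷ V)
  ... | inj₁ none = contradiction (trans (forest-congᴾ wp (v ∷ V) none (λ _ e → e)) (forest-0 v V (λ _ → refl))) ≢0
  ... | inj₂ (x , V′ , q , px∈A) = ↭.All-resp-↭ q (rx ∷ forest≢0⇒rooted k (x ∷ A) V′
      (s≤s⁻¹ (≤-trans (≤-reflexive (↭-length q)) V≤k)) (Distinct-↭ (shift x A V′) distinct′) (rx ∷ rA)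
      (λ e → ≢0 (trans (forest-↭ (attached A) (↭-sym q)) (trans (absorb A x V′ distinct′ px∈A) e))))
    where
    distinct′ = Distinct-next A q distinct
    rooted-parent : ∀ x → Rooted (parent x) → Rooted x
    rooted-parent Fin.zero    _ = root
    rooted-parent (Fin.suc v) r = step r
    rx : Rooted x
    rx = rooted-parent x (All.lookup rA px∈A)

  rooted⇒forest≡1 : (∀ v → Rooted v) → ∀ k A V → length V ≤ k → Distinct (A ++ V) → (∀ v → v ∈ A ++ V) →
    Fin.zero ∈ A → forest (attached A) V ≡ 1
  rooted⇒forest≡1 r k       A []      _   _        _     _   = refl
  rooted⇒forest≡1 r (suc k) A (v ∷ V) V≤k distinct every 0∈A with nextOf A (v ∷ V)
  -- The search has stopped with `v` left over: following parents from `v` never leaves the list,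
  -- although it should end at 0, which is in `A`.
  ... | inj₁ none = contradiction (here refl) (unreachable (r v))
    where
    unreachable : ∀ {u} → Rooted u → u ∈ v ∷ V → ⊥
    unreachable root u∈V = All.lookup (All.lookup (proj₂ (Distinct-++ A distinct)) 0∈A) u∈V refl
    unreachable (step {u} s) u∈V with ∈-++⁻ A (every (p u))
    ... | inj₂ pu∈V = unreachable s pu∈V
    ... | inj₁ pu∈A with trans (sym (All.lookup none u∈V)) (∑-eq-∈ A (p u) pu∈A (proj₁ (Distinct-++ A distinct)))
    ...   | ()
  ... | inj₂ (x , V′ , q , px∈A) = begin
    forest (attached A) (v ∷ V)    ≡⟨ forest-↭ (attached A) (↭-sym q) ⟩
    forest (attached A) (x ∷ V′)   ≡⟨ absorb A x V′ distinct′ px∈A ⟩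
    forest (attached (x ∷ A)) V′   ≡⟨ rooted⇒forest≡1 r k (x ∷ A) V′ (s≤s⁻¹ (≤-trans (≤-reflexive (↭-length q)) V≤k))
                                        (Distinct-↭ (shift x A V′) distinct′)
                                        (λ u → ↭.∈-resp-↭ (↭-trans (↭.++⁺ˡ A (↭-sym q)) (shift x A V′)) (every u)) (there 0∈A) ⟩
    1                              ∎
    where
    distinct′ = Distinct-next A q distinct

  distinct-all : Distinct (Fin.zero ∷ others)
  distinct-all = allFin⁺ n

  Φ≡forest : Φ ≡ forest (attached (Fin.zero ∷ [])) others
  Φ≡forest = trans (tree≡forest Fin.zero others) (forest-cong others (λ v → sym (+-identityʳ _)))

  Φ≢0⇒rooted : Φ ≢ 0 → ∀ v → Rooted v
  Φ≢0⇒rooted ≢0 v = All.lookup (root ∷ forest≢0⇒rooted (length others) (Fin.zero ∷ []) others ≤-refl distinct-all (root ∷ [])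
    (λ e → ≢0 (trans Φ≡forest e))) (∈-allFin v)

  rooted⇒Φ≡1 : (∀ v → Rooted v) → Φ ≡ 1
  rooted⇒Φ≡1 r = trans Φ≡forest (rooted⇒forest≡1 r (length others) (Fin.zero ∷ []) others ≤-refl distinct-all ∈-allFin (here refl))

-- Every vertex has exactly one parent, so the weight of trees is multilinear in the rows of w.
module Multilinear {n : ℕ} (w : Fin n → Fin n → ℕ) where
  ∫ : Fin n → (Fin n → ℕ) → ℕ
  ∫ v f = ∑ (allFin n) (λ b → w b v * f b)

  ∫-congᴼ : ∀ v {f g : Fin n → ℕ} → (∀ b → ⊤ → f b ≡ g b) → ∫ v f ≡ ∫ v g
  ∫-congᴼ v h = ∑-cong (allFin n) (λ b → cong (w b v *_) (h b tt))

  ∫-+ : ∀ v (f g : Fin n → ℕ) → ∫ v (λ b → f b + g b) ≡ ∫ v f + ∫ v g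
  ∫-+ v f g = trans (∑-cong (allFin n) (λ b → *-distribˡ-+ (w b v) _ _)) (∑-+ (allFin n) _ _)

  ∫-* : ∀ v k (f : Fin n → ℕ) → ∫ v (λ b → k * f b) ≡ k * ∫ v f
  ∫-* v k f = trans (∑-cong (allFin n) (λ b → *-left-comm (w b v) k _)) (∑-* k (allFin n) _)

  ∫-swap : ∀ u v (f : Fin n → Fin n → ℕ) → ∫ u (λ b → ∫ v (f b)) ≡ ∫ v (λ c → ∫ u (λ b → f b c))
  ∫-swap u v f = begin
    ∑ (allFin n) (λ b → w b u * ∑ (allFin n) (λ c → w c v * f b c))
      ≡⟨ ∑-cong (allFin n) (λ b → sym (∑-* (w b u) (allFin n) _)) ⟩
    ∑ (allFin n) (λ b → ∑ (allFin n) (λ c → w b u * (w c v * f b c)))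
      ≡⟨ ∑-swap (allFin n) (allFin n) _ ⟩
    ∑ (allFin n) (λ c → ∑ (allFin n) (λ b → w b u * (w c v * f b c)))
      ≡⟨ ∑-cong (allFin n) (λ c → trans (∑-cong (allFin n) (λ b → *-left-comm (w b u) (w c v) _)) (∑-* (w c v) (allFin n) _)) ⟩
    ∑ (allFin n) (λ c → w c v * ∑ (allFin n) (λ b → w b u * f b c)) ∎

  open Labelling {Fin n} {Fin n} ∫ (λ _ → ⊤) ∫-congᴼ ∫-+ ∫-* ∫-swap

  -- A vertex carries a chosen parent `b` and may be the child of `b` only.
  wY : Fin n × Fin n → Fin n × Fin n → ℕ
  wY (q , _) (_ , b) = eq b q

  private
    module F = Forest w
    module G = Forest wY

  Lab-∏ : ∀ q q′ S → Lab S (λ K → ∏ K (wY (q , q′))) ≡ ∏ S (w q)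
  Lab-∏ q q′ []      = refl
  Lab-∏ q q′ (v ∷ S) = begin
    ∑ (allFin n) (λ b → w b v * Lab S (λ K → eq b q * ∏ K (wY (q , q′))))
      ≡⟨ ∑-cong (allFin n) (λ b → trans (cong (w b v *_) (trans (Lab-* (eq b q) S _) (cong (eq b q *_) (Lab-∏ q q′ S)))) (sym (*-assoc (w b v) _ _))) ⟩
    ∑ (allFin n) (λ b → w b v * eq b q * ∏ S (w q))
      ≡⟨ trans (∑-*ʳ (∏ S (w q)) (allFin n) _) (cong (_* ∏ S (w q)) (∑-eq-* n q (λ b → w b v))) ⟩
    w q v * ∏ S (w q) ∎

  hang-Lab : ∀ {t : Fin n → List (Fin n) → ℕ} {t′ : Fin n × Fin n → List (Fin n × Fin n) → ℕ} →
    (∀ q q′ B → Lab B (t′ (q , q′)) ≡ t q B) → ∀ K R → Lab R (hang t′ K) ≡ hang t (map proj₁ K) R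
  hang-Lab h [] []      = refl
  hang-Lab h [] (v ∷ R) = trans (∫-cong v (λ b → Lab-* 0 R (λ _ → 0))) (∫-* v 0 (λ _ → 0))
  hang-Lab {t} {t′} h ((q , q′) ∷ K) R = begin
    Lab R (λ L → Spl L (λ B C → t′ (q , q′) B * hang t′ K C))
      ≡⟨ Lab-Spl R _ ⟩
    Spl R (λ B C → Lab B (λ L → Lab C (λ M → t′ (q , q′) L * hang t′ K M)))
      ≡⟨ Spl-cong R (λ B C → trans (sym (Lab-*-Lab B C _ _)) (cong₂ _*_ (h q q′ B) (hang-Lab h K C))) ⟩
    hang t (q ∷ map proj₁ K) R ∎

  treeₙ-Lab : ∀ k q q′ V → Lab V (G.treeₙ k (q , q′)) ≡ F.treeₙ k q V
  treeₙ-Lab zero    q q′ []      = refl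
  treeₙ-Lab zero    q q′ (v ∷ V) = trans (∫-cong v (λ b → Lab-* 0 V (λ _ → 0))) (∫-* v 0 (λ _ → 0))
  treeₙ-Lab (suc k) q q′ V = begin
    Lab V (λ L → Spl L (λ S R → ∏ S (wY (q , q′)) * hang (G.treeₙ k) S R))
      ≡⟨ Lab-Spl V _ ⟩
    Spl V (λ S R → Lab S (λ K → Lab R (λ L → ∏ K (wY (q , q′)) * hang (G.treeₙ k) K L)))
      ≡⟨ Spl-cong V (λ S R → begin
           Lab S (λ K → Lab R (λ L → ∏ K (wY (q , q′)) * hang (G.treeₙ k) K L))
             ≡⟨ Lab-congᴼ S (λ { K refl _ → trans (Lab-* (∏ K (wY (q , q′))) R _)
                  (cong (∏ K (wY (q , q′)) *_) (hang-Lab (treeₙ-Lab k) K R)) }) ⟩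
           Lab S (λ K → ∏ K (wY (q , q′)) * hang (F.treeₙ k) S R)
             ≡⟨ trans (Lab-*ʳ (hang (F.treeₙ k) S R) S _) (cong (_* hang (F.treeₙ k) S R) (Lab-∏ q q′ S)) ⟩
           ∏ S (w q) * hang (F.treeₙ k) S R ∎) ⟩
    F.treeₙ (suc k) q V ∎

  tree-Lab : ∀ q q′ V → Lab V (G.tree (q , q′)) ≡ F.tree q V
  tree-Lab q q′ V = trans (Lab-congᴼ V (λ { K refl _ → cong (λ k → G.treeₙ k (q , q′) K) (sym (length-map proj₁ K)) }))
    (treeₙ-Lab (length V) q q′ V)

  Lab-funs : ∀ k (lab : Fin k → Fin n) f →
    Lab (tabulate lab) f ≡ ∑ (funs (allFin n) k) (λ p → ∏ᶠ k (λ i → w (p i) (lab i)) * f (tabulate (λ i → lab i , p i)))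
  Lab-funs zero    lab f = sym (trans (+-identityʳ _) (*-identityˡ _))
  Lab-funs (suc k) lab f = sym (begin
    ∑ (funs (allFin n) (suc k)) (λ p → ∏ᶠ (suc k) (λ i → w (p i) (lab i)) * f (tabulate (λ i → lab i , p i)))
      ≡⟨ ∑-funs-suc (allFin n) k _ (λ e → cong₂ _*_ (∏ᶠ-cong (suc k) (λ i → cong (λ b → w b (lab i)) (e i)))
           (cong f (tabulate-cong (λ i → cong (lab i ,_) (e i))))) ⟩
    ∑ (allFin n) (λ b → ∑ (funs (allFin n) k) (λ p → w b (lab Fin.zero) * ∏ᶠ k (λ i → w (p i) (lab (Fin.suc i))) *
      f ((lab Fin.zero , b) ∷ tabulate (λ i → lab (Fin.suc i) , p i))))
      ≡⟨ ∑-cong (allFin n) (λ b → trans (∑-cong (funs (allFin n) k) (λ p → *-assoc (w b (lab Fin.zero)) _ _))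
           (trans (∑-* (w b (lab Fin.zero)) (funs (allFin n) k) _)
             (cong (w b (lab Fin.zero) *_) (sym (Lab-funs k (λ i → lab (Fin.suc i)) (λ K → f ((lab Fin.zero , b) ∷ K))))))) ⟩
    Lab (tabulate lab) f ∎)

-- By multilinearity each choice of parents contributes the weights of its edges times the tree
-- weight of the 0/1 matrix of that choice, which is `Φ p`.
tree-parentMaps : ∀ {n′} (w : Fin (suc n′) → Fin (suc n′) → ℕ) →
  Forest.tree w Fin.zero (tabulate Fin.suc) ≡
  ∑ (funs (allFin (suc n′)) n′) (λ p → ∏ᶠ n′ (λ v → w (p v) (Fin.suc v)) * ParentMap.Φ p)
tree-parentMaps {n′} w = begin
  Forest.tree w Fin.zero (tabulate Fin.suc)
    ≡⟨ M.tree-Lab Fin.zero Fin.zero (tabulate Fin.suc) ⟨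
  M.Lab (tabulate Fin.suc) (Forest.tree M.wY (Fin.zero , Fin.zero))
    ≡⟨ M.Lab-funs n′ Fin.suc _ ⟩
  ∑ (funs (allFin (suc n′)) n′) (λ p → ∏ᶠ n′ (λ v → w (p v) (Fin.suc v)) * Forest.tree M.wY (Fin.zero , Fin.zero) (tabulate (λ v → Fin.suc v , p v)))
    ≡⟨ ∑-cong (funs (allFin (suc n′)) n′) (λ p → cong (∏ᶠ n′ (λ v → w (p v) (Fin.suc v)) *_) (sym (toΦ p))) ⟩
  ∑ (funs (allFin (suc n′)) n′) (λ p → ∏ᶠ n′ (λ v → w (p v) (Fin.suc v)) * ParentMap.Φ p) ∎
  where
  module M where
    open Multilinear w public
    open Labelling {Fin (suc n′)} {Fin (suc n′)} ∫ (λ _ → ⊤) ∫-congᴼ ∫-+ ∫-* ∫-swap public using (Lab)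
  toΦ : ∀ p → ParentMap.Φ p ≡ Forest.tree M.wY (Fin.zero , Fin.zero) (tabulate (λ v → Fin.suc v , p v))
  toΦ p = trans (tree-map wp M.wY (λ v → v , parent v) (λ _ → ⊤) (λ _ _ → refl) Fin.zero others tt (All.universal (λ _ → tt) others))
    (cong (Forest.tree M.wY (Fin.zero , Fin.zero)) (map-tabulate Fin.suc (λ v → v , parent v)))
    where open ParentMap p

-- Trees as graphs

∧-true : ∀ {a b} → a ∧ b ≡ true → a ≡ true × b ≡ true
∧-true {true} {true} _ = refl , refl

∨-true : ∀ {a b} → a ∨ b ≡ true → a ≡ true ⊎ b ≡ true
∨-true {true}  _ = inj₁ refl
∨-true {false} e = inj₂ e

∨-introˡ : ∀ {a b} → a ≡ true → a ∨ b ≡ true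
∨-introˡ refl = refl

∨-introʳ : ∀ {a b} → b ≡ true → a ∨ b ≡ true
∨-introʳ {a} refl = ∨-zeroʳ a

not-true : ∀ {a} → not a ≡ true → a ≡ true → ⊥
not-true {true} () _

⇔ᵇ-true : ∀ {a b} → (a ⇔ᵇ b) ≡ true → a ≡ b
⇔ᵇ-true {true}  {true}  _ = refl
⇔ᵇ-true {false} {false} _ = refl

⇒ᵇ-intro : ∀ {a b} → (a ≡ true → b ≡ true) → (a ⇒ᵇ b) ≡ true
⇒ᵇ-intro {true}  h = h refl
⇒ᵇ-intro {false} h = refl

⇒ᵇ-elim : ∀ {a b} → (a ⇒ᵇ b) ≡ true → a ≡ true → b ≡ true
⇒ᵇ-elim e refl = e

all-intro : ∀ n {p : Fin n → Bool} → (∀ i → p i ≡ true) → allFin? n p ≡ true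
all-intro n {p} h = go (allFin n)
  where
  go : ∀ xs → all p xs ≡ true
  go []       = refl
  go (x ∷ xs) = cong₂ _∧_ (h x) (go xs)

all-elim : ∀ n {p : Fin n → Bool} → allFin? n p ≡ true → ∀ i → p i ≡ true
all-elim n {p} e i = go (allFin n) e (∈-allFin i)
  where
  go : ∀ xs → all p xs ≡ true → i ∈ xs → p i ≡ true
  go (x ∷ xs) e (here refl) = proj₁ (∧-true e)
  go (x ∷ xs) e (there i∈)  = go xs (proj₂ (∧-true {p x} e)) i∈

any-introᴸ : ∀ {p : A → Bool} {x xs} → x ∈ xs → p x ≡ true → any p xs ≡ true
any-introᴸ (here refl) e = ∨-introˡ e
any-introᴸ (there x∈)  e = ∨-introʳ (any-introᴸ x∈ e)

any-elimᴸ : ∀ {p : A → Bool} xs → any p xs ≡ true → ∃ λ x → x ∈ xs × p x ≡ true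
any-elimᴸ {p = p} (x ∷ xs) e with ∨-true {p x} e
... | inj₁ e′ = x , here refl , e′
... | inj₂ e′ = let y , y∈ , e″ = any-elimᴸ xs e′ in y , there y∈ , e″

any-intro : ∀ n {p : Fin n → Bool} i → p i ≡ true → anyFin n p ≡ true
any-intro n i = any-introᴸ (∈-allFin i)

any-elim : ∀ n {p : Fin n → Bool} → anyFin n p ≡ true → ∃ λ i → p i ≡ true
any-elim n e = let i , _ , e′ = any-elimᴸ (allFin n) e in i , e′

funs-complete : ∀ (xs : List A) → (∀ x → x ∈ xs) → ∀ k (s : Fin k → A) → ∃ λ s′ → s′ ∈ funs xs k × s′ ≗ s
funs-complete xs every zero    s = _ , here refl , λ ()
funs-complete xs every (suc k) s = let s′ , s′∈ , e = funs-complete xs every k (λ i → s (Fin.suc i)) in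
  _ , ∈-concatMap⁺ _ {xs = xs} (Any.map (λ { refl → ∈-map⁺ _ s′∈ }) (every (s Fin.zero))) ,
  λ { Fin.zero → refl ; (Fin.suc i) → e i }

-- Paths and cycles

module Paths {n : ℕ} (E : Fin n → Fin n → Set) where

  data Path : Fin n → List (Fin n) → Fin n → Set where
    []  : ∀ {u} → Path u [] u
    _∷_ : ∀ {u x xs v} → E u x → Path x xs v → Path u (x ∷ xs) v

  _++ᵖ_ : ∀ {u v z xs ys} → Path u xs v → Path v ys z → Path u (xs ++ ys) z
  []      ++ᵖ q = q
  (e ∷ p) ++ᵖ q = e ∷ (p ++ᵖ q)

  Simple : Fin n → Fin n → Set
  Simple u v = ∃ λ xs → Path u xs v × AllPairs _≢_ (u ∷ xs)

  suffix : ∀ {u x xs v} → u ∈ x ∷ xs → Path x xs v → AllPairs _≢_ (x ∷ xs) → Simple u v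
  suffix (here refl) p       d       = _ , p , d
  suffix (there u∈)  (e ∷ p) (_ ∷ d) = suffix u∈ p d

  simple : ∀ {u xs v} → Path u xs v → Simple u v
  simple [] = [] , [] , ([] ∷ [])
  simple {u} (_∷_ {x = x} e p) with simple p
  ... | ys , q , d with Any.any? (u Fin.≟_) (x ∷ ys)
  ...   | yes u∈ = suffix u∈ q d
  ...   | no  u∉ = x ∷ ys , e ∷ q , (All.¬Any⇒All¬ _ u∉ ∷ d)

  lookup-edge : ∀ {u xs v} → Path u xs v → ∀ i → E (lookup (u ∷ xs) (Fin.inject₁ i)) (lookup (u ∷ xs) (Fin.suc i))
  lookup-edge (e ∷ p) Fin.zero    = e
  lookup-edge (e ∷ p) (Fin.suc i) = lookup-edge p i

  lookup-last : ∀ {u xs v} → Path u xs v → lookup (u ∷ xs) (Fin.fromℕ (length xs)) ≡ v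
  lookup-last []      = refl
  lookup-last (e ∷ p) = lookup-last p

lookup-injective : ∀ {xs : List A} → AllPairs _≢_ xs → ∀ i j → lookup xs i ≡ lookup xs j → i ≡ j
lookup-injective (_ ∷ _) Fin.zero    Fin.zero    _ = refl
lookup-injective (u ∷ _) Fin.zero    (Fin.suc j) e = contradiction e (All.lookup u (∈-lookup j))
lookup-injective (u ∷ _) (Fin.suc i) Fin.zero    e = contradiction (sym e) (All.lookup u (∈-lookup i))
lookup-injective (_ ∷ d) (Fin.suc i) (Fin.suc j) e = cong Fin.suc (lookup-injective d i j e)

distinct-length : ∀ {n} {xs : List (Fin n)} → AllPairs _≢_ xs → length xs ≤ n
distinct-length d = Fin.injective⇒≤ (λ {i} {j} → lookup-injective d i j)

module GraphPaths {n : ℕ} (g : Graph n) where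
  open Paths (λ u v → g u v ≡ true) public

  reach-refl : ∀ k i → reach g k i i ≡ true
  reach-refl zero    i = ≡ᵇ-refl i
  reach-refl (suc k) i = ∨-introˡ (reach-refl k i)

  -- `reach` extends a walk at its far end, whereas paths grow at the near end.
  reach-cons : ∀ k {i l j} → g i l ≡ true → reach g k l j ≡ true → reach g (suc k) i j ≡ true
  reach-cons zero    {i} {l} {j} e r with refl ← ≡ᵇ⇒≡ᶠ {i = l} {j} r = ∨-introʳ {i ≡ᵇ j}
    (any-intro n i (trans (cong (_∧ g i j) (≡ᵇ-refl i)) e))
  reach-cons (suc k) {i} {l} {j} e r with ∨-true {reach g k l j} r
  ... | inj₁ r′ = ∨-introˡ (reach-cons k e r′)
  ... | inj₂ r′ with any-elim n r′
  ...   | x , r″ = let a , b = ∧-true {reach g k l x} r″ in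
    ∨-introʳ {reach g (suc k) i j} (any-intro n x (cong₂ _∧_ (reach-cons k e a) b))

  path⇒reach : ∀ {k i xs j} → Path i xs j → length xs ≤ k → reach g k i j ≡ true
  path⇒reach {k}     []      _        = reach-refl k _
  path⇒reach {suc k} (e ∷ p) (s≤s l)  = reach-cons k e (path⇒reach p l)

  -- A simple path visits at most `n` vertices, so the `n` steps examined by `isConnected` suffice.
  simple⇒reach : ∀ {i j} → Simple i j → reach g n i j ≡ true
  simple⇒reach (xs , p , d) = path⇒reach p (≤-trans (n≤1+n _) (distinct-length d))

  reach-mono : ∀ {k l i j} → k ≤ l → reach g k i j ≡ true → reach g l i j ≡ true
  reach-mono {l = zero}  z≤n r = r
  reach-mono {l = suc l} {i} {j} k≤l r with m≤n⇒m<n∨m≡n k≤l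
  ... | inj₁ (s≤s k≤l′) = ∨-introˡ (reach-mono k≤l′ r)
  ... | inj₂ refl       = r

cycle-edges : ∀ {n} (g : Graph n) k (s : Fin (suc k) → Fin n) → isCycle g k s ≡ true →
  (∀ i j → s i ≡ s j → i ≡ j) × (∀ i → g (s (Fin.inject₁ i)) (s (Fin.suc i)) ≡ true) × g (s (Fin.fromℕ k)) (s Fin.zero) ≡ true
cycle-edges g k s e = let a , bc = ∧-true {injectiveᵇ s} e ; b , c = ∧-true {allFin? k _} bc in
  (λ i j q → ≡ᵇ⇒≡ᶠ (⇒ᵇ-elim (all-elim (suc k) (all-elim (suc k) a i) j) (trans (cong (_≡ᵇ s j) q) (≡ᵇ-refl (s j))))) ,
  all-elim k b , c

isCycle-intro : ∀ {n} (g : Graph n) k (s : Fin (suc k) → Fin n) →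
  (∀ i j → s i ≡ s j → i ≡ j) → (∀ i → g (s (Fin.inject₁ i)) (s (Fin.suc i)) ≡ true) → g (s (Fin.fromℕ k)) (s Fin.zero) ≡ true →
  isCycle g k s ≡ true
isCycle-intro g k s a b c = cong₂ _∧_
  (all-intro (suc k) (λ i → all-intro (suc k) (λ j → ⇒ᵇ-intro (λ e → trans (cong (_≡ᵇ j) (a i j (≡ᵇ⇒≡ᶠ e))) (≡ᵇ-refl j)))))
  (cong₂ _∧_ (all-intro k b) c)

-- The enumeration contains `s` up to pointwise equality, so the conditions are transferred to the
-- listed copy `s′`.
hasCycle-intro : ∀ {n} (g : Graph n) j → j < n → (s : Fin (3 + j) → Fin n) → isCycle g (2 + j) s ≡ true → hasCycle g ≡ true
hasCycle-intro {n} g j j<n s e with funs-complete (allFin n) ∈-allFin (3 + j) s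
... | s′ , s′∈ , q = let a , b , c = cycle-edges g (2 + j) s e in
  any-introᴸ (∈-applyUpTo⁺ (2 +_) j<n) (any-introᴸ s′∈ (isCycle-intro g (2 + j) s′
    (λ i j r → a i j (trans (sym (q i)) (trans r (q j))))
    (λ i → trans (cong₂ g (q (Fin.inject₁ i)) (q (Fin.suc i))) (b i))
    (trans (cong₂ g (q (Fin.fromℕ (2 + j))) (q Fin.zero)) c)))

hasCycle-elim : ∀ {n} (g : Graph n) → hasCycle g ≡ true → ∃ λ j → ∃ λ s → isCycle g (2 + j) s ≡ true
hasCycle-elim {n} g e with any-elimᴸ (applyUpTo (2 +_) n) e
... | k , k∈ , e′ with ∈-applyUpTo⁻ (2 +_) k∈
...   | j , _ , refl with any-elimᴸ (funs (allFin n) (3 + j)) e′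
...     | s , _ , e″ = j , s , e″

argmax : ∀ k (f : Fin (suc k) → ℕ) → ∃ λ i → ∀ j → f j ≤ f i
argmax zero    f = Fin.zero , λ { Fin.zero → ≤-refl }
argmax (suc k) f with argmax k (λ i → f (Fin.suc i))
... | i , max with ≤-total (f (Fin.suc i)) (f Fin.zero)
...   | inj₁ le = Fin.zero , λ { Fin.zero → ≤-refl ; (Fin.suc j) → ≤-trans (max j) le }
...   | inj₂ le = Fin.suc i , λ { Fin.zero → le ; (Fin.suc j) → max j }

-- The graph of a parent map

module Tree {n′ : ℕ} (p : Fin n′ → Fin (suc n′)) where
  open ParentMap p

  isParent : Fin n → Fin n → Bool
  isParent Fin.zero    u = false
  isParent (Fin.suc v) u = p v ≡ᵇ u

  graphOf : Graph n
  graphOf u v = isParent u v ∨ isParent v u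

  parent-edge : ∀ v → graphOf (Fin.suc v) (p v) ≡ true
  parent-edge v = ∨-introˡ (≡ᵇ-refl (p v))

  isParent⇒≡ : ∀ {u v} → isParent u v ≡ true → parent u ≡ v
  isParent⇒≡ {Fin.suc u} e = ≡ᵇ⇒≡ᶠ e

  module _ (rooted : ∀ v → Rooted v) where
    depth : ∀ {v} → Rooted v → ℕ
    depth root     = 0
    depth (step r) = suc (depth r)

    depth-unique : ∀ {v} (r s : Rooted v) → depth r ≡ depth s
    depth-unique root     root     = refl
    depth-unique (step r) (step s) = cong suc (depth-unique r s)

    D : Fin n → ℕ
    D v = depth (rooted v)

    D-parent : ∀ {u v} → isParent u v ≡ true → D u ≡ suc (D v)
    D-parent {Fin.suc u} e with refl ← ≡ᵇ⇒≡ᶠ {i = p u} e = depth-unique (rooted (Fin.suc u)) (step (rooted (p u)))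

    -- A neighbour that is not deeper must be the parent, so the deepest vertex of a cycle has only one neighbour on it.
    shallow-neighbour : ∀ {u v} → graphOf u v ≡ true → D v ≤ D u → parent u ≡ v
    shallow-neighbour {u} {v} e Dv≤Du with ∨-true {isParent u v} e
    ... | inj₁ e′ = isParent⇒≡ {u} e′
    ... | inj₂ e′ = contradiction (≤-trans (≤-reflexive (sym (D-parent e′))) Dv≤Du) 1+n≰n

    module _ (g : Graph n) (g≡ : ∀ u v → g u v ≡ graphOf u v) where
      graphOf-sym : ∀ {u v} → g u v ≡ true → graphOf v u ≡ true
      graphOf-sym {u} {v} e with ∨-true {isParent u v} (trans (sym (g≡ u v)) e)
      ... | inj₁ a = ∨-introʳ {isParent v u} a
      ... | inj₂ a = ∨-introˡ a

      noCycle : ∀ j (s : Fin (3 + j) → Fin n) → isCycle g (2 + j) s ≡ true → ⊥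
      noCycle j s e with cycle-edges g (2 + j) s e | argmax (2 + j) (λ i → D (s i))
      ... | inj , edge , close | i , max = at i max
        where
        next : ∀ i → graphOf (s (Fin.inject₁ i)) (s (Fin.suc i)) ≡ true
        next i = trans (sym (g≡ _ _)) (edge i)
        two : ∀ {i a b} → (∀ j → D (s j) ≤ D (s i)) → graphOf (s i) (s a) ≡ true → graphOf (s i) (s b) ≡ true → a ≡ b
        two {i} {a} {b} max e e′ = inj a b (trans (sym (shallow-neighbour e (max a))) (shallow-neighbour e′ (max b)))
        -- The two cyclic neighbours of position `i`, with wrap-around at both ends, have different
        -- positions because the cycle has at least three vertices.
        at : ∀ i → (∀ j → D (s j) ≤ D (s i)) → ⊥
        at Fin.zero max with two max (graphOf-sym close) (next Fin.zero)
        ... | ()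
        at (Fin.suc i) max with view i
        ... | ‵fromℕ with two max (graphOf-sym (edge (Fin.fromℕ (suc j)))) (trans (sym (g≡ _ _)) close)
        ...   | ()
        at (Fin.suc .(Fin.inject₁ i)) max | ‵inject₁ i with two max (graphOf-sym (edge (Fin.inject₁ i))) (next (Fin.suc i))
        ...   | q = contradiction (cong toℕ q) (λ e → <⇒≢ (≤-trans (s≤s (≤-reflexive (trans (Fin.toℕ-inject₁ (Fin.inject₁ i)) (Fin.toℕ-inject₁ i)))) (n≤1+n _)) e)

      open GraphPaths g

      step-edge : ∀ v → g (Fin.suc v) (p v) ≡ true
      step-edge v = trans (g≡ _ _) (parent-edge v)

      toRoot : ∀ {v} → Rooted v → ∃ λ xs → Path v xs Fin.zero
      toRoot root         = [] , []
      toRoot (step {v} r) = let xs , q = toRoot r in p v ∷ xs , step-edge v ∷ q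

      fromRoot : ∀ {v} → Rooted v → ∃ λ xs → Path Fin.zero xs v
      fromRoot root         = [] , []
      fromRoot (step {v} r) = let xs , q = fromRoot r in _ , q ++ᵖ (trans (g≡ _ _) (graphOf-sym (step-edge v)) ∷ [])

      connect : ∀ u v → Simple u v
      connect u v = simple (proj₂ (toRoot (rooted u)) ++ᵖ proj₂ (fromRoot (rooted v)))

      noLoop : ∀ u → graphOf u u ≡ true → ⊥
      noLoop u e with ∨-true {isParent u u} e
      ... | inj₁ a = 1+n≢n (sym (D-parent {u} {u} a))
      ... | inj₂ a = 1+n≢n (sym (D-parent {u} {u} a))

      ⇔-intro : ∀ {a b} → (a ≡ true → b ≡ true) → (b ≡ true → a ≡ true) → (a ⇔ᵇ b) ≡ true
      ⇔-intro {true}          f h = f refl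
      ⇔-intro {false} {true}  f h with () ← h refl
      ⇔-intro {false} {false} f h = refl

      not-intro : ∀ {a} → (a ≡ true → ⊥) → not a ≡ true
      not-intro {true}  h = contradiction refl h
      not-intro {false} h = refl

      isTree-intro : isTree g ≡ true
      isTree-intro = cong₂ _∧_
        (all-intro n (λ i → all-intro n (λ j → cong₂ _∧_
          (⇔-intro {g i j} (λ e → trans (g≡ j i) (graphOf-sym e)) (λ e → trans (g≡ i j) (graphOf-sym e)))
          (not-intro (λ e → noLoop i (trans (sym (g≡ i i)) e))))))
        (cong₂ _∧_ (all-intro n (λ i → all-intro n (λ j → simple⇒reach (connect i j))))
          (not-intro (λ e → let j , s , e′ = hasCycle-elim g e in noCycle j s e′)))

-- Induction along the way to the root. If the edge from `suc v` to `p v` were oriented the other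
-- way in `q`, then by induction `suc v` would also be the parent of `p v` under `p`, and depths
-- would increase around a 2-cycle.
parent-unique : ∀ {n′} (p q : Fin n′ → Fin (suc n′)) → (∀ v → ParentMap.Rooted p v) →
  (∀ u v → Tree.graphOf p u v ≡ Tree.graphOf q u v) → p ≗ q
parent-unique p q rooted same v = go (rooted (Fin.suc v))
  where
  module P = Tree p
  module Q = Tree q
  open ParentMap p using (Rooted; root; step)
  p≡ : ∀ v x → p v ≡ x → P.isParent (Fin.suc v) x ≡ true
  p≡ v x refl = ≡ᵇ-refl x
  go : ∀ {v} → Rooted (Fin.suc v) → p v ≡ q v
  back : ∀ v x → p v ≡ x → Rooted x → Q.isParent x (Fin.suc v) ≡ true → p v ≡ q v
  go {v} (step r) with ∨-true {Q.isParent (Fin.suc v) (p v)} (trans (sym (same (Fin.suc v) (p v))) (P.parent-edge v))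
  ... | inj₁ e = sym (≡ᵇ⇒≡ᶠ e)
  ... | inj₂ e = back v (p v) refl r e
  back v (Fin.suc u) pv r e = contradiction
    (trans (P.D-parent rooted {Fin.suc v} {Fin.suc u} (p≡ v (Fin.suc u) pv)) (cong suc (P.D-parent rooted {Fin.suc u} {Fin.suc v} (p≡ u (Fin.suc v) (trans (go r) (≡ᵇ⇒≡ᶠ e))))))
    (λ d → 1+n≰n (≤-trans (n≤1+n (suc (P.D rooted (Fin.suc v)))) (≤-reflexive (sym d))))

-- The parent map of a tree

least : ∀ (P : ℕ → Bool) k → P k ≡ true → ∃ λ j → j ≤ k × P j ≡ true × (∀ i → i < j → P i ≡ false)
least P zero    e = zero , z≤n , e , λ i ()
least P (suc k) e with P zero in e₀
... | true  = zero , z≤n , e₀ , λ i ()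
... | false = let j , j≤k , e₁ , h = least (λ i → P (suc i)) k e in
  suc j , s≤s j≤k , e₁ , λ { zero _ → e₀ ; (suc i) (s≤s i<j) → h i i<j }

module FromTree {n′ : ℕ} (g : Graph (suc n′)) (isTree-g : isTree g ≡ true) where
  n = suc n′
  open GraphPaths g

  simple-g : ∀ i j → (g i j ⇔ᵇ g j i) ∧ not (g i i) ≡ true
  simple-g i = all-elim n (all-elim n (proj₁ (∧-true {isSimple g} isTree-g)) i)

  g-sym : ∀ i j → g i j ≡ g j i
  g-sym i j = ⇔ᵇ-true (proj₁ (∧-true (simple-g i j)))

  g-irrefl : ∀ i → g i i ≡ true → ⊥
  g-irrefl i = not-true (proj₂ (∧-true {g i i ⇔ᵇ g i i} (simple-g i i)))

  connected : ∀ i j → reach g n i j ≡ true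
  connected i = all-elim n (all-elim n (proj₁ (∧-true {isConnected g} (proj₂ (∧-true {isSimple g} isTree-g)))) i)

  acyclic : hasCycle g ≡ true → ⊥
  acyclic = not-true (proj₂ (∧-true {isConnected g} (proj₂ (∧-true {isSimple g} isTree-g))))

  -- A neighbour preceding `suc v` on a shortest walk from 0. The strict bound makes the number of
  -- steps drop along `p`, which drives the induction in `rooted-within`.
  Closer : Fin n′ → Set
  Closer v = ∃ λ u → g u (Fin.suc v) ≡ true × ∃ λ k → reach g k Fin.zero u ≡ true ×
    (∀ j → reach g j Fin.zero (Fin.suc v) ≡ true → k < j)

  abstract
   closer : ∀ v → Closer v
   closer v with least (λ k → reach g k Fin.zero (Fin.suc v)) n (connected Fin.zero (Fin.suc v))
   ... | suc k , _ , r , min with ∨-true {reach g k Fin.zero (Fin.suc v)} r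
   ...   | inj₁ r′ with () ← trans (sym r′) (min k ≤-refl)
   ...   | inj₂ r′ with any-elim n r′
   ...     | u , e = u , proj₂ (∧-true {reach g k Fin.zero u} e) , k , proj₁ (∧-true e) , λ j rj → minimal j rj
     where
     minimal : ∀ j → reach g j Fin.zero (Fin.suc v) ≡ true → k < j
     minimal j rj with ≤-<-connex j k
     ... | inj₂ k<j = k<j
     ... | inj₁ j≤k with () ← trans (sym rj) (min j (s≤s j≤k))

  p : Fin n′ → Fin n
  p v = proj₁ (closer v)

  open ParentMap p using (Rooted; root; step)
  open Tree p using (graphOf; isParent)

  rooted-within : ∀ k v → reach g k Fin.zero v ≡ true → Rooted v
  rooted-within k       Fin.zero    r = root
  rooted-within zero    (Fin.suc v) r with () ← r
  rooted-within (suc k) (Fin.suc v) r = let _ , _ , l , rl , min = closer v in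
    step (rooted-within k (p v) (reach-mono (s≤s⁻¹ (min (suc k) r)) rl))

  rooted : ∀ v → Rooted v
  rooted v = rooted-within n v (connected Fin.zero v)

  graphOf⊆g : ∀ u v → graphOf u v ≡ true → g u v ≡ true
  graphOf⊆g u v e with ∨-true {isParent u v} e
  ... | inj₁ a = up u v a
    where
    up : ∀ u v → isParent u v ≡ true → g u v ≡ true
    up (Fin.suc u) v a with refl ← ≡ᵇ⇒≡ᶠ {i = p u} a = trans (g-sym _ _) (proj₁ (proj₂ (closer u)))
  ... | inj₂ a = up v u a
    where
    up : ∀ v u → isParent v u ≡ true → g u v ≡ true
    up (Fin.suc v) u a with refl ← ≡ᵇ⇒≡ᶠ {i = p v} a = proj₁ (proj₂ (closer v))

  -- An edge of `g` missing from the graph of `p` would close a simple path of that graph to a cycle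
  -- in `g`.
  graph-edge : ∀ u v → g u v ≡ true → graphOf u v ≡ true
  graph-edge u v e with Tree.connect p rooted graphOf (λ _ _ → refl) u v
  ... | [] , [] , _ = contradiction e (g-irrefl u)
  ... | x ∷ [] , (e′ ∷ []) , _ = e′
  ... | x ∷ y ∷ xs , path , d = contradiction (hasCycle-intro g (length xs) (≤-trans (n≤1+n _) (≤-trans (n≤1+n _) (distinct-length d)))
      (lookup (u ∷ x ∷ y ∷ xs)) (isCycle-intro g (2 + length xs) (lookup (u ∷ x ∷ y ∷ xs)) (lookup-injective d)
        (λ i → graphOf⊆g _ _ (P.lookup-edge path i))
        (trans (cong (λ z → g z u) (P.lookup-last path)) (trans (g-sym v u) e)))) acyclic
    where module P = GraphPaths graphOf

  g≡graphOf : ∀ u v → g u v ≡ graphOf u v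
  g≡graphOf u v with g u v in e | graphOf u v in e′
  ... | true  | true  = refl
  ... | false | false = refl
  ... | true  | false = trans (sym (graph-edge u v e)) e′
  ... | false | true  = trans (sym e) (graphOf⊆g u v e′)

-- Counting tiered trees

-- With `e` an indicator of equality, this says that the enumeration of functions contains each one
-- exactly once up to pointwise equality.
∑-funs-match : ∀ (xs : List A) (e : A → A → ℕ) → (∀ y → ∑ xs (λ x → e x y) ≡ 1) → ∀ k (h : Fin k → A) →
  ∑ (funs xs k) (λ f → ∏ᶠ k (λ i → e (f i) (h i))) ≡ 1
∑-funs-match xs e e-sum zero    h = refl
∑-funs-match xs e e-sum (suc k) h = begin
  ∑ (funs xs (suc k)) (λ f → ∏ᶠ (suc k) (λ i → e (f i) (h i)))
    ≡⟨ ∑-funs-suc xs k _ (λ q → ∏ᶠ-cong (suc k) (λ i → cong (λ x → e x (h i)) (q i))) ⟩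
  ∑ xs (λ x → ∑ (funs xs k) (λ f → e x (h Fin.zero) * ∏ᶠ k (λ i → e (f i) (h (Fin.suc i)))))
    ≡⟨ ∑-cong xs (λ x → trans (∑-* (e x (h Fin.zero)) (funs xs k) _)
         (trans (cong (e x (h Fin.zero) *_) (∑-funs-match xs e e-sum k (λ i → h (Fin.suc i)))) (*-identityʳ _))) ⟩
  ∑ xs (λ x → e x (h Fin.zero))
    ≡⟨ e-sum (h Fin.zero) ⟩
  1 ∎

eqᴮ : Bool → Bool → ℕ
eqᴮ a b = [ a ⇔ᵇ b ]

eqᴳ : ∀ {n} → Graph n → Graph n → ℕ
eqᴳ {n} g h = ∏ᶠ n (λ i → ∏ᶠ n (λ j → eqᴮ (g i j) (h i j)))

eqᴾ : ∀ {k n} → (Fin k → Fin n) → (Fin k → Fin n) → ℕ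
eqᴾ {k} p q = ∏ᶠ k (λ i → eq (p i) (q i))

∑-eqᴳ : ∀ n (h : Graph n) → ∑ (allGraphs n) (λ g → eqᴳ g h) ≡ 1
∑-eqᴳ n h = ∑-funs-match _ (λ r s → ∏ᶠ n (λ j → eqᴮ (r j) (s j)))
  (∑-funs-match _ eqᴮ (λ { true → refl ; false → refl }) n) n h

∑-eqᴾ : ∀ k n (q : Fin k → Fin n) → ∑ (funs (allFin n) k) (λ p → eqᴾ p q) ≡ 1
∑-eqᴾ k n = ∑-funs-match (allFin n) eq
  (λ y → trans (∑-cong (allFin n) (λ b → sym (*-identityˡ (eq b y)))) (∑-eq-* n y (λ _ → 1))) k

eqᴳ∈01 : ∀ {n} (g h : Graph n) → eqᴳ g h ≡ 0 ⊎ (∀ u v → g u v ≡ h u v)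
eqᴳ∈01 {n} g h = ∏ᶠ∈01 n _ (λ i → ∏ᶠ∈01 n _ (λ j → dec (g i j) (h i j)))
  where
  dec : ∀ a b → eqᴮ a b ≡ 0 ⊎ a ≡ b
  dec true  true  = inj₂ refl
  dec true  false = inj₁ refl
  dec false true  = inj₁ refl
  dec false false = inj₂ refl

eqᴳ≡1 : ∀ {n} (g h : Graph n) → (∀ u v → g u v ≡ h u v) → eqᴳ g h ≡ 1
eqᴳ≡1 {n} g h e = ∏ᶠ≡1 n (λ i → ∏ᶠ≡1 n (λ j → trans (cong (λ a → eqᴮ a (h i j)) (e i j)) (eqᴮ-refl (h i j))))
  where
  eqᴮ-refl : ∀ b → eqᴮ b b ≡ 1
  eqᴮ-refl true  = refl
  eqᴮ-refl false = refl

isParent-cong : ∀ {n′} {p q : Fin n′ → Fin (suc n′)} → p ≗ q → ∀ u v → Tree.isParent p u v ≡ Tree.isParent q u v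
isParent-cong e Fin.zero    v = refl
isParent-cong e (Fin.suc u) v = cong (_≡ᵇ v) (e u)

graphOf-cong : ∀ {n′} {p q : Fin n′ → Fin (suc n′)} → p ≗ q → ∀ u v → Tree.graphOf p u v ≡ Tree.graphOf q u v
graphOf-cong {p = p} {q} e u v = cong₂ _∨_ (isParent-cong {p = p} {q} e u v) (isParent-cong {p = p} {q} e v u)

Rooted-cong : ∀ {n′} {p q : Fin n′ → Fin (suc n′)} → p ≗ q → ∀ {v} → ParentMap.Rooted p v → ParentMap.Rooted q v
Rooted-cong e ParentMap.root     = ParentMap.root
Rooted-cong {q = q} e (ParentMap.step {v} r) = ParentMap.step (subst (ParentMap.Rooted q) (e v) (Rooted-cong e r))

Φ∈01 : ∀ {n′} (p : Fin n′ → Fin (suc n′)) → ParentMap.Φ p ≡ 0 ⊎ (∀ v → ParentMap.Rooted p v)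
Φ∈01 p with ParentMap.Φ p Data.Nat.≟ 0
... | yes e = inj₁ e
... | no ≢0 = inj₂ (ParentMap.Φ≢0⇒rooted p ≢0)

-- For a tree only its parent map towards 0 contributes, and for other graphs none does. The tree
-- condition thereby becomes a sum that can be exchanged with the sum over graphs.
isTree-parentMaps : ∀ {n′} (g : Graph (suc n′)) →
  [ isTree g ] ≡ ∑ (funs (allFin (suc n′)) n′) (λ p → eqᴳ g (Tree.graphOf p) * ParentMap.Φ p)
isTree-parentMaps {n′} g with isTree g in tree?
... | true = sym (trans (∑-cong (funs (allFin (suc n′)) n′) term) (∑-eqᴾ n′ (suc n′) p₀))
  where
  open FromTree g tree? renaming (p to p₀; rooted to rooted₀)
  term : ∀ p → eqᴳ g (Tree.graphOf p) * ParentMap.Φ p ≡ eqᴾ p p₀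
  term p with ∏ᶠ∈01 n′ (λ i → eq (p i) (p₀ i)) (λ i → eq∈01 (p i) (p₀ i))
  ... | inj₂ p≗p₀ = trans (cong₂ _*_
      (eqᴳ≡1 g (Tree.graphOf p) (λ u v → trans (g≡graphOf u v) (graphOf-cong {p = p₀} {p} (λ i → sym (p≗p₀ i)) u v)))
      (ParentMap.rooted⇒Φ≡1 p (λ v → Rooted-cong (λ i → sym (p≗p₀ i)) (rooted₀ v))))
    (sym (∏ᶠ≡1 n′ (λ i → trans (cong (λ x → eq x (p₀ i)) (p≗p₀ i)) (eq-refl (p₀ i)))))
  ... | inj₁ eqᴾ≡0 with eqᴳ∈01 g (Tree.graphOf p) | Φ∈01 p
  ...   | inj₁ e | _      = trans (cong (_* ParentMap.Φ p) e) (sym eqᴾ≡0)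
  ...   | inj₂ _ | inj₁ e = trans (cong (eqᴳ g (Tree.graphOf p) *_) e) (trans (*-zeroʳ (eqᴳ g (Tree.graphOf p))) (sym eqᴾ≡0))
  ...   | inj₂ e | inj₂ r = contradiction
    (trans (sym eqᴾ≡0) (∏ᶠ≡1 n′ (λ i → trans (cong (λ x → eq x (p₀ i)) (parent-unique p p₀ r (λ u v → trans (sym (e u v)) (g≡graphOf u v)) i)) (eq-refl (p₀ i)))))
    λ ()
... | false = sym (trans (∑-cong (funs (allFin (suc n′)) n′) term) (∑-0 (funs (allFin (suc n′)) n′)))
  where
  term : ∀ p → eqᴳ g (Tree.graphOf p) * ParentMap.Φ p ≡ 0
  term p with eqᴳ∈01 g (Tree.graphOf p) | Φ∈01 p
  ... | inj₁ e | _      = cong (_* ParentMap.Φ p) e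
  ... | inj₂ _ | inj₁ e = trans (cong (eqᴳ g (Tree.graphOf p) *_) e) (*-zeroʳ (eqᴳ g (Tree.graphOf p)))
  ... | inj₂ e | inj₂ r = contradiction (trans (sym tree?) (Tree.isTree-intro p r g e)) λ ()

-- Tierings as products of edge weights

Comparable : Vertex → Vertex → Set
Comparable (l , c) (k , d) = (l < k × c < d) ⊎ (k < l × d < c)

w≡1 : ∀ u v → Comparable u v → w u v ≡ 1
w≡1 (l , c) (k , d) (inj₁ (l<k , c<d)) = trans (w-< c d l<k) (<⇒lt≡1 c<d)
w≡1 (l , c) (k , d) (inj₂ (k<l , d<c)) = trans (w-> c d k<l) (<⇒lt≡1 d<c)

w∈01 : ∀ u v → w u v ≡ 0 ⊎ Comparable u v
w∈01 (l , c) (k , d) with <-cmp l k | ≤-<-connex d c | ≤-<-connex c d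
... | tri< l<k _ _  | inj₁ d≤c | _        = inj₁ (trans (w-< c d l<k) (≤⇒lt≡0 d≤c))
... | tri< l<k _ _  | inj₂ c<d | _        = inj₂ (inj₁ (l<k , c<d))
... | tri≈ _ refl _ | _        | _        = inj₁ (w-≡ l c d)
... | tri> _ _ k<l  | _        | inj₁ c≤d = inj₁ (trans (w-> c d k<l) (≤⇒lt≡0 c≤d))
... | tri> _ _ k<l  | _        | inj₂ d<c = inj₂ (inj₂ (k<l , d<c))

<ᵇ-intro : ∀ {n} {i j : Fin n} → toℕ i < toℕ j → (i <ᵇ j) ≡ true
<ᵇ-intro {i = i} {j} i<j with i Fin.<? j
... | yes _  = refl
... | no i≮j = contradiction i<j i≮j

<ᵇ-elim : ∀ {n} {i j : Fin n} → (i <ᵇ j) ≡ true → toℕ i < toℕ j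
<ᵇ-elim {i = i} {j} e with i Fin.<? j
... | yes i<j = i<j

≢ᵇ-intro : ∀ {n} {i j : Fin n} → toℕ i ≢ toℕ j → not (i ≡ᵇ j) ≡ true
≢ᵇ-intro {i = i} {j} i≢j with i Fin.≟ j
... | yes refl = contradiction refl i≢j
... | no _     = refl

vertex : ∀ {n m} → (Fin n → Fin m) → Fin n → Vertex
vertex t v = toℕ v , toℕ (t v)

module _ {n″ m : ℕ} (g : Graph (2 + n″)) (t : Fin (2 + n″) → Fin m) (p : Fin (suc n″) → Fin (2 + n″))
  (g≡ : ∀ u v → g u v ≡ Tree.graphOf p u v) where
  open Tree p using (graphOf; isParent; parent-edge)
  private
    n = 2 + n″
    h = vertex t

  Comparable-sym : ∀ u v → Comparable u v → Comparable v u
  Comparable-sym u v (inj₁ x) = inj₂ x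
  Comparable-sym u v (inj₂ x) = inj₁ x

  Comparable⇒≢ : ∀ {u v} → Comparable (h u) (h v) → toℕ (t u) ≢ toℕ (t v)
  Comparable⇒≢ (inj₁ (_ , c<d)) e = <⇒≢ c<d e
  Comparable⇒≢ (inj₂ (_ , d<c)) e = <⇒≢ d<c (sym e)

  distinct increasing : Fin n → Fin n → Bool
  distinct   v v′ = g v v′ ⇒ᵇ not (t v ≡ᵇ t v′)
  increasing v v′ = (g v v′ ∧ (v′ <ᵇ v)) ⇒ᵇ (t v′ <ᵇ t v)

  isTiering-intro : (∀ v → Comparable (h (p v)) (h (Fin.suc v))) → isTiering g t ≡ true
  isTiering-intro c = cong₂ _∧_
    -- Two different tiers are found on the vertex `suc zero` and its parent.
    (any-intro n {λ i → anyFin n λ j → not (t i ≡ᵇ t j)} (p Fin.zero) (any-intro n {λ j → not (t (p Fin.zero) ≡ᵇ t j)} (Fin.suc Fin.zero)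
      (≢ᵇ-intro (Comparable⇒≢ {p Fin.zero} {Fin.suc Fin.zero} (c Fin.zero)))))
    (cong₂ _∧_
      (all-intro n {λ v → allFin? n (distinct v)} (λ v → all-intro n {distinct v} (λ v′ → ⇒ᵇ-intro {g v v′} (λ e →
        ≢ᵇ-intro (Comparable⇒≢ {v} {v′} (edge v v′ e))))))
      (all-intro n {λ v → allFin? n (increasing v)} (λ v → all-intro n {increasing v} (λ v′ → ⇒ᵇ-intro {g v v′ ∧ (v′ <ᵇ v)} (λ e →
        <ᵇ-intro (down v v′ (<ᵇ-elim (proj₂ (∧-true {g v v′} e))) (edge v v′ (proj₁ (∧-true {g v v′} e)))))))))
    where
    up : ∀ u v → isParent u v ≡ true → Comparable (h v) (h u)
    up (Fin.suc u) v e with refl ← ≡ᵇ⇒≡ᶠ {i = p u} e = c u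
    edge : ∀ u v → g u v ≡ true → Comparable (h u) (h v)
    edge u v e with ∨-true {isParent u v} (trans (sym (g≡ u v)) e)
    ... | inj₁ a = Comparable-sym (h v) (h u) (up u v a)
    ... | inj₂ a = up v u a
    down : ∀ v v′ → toℕ v′ < toℕ v → Comparable (h v) (h v′) → toℕ (t v′) < toℕ (t v)
    down v v′ v′<v (inj₁ (v<v′ , _)) = contradiction v<v′ (<⇒≯ v′<v)
    down v v′ v′<v (inj₂ (_ , lt))   = lt

  isTiering-elim : isTiering g t ≡ true → ∀ v → Comparable (h (p v)) (h (Fin.suc v))
  isTiering-elim e v = orient (<-cmp (toℕ (p v)) (toℕ (Fin.suc v)))
    where
    conditions = ∧-true {allFin? n (λ v → allFin? n (distinct v))}
      (proj₂ (∧-true {anyFin n λ i → anyFin n λ j → not (t i ≡ᵇ t j)} e))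
    differ : ∀ u v → g u v ≡ true → t u ≡ t v → ⊥
    differ u v a eq = not-true (⇒ᵇ-elim (all-elim n {distinct u} (all-elim n {λ v → allFin? n (distinct v)} (proj₁ conditions) u) v) a)
      (trans (cong (_≡ᵇ t v) eq) (≡ᵇ-refl (t v)))
    increase : ∀ u v → g u v ≡ true → toℕ v < toℕ u → toℕ (t v) < toℕ (t u)
    increase u v a v<u = <ᵇ-elim (⇒ᵇ-elim
      (all-elim n {increasing u} (all-elim n {λ v → allFin? n (increasing v)} (proj₂ conditions) u) v) (cong₂ _∧_ a (<ᵇ-intro v<u)))
    upward : g (Fin.suc v) (p v) ≡ true
    upward = trans (g≡ (Fin.suc v) (p v)) (parent-edge v)
    downward : g (p v) (Fin.suc v) ≡ true
    downward = trans (g≡ (p v) (Fin.suc v)) (∨-introʳ {isParent (p v) (Fin.suc v)} (≡ᵇ-refl (p v)))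
    orient : Tri (toℕ (p v) < toℕ (Fin.suc v)) (toℕ (p v) ≡ toℕ (Fin.suc v)) (toℕ (Fin.suc v) < toℕ (p v)) →
      Comparable (h (p v)) (h (Fin.suc v))
    orient (tri< lt _ _) = inj₁ (lt , increase (Fin.suc v) (p v) upward lt)
    orient (tri> _ _ gt) = inj₂ (gt , increase (p v) (Fin.suc v) downward gt)
    orient (tri≈ _ eq _) = contradiction (cong t (sym (Fin.toℕ-injective eq))) (differ (Fin.suc v) (p v) upward)

  -- Every edge joins a vertex to its parent, so the conditions on pairs of vertices reduce to one
  -- factor per vertex other than the root.
  isTiering-∏ : [ isTiering g t ] ≡ ∏ᶠ (suc n″) (λ v → w (h (p v)) (h (Fin.suc v)))
  isTiering-∏ with isTiering g t in tiering?
  ... | true  = sym (∏ᶠ≡1 (suc n″) (λ v → w≡1 (h (p v)) (h (Fin.suc v)) (isTiering-elim tiering? v)))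
  ... | false with ∏ᶠ∈01 (suc n″) (λ v → w (h (p v)) (h (Fin.suc v))) (λ v → w∈01 (h (p v)) (h (Fin.suc v)))
  ...   | inj₁ e = sym e
  ...   | inj₂ c = contradiction (trans (sym tiering?) (isTiering-intro c)) λ ()

count-∑ : ∀ (P : A → Bool) xs → count P xs ≡ ∑ xs (λ x → [ P x ])
count-∑ P []       = refl
count-∑ P (x ∷ xs) with P x
... | true  = cong suc (count-∑ P xs)
... | false = count-∑ P xs

-- With the sum over graphs innermost, `eqᴳ` selects the graph of `p`; the sum left over parent maps
-- is the expansion of a tree weight.
tieredCount-trees : ∀ n″ m → tieredCount (2 + n″) m ≡
  ∑ (funs (allFin m) (2 + n″)) (λ t → Forest.tree w (vertex t Fin.zero) (tabulate (λ v → vertex t (Fin.suc v))))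
tieredCount-trees n″ m = begin
  ∑ Gs (λ g → if isTree g then count (isTiering g) Ts else 0)
    ≡⟨ ∑-cong Gs (λ g → trans (if≡* (isTree g) _) (cong₂ _*_ (isTree-parentMaps g) (count-∑ (isTiering g) Ts))) ⟩
  ∑ Gs (λ g → ∑ Ps (λ p → eqᴳ g (Tree.graphOf p) * ParentMap.Φ p) * ∑ Ts (λ t → [ isTiering g t ]))
    ≡⟨ ∑-cong Gs (λ g → trans (sym (∑-* (∑ Ps (λ p → eqᴳ g (Tree.graphOf p) * ParentMap.Φ p)) Ts _)) (∑-cong Ts (λ t → sym (∑-*ʳ [ isTiering g t ] Ps _)))) ⟩
  ∑ Gs (λ g → ∑ Ts (λ t → ∑ Ps (λ p → eqᴳ g (Tree.graphOf p) * ParentMap.Φ p * [ isTiering g t ])))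
    ≡⟨ trans (∑-swap Gs Ts _) (∑-cong Ts (λ t → ∑-swap Gs Ps _)) ⟩
  ∑ Ts (λ t → ∑ Ps (λ p → ∑ Gs (λ g → eqᴳ g (Tree.graphOf p) * ParentMap.Φ p * [ isTiering g t ])))
    ≡⟨ ∑-cong Ts (λ t → ∑-cong Ps (λ p → graphs t p)) ⟩
  ∑ Ts (λ t → ∑ Ps (λ p → weightOf t p * ParentMap.Φ p))
    ≡⟨ ∑-cong Ts (λ t → sym (tree-parentMaps (λ u v → w (vertex t u) (vertex t v)))) ⟩
  ∑ Ts (λ t → Forest.tree (λ u v → w (vertex t u) (vertex t v)) Fin.zero (tabulate Fin.suc))
    ≡⟨ ∑-cong Ts (λ t → trans
         (tree-map _ w (vertex t) (λ _ → ⊤) (λ _ _ → refl) Fin.zero (tabulate Fin.suc) tt (All.universal (λ _ → tt) _))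
         (cong (Forest.tree w (vertex t Fin.zero)) (map-tabulate Fin.suc (vertex t)))) ⟩
  ∑ Ts (λ t → Forest.tree w (vertex t Fin.zero) (tabulate (λ v → vertex t (Fin.suc v)))) ∎
  where
  Gs = allGraphs (2 + n″)
  Ts = funs (allFin m) (2 + n″)
  Ps = funs (allFin (2 + n″)) (suc n″)
  weightOf : (Fin (2 + n″) → Fin m) → (Fin (suc n″) → Fin (2 + n″)) → ℕ
  weightOf t p = ∏ᶠ (suc n″) (λ v → w (vertex t (p v)) (vertex t (Fin.suc v)))
  if≡* : ∀ b k → (if b then k else 0) ≡ [ b ] * k
  if≡* true  k = sym (+-identityʳ k)
  if≡* false k = refl
  rearrange : ∀ e f x → e * f * x ≡ x * f * e
  rearrange = solve-∀
  graphs : ∀ t p → ∑ Gs (λ g → eqᴳ g (Tree.graphOf p) * ParentMap.Φ p * [ isTiering g t ]) ≡ weightOf t p * ParentMap.Φ p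
  graphs t p = begin
    ∑ Gs (λ g → eqᴳ g (Tree.graphOf p) * ParentMap.Φ p * [ isTiering g t ])
      ≡⟨ ∑-cong Gs (λ g → trans (term g) (rearrange (eqᴳ g (Tree.graphOf p)) (ParentMap.Φ p) (weightOf t p))) ⟩
    ∑ Gs (λ g → weightOf t p * ParentMap.Φ p * eqᴳ g (Tree.graphOf p))
      ≡⟨ ∑-* (weightOf t p * ParentMap.Φ p) Gs _ ⟩
    weightOf t p * ParentMap.Φ p * ∑ Gs (λ g → eqᴳ g (Tree.graphOf p))
      ≡⟨ trans (cong (weightOf t p * ParentMap.Φ p *_) (∑-eqᴳ (2 + n″) (Tree.graphOf p))) (*-identityʳ _) ⟩
    weightOf t p * ParentMap.Φ p ∎
    where
    term : ∀ g → eqᴳ g (Tree.graphOf p) * ParentMap.Φ p * [ isTiering g t ] ≡ eqᴳ g (Tree.graphOf p) * ParentMap.Φ p * weightOf t p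
    term g with eqᴳ∈01 g (Tree.graphOf p)
    ... | inj₁ e  = trans (cong (λ z → z * ParentMap.Φ p * [ isTiering g t ]) e) (sym (cong (λ z → z * ParentMap.Φ p * weightOf t p) e))
    ... | inj₂ g≡ = cong (eqᴳ g (Tree.graphOf p) * ParentMap.Φ p *_) (isTiering-∏ g t p g≡)

Lab-tiers : ∀ m k (lab : Fin k → ℕ) f → Tiers.Lab m (tabulate lab) f ≡
  ∑ (funs (allFin m) k) (λ t → f (tabulate (λ i → lab i , toℕ (t i))))
Lab-tiers m zero    lab f = sym (+-identityʳ _)
Lab-tiers m (suc k) lab f = sym (begin
  ∑ (funs (allFin m) (suc k)) (λ t → f (tabulate (λ i → lab i , toℕ (t i))))
    ≡⟨ ∑-funs-suc (allFin m) k _ (λ e → cong f (tabulate-cong (λ i → cong (λ c → lab i , toℕ c) (e i)))) ⟩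
  ∑ (allFin m) (λ c → ∑ (funs (allFin m) k) (λ t → f ((lab Fin.zero , toℕ c) ∷ tabulate (λ i → lab (Fin.suc i) , toℕ (t i)))))
    ≡⟨ ∑-cong (allFin m) (λ c → Lab-tiers m k (λ i → lab (Fin.suc i)) (λ K → f ((lab Fin.zero , toℕ c) ∷ K))) ⟨
  ∑ (allFin m) (λ c → Tiers.Lab m (tabulate (λ i → lab (Fin.suc i))) (λ K → f ((lab Fin.zero , toℕ c) ∷ K)))
    ≡⟨ ∑-allFin m (λ c → Tiers.Lab m (tabulate (λ i → lab (Fin.suc i))) (λ K → f ((lab Fin.zero , c) ∷ K))) ⟩
  Tiers.Lab m (tabulate lab) f ∎)

theorem3p2 : (n m : ℕ) → 2 ≤ m → 2 ≤ n →
    n * m ^ (n ∸ 1) * tieredCount n m ≡ rhsSum n m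
theorem3p2 (suc (suc n″)) m _ (s≤s (s≤s _)) = begin
  suc n′ * m ^ n′ * tieredCount (suc n′) m
    ≡⟨ cong (suc n′ * m ^ n′ *_) (trans (tieredCount-trees n″ m) (sym trees)) ⟩
  -- The root 0 of the parent maps is also the smallest label, as the removal of the root requires.
  suc n′ * m ^ n′ * Counting.Trees m 0 V
    ≡⟨ cong (λ k → suc k * m ^ k * Counting.Trees m 0 V) (sym |V|) ⟩
  suc (length V) * m ^ length V * Counting.Trees m 0 V
    ≡⟨ Counting.Trees-count m 0 V (All.tabulate⁺ {f = λ (i : Fin n′) → suc (toℕ i)} (λ i → s≤s z≤n) ∷ AllPairs.tabulate⁺-< s≤s) ⟩
  Tiers.Lab m (0 ∷ V) (λ K → ∑ K (Tiers.s m) ^ length V)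
    ≡⟨ rhsSum-Lab m 0 V ⟨
  rhsSum (suc (length V)) m
    ≡⟨ cong (λ k → rhsSum (suc k) m) |V| ⟩
  rhsSum (suc n′) m ∎
  where
  n′ = suc n″
  V : List ℕ
  V = tabulate {n = n′} (λ i → suc (toℕ i))
  |V| : length V ≡ n′
  |V| = length-tabulate {n = n′} (λ i → suc (toℕ i))
  trees : Counting.Trees m 0 V ≡
    ∑ (funs (allFin m) (suc n′)) (λ t → Forest.tree w (vertex t Fin.zero) (tabulate (λ v → vertex t (Fin.suc v))))
  trees = sym (begin
    ∑ (funs (allFin m) (suc n′)) (λ t → Forest.tree w (vertex t Fin.zero) (tabulate (λ v → vertex t (Fin.suc v))))
      ≡⟨ ∑-funs-suc (allFin m) n′ _ (λ e → cong₂ (λ c K → Forest.tree w (0 , toℕ c) K) (e Fin.zero)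
           (tabulate-cong (λ v → cong (λ c → suc (toℕ v) , toℕ c) (e (Fin.suc v))))) ⟩
    ∑ (allFin m) (λ c → ∑ (funs (allFin m) n′) (λ t → Forest.tree w (0 , toℕ c) (tabulate (λ v → suc (toℕ v) , toℕ (t v)))))
      ≡⟨ ∑-cong (allFin m) (λ c → Lab-tiers m n′ (λ i → suc (toℕ i)) (Forest.tree w (0 , toℕ c))) ⟨
    ∑ (allFin m) (λ c → Tiers.Lab m V (Forest.tree w (0 , toℕ c)))
      ≡⟨ ∑-allFin m (λ c → Tiers.Lab m V (Forest.tree w (0 , c))) ⟩
    Counting.Trees m 0 V ∎)
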